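{- Let $\mathcal{C}$ be a hereditary class of finite ordered binary structures of type $k$. Then either there is an integer $\ell$ such that every member of $\mathcal{C}$ has a monomorphic decomposition into at most $\ell+1$ blocks, in which case $\mathcal{C}$ is a finite union of ages of ordered binary structures of type $k$, each having a monomorphic decomposition into at most $\ell+1$ blocks, and the profile of $\mathcal{C}$ coincides for all sufficiently large $n$ with a polynomial; or the profile of $\mathcal{C}$ is at least exponential, i.e. there exist $a>0$, $c>1$ with $\varphi_{\mathcal{C}}(n)\ge ac^n$ for all sufficiently large $n$.
   Context: An ordered binary structure of type $k$ is $(E,\le,\rho_1,\dots,\rho_k)$ with $\le$ a linear order and $\rho_i$ binary relations on $E$. A class is hereditary if closed under isomorphism and restrictions. The profile $\varphi_{\mathcal{C}}(n)$ counts members of $\mathcal{C}$ with $n$ elements up to isomorphism. The age of a structure is the class of its finite restrictions up to isomorphism. A monomorphic decomposition of $\mathcal{R}$ is a partition $\mathcal{P}$ of $E$ such that for all finite $A,A'\subseteq E$ with $|A\cap B|=|A'\cap B|$ for every $B\in\mathcal{P}$, $\mathcal{R}_{\restriction A}\cong\mathcal{R}_{\restriction A'}$. -}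

module Defs where

open import Level using (Level; 0ℓ)
open import Data.Bool using (Bool; true; false)
open import Data.Nat using (ℕ; zero; suc)
open import Data.Fin as F using (Fin)
open import Data.Fin.Properties as FP using ()
open import Data.Integer using (+_)
open import Data.Rational as Q using (ℚ; 0ℚ; 1ℚ)
open import Data.List using (List; []; _∷_)
open import Data.Product using (Σ; Σ-syntax; _×_)
open import Function.Bundles using (_⇔_)
open import Function.Definitions using (Bijective)
open import Relation.Nullary using (¬_)
open import Relation.Nullary.Decidable using (⌊_⌋)
open import Relation.Binary.PropositionalEquality using (_≡_)
open import Relation.Binary.Structures using (IsTotalOrder)

record Structure (k : ℕ) : Set₁ where
  field
    Carrier     : Set
    _≤_         : Carrier → Carrier → Set
    isTotalOrder : IsTotalOrder _≡_ _≤_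
    ρ           : Fin k → Carrier → Carrier → Set

_<ₛ_ : ∀ {k} {R : Structure k} → Structure.Carrier R → Structure.Carrier R → Set
_<ₛ_ {R = R} x y = Structure._≤_ R x y × ¬ (x ≡ y)

-- a finite subset A of E of size m, given by its increasing enumeration
-- f : Fin m → E (strictly increasing)
StrictlyIncreasing : ∀ {k} (R : Structure k) {m : ℕ} → (Fin m → Structure.Carrier R) → Set
StrictlyIncreasing R {m} f = ∀ (x y : Fin m) → x F.< y → _<ₛ_ {R = R} (f x) (f y)

-- relational part of an ordered structure on the chain Fin m (order = usual order of Fin m)
RelsOn : ℕ → ℕ → Set₁
RelsOn k m = Fin k → Fin m → Fin m → Set

-- the relational part of the restriction R|A, A = image of f, transported to Fin m
-- along the increasing enumeration f (the order on A is the induced one)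
restrictRels : ∀ {k} (R : Structure k) {m : ℕ} → (Fin m → Structure.Carrier R) → RelsOn k m
restrictRels R f i x y = Structure.ρ R i (f x) (f y)

IsoRels : ∀ {k m} → RelsOn k m → RelsOn k m → Set
IsoRels {k} {m} P Q =
  Σ[ σ ∈ (Fin m → Fin m) ]
    ( Bijective _≡_ _≡_ σ
    × (∀ x y → (x F.≤ y) ⇔ (σ x F.≤ σ y))
    × (∀ i x y → P i x y ⇔ Q i (σ x) (σ y)))

-- Finite ordered binary structures of type k with n elements,
-- represented on the chain Fin n with its usual order.

FinStr : ℕ → ℕ → Set
FinStr k n = Fin k → Fin n → Fin n → Bool

relsOf : ∀ {k n} → FinStr k n → RelsOn k n
relsOf s i x y = s i x y ≡ true

_≅_ : ∀ {k n} → FinStr k n → FinStr k n → Set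
s ≅ t = IsoRels (relsOf s) (relsOf t)

toStructure : ∀ {k n} → FinStr k n → Structure k
toStructure {k} {n} s = record
  { Carrier = Fin n ; _≤_ = F._≤_ ; isTotalOrder = FP.≤-isTotalOrder ; ρ = relsOf s }

restrictFin : ∀ {k n m} → FinStr k n → (Fin m → Fin n) → FinStr k m
restrictFin s f i x y = s i (f x) (f y)

Class : ℕ → Set₁
Class k = (n : ℕ) → FinStr k n → Set

Hereditary : ∀ {k} → Class k → Set
Hereditary {k} C =
    (∀ n (s t : FinStr k n) → C n s → s ≅ t → C n t)
  × (∀ n m (s : FinStr k n) (f : Fin m → Fin n) →
       StrictlyIncreasing (toStructure s) f → C n s → C m (restrictFin s f))

countFin : (m : ℕ) → (Fin m → Bool) → ℕ
countFin zero    p = 0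
countFin (suc m) p with p F.zero
... | true  = suc (countFin m (λ x → p (F.suc x)))
... | false = countFin m (λ x → p (F.suc x))

-- |A ∩ B_j| where A is enumerated by f and B_j = blk⁻¹(j)
countIn : ∀ {k b m} (R : Structure k) → (Structure.Carrier R → Fin b) →
          (Fin m → Structure.Carrier R) → Fin b → ℕ
countIn {m = m} R blk f j = countFin m (λ x → ⌊ blk (f x) F.≟ j ⌋)

-- a partition of E into at most b blocks (labelled by Fin b; empty labels are
-- ignored) which is a monomorphic decomposition of R
MonoDecomp : ∀ {k} → Structure k → ℕ → Set
MonoDecomp R b =
  Σ[ blk ∈ (Structure.Carrier R → Fin b) ]
    (∀ (m : ℕ) (f g : Fin m → Structure.Carrier R) →
       StrictlyIncreasing R f → StrictlyIncreasing R g →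
       (∀ j → countIn R blk f j ≡ countIn R blk g j) →
       IsoRels (restrictRels R f) (restrictRels R g))

InAge : ∀ {k n} → Structure k → FinStr k n → Set
InAge {k} {n} R s =
  Σ[ f ∈ (Fin n → Structure.Carrier R) ]
    (StrictlyIncreasing R f × IsoRels (relsOf s) (restrictRels R f))

HasProfile : ∀ {k} → Class k → ℕ → ℕ → Set
HasProfile {k} C n N =
  Σ[ reps ∈ (Fin N → FinStr k n) ]
    ( (∀ j → C n (reps j))
    × (∀ j j' → reps j ≅ reps j' → j ≡ j')
    × (∀ s → C n s → Σ[ j ∈ Fin N ] (s ≅ reps j)))

ℕtoℚ : ℕ → ℚ
ℕtoℚ n = + n Q./ 1

_^ℚ_ : ℚ → ℕ → ℚ
q ^ℚ zero  = 1ℚ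
q ^ℚ suc n = q Q.* (q ^ℚ n)

evalPoly : List ℚ → ℚ → ℚ
evalPoly []       x = 0ℚ
evalPoly (a ∷ as) x = a Q.+ x Q.* evalPoly as x

{-# OPTIONS --safe #-}

-- Call p a break of a structure on a chain if p and p + 1 are not twins, that is, if their loops
-- differ or some other element relates differently to them.  Cutting at the breaks splits the
-- structure into runs, and a relation between two elements depends only on their runs and on
-- their order.  Hence few breaks give a monomorphic decomposition into runs.  Conversely, if b
-- blocks suffice, then among three breaks p with the same labels of p and p + 1 the middle one
-- would be a twin, so there are at most 2b² breaks.
--
-- If the number of breaks is unbounded, pick ⌊n/2⌋ breaks p, each with an element z telling p
-- from p + 1, such that the pairs {p , p + 1} and the elements z do not interfere.  Independently
-- moving each p to p + 1 in an n-element subset containing all p and z yields 2^⌊n/2⌋ structures.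
--
-- If it is bounded, a structure is a finite table together with the vector m of its run lengths.
-- For a fixed table the admissible m form a down-closed subset of ℕᴷ.  Such a set is a finite
-- union of boxes, each of which is the age of a sum of finite chains and copies of ω, and a
-- compactness argument decomposes that sum.  For the profile one counts each structure once by
-- requiring that every boundary between runs is a break; this is an up-closed condition on m.
-- Slicing shows that the m of size n in an intersection of a down-closed and an up-closed set are
-- counted by an eventually polynomial function.
module Submission where

open import Defs
open import Level using (Level; 0ℓ)
open import Axiom.ExcludedMiddle using (ExcludedMiddle)
open import Data.Bool using (Bool; true; false; not; if_then_else_; _∨_; T)
import Data.Bool.Properties as BP
open import Data.Empty using (⊥; ⊥-elim)
open import Data.Fin as F using (Fin; toℕ; fromℕ<; finToFun; funToFin; splitAt)
import Data.Fin.Properties as FP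
import Data.Integer as ℤ
import Data.Integer.Properties as ℤP
open import Data.List as List using (List; []; _∷_; _++_; length; filter; tabulate)
import Data.List.Properties as LP
open import Data.List.Membership.Propositional using (_∈_)
open import Data.List.Membership.Propositional.Properties
  using (∈-++⁺ˡ; ∈-++⁺ʳ; ∈-++⁻; ∈-map⁺; ∈-map⁻; ∈-lookup)
open import Data.List.Relation.Binary.Pointwise as LPw using ([]; _∷_)
open import Data.List.Relation.Unary.All as All using (All; []; _∷_)
import Data.List.Relation.Unary.All.Properties as AllP
open import Data.List.Relation.Unary.AllPairs using (AllPairs; []; _∷_)
import Data.List.Relation.Unary.AllPairs.Properties as APP
open import Data.List.Relation.Unary.Any as Any using (here)
open import Data.List.Relation.Unary.Any.Properties using (lookup-index)
open import Data.Maybe using (Maybe; just; nothing)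
open import Data.Nat as ℕ
  using (ℕ; zero; suc; _+_; _*_; _∸_; _^_; _⊔_; _≤_; z≤n; s≤s; s≤s⁻¹; _≡ᵇ_; ⌊_/2⌋)
open import Data.Nat.ListAction using (sum)
open import Data.Nat.Properties as ℕP
open import Data.Product using (Σ; Σ-syntax; _×_; _,_; proj₁; proj₂; ∃; ∃₂)
open import Data.Rational as ℚ using (ℚ; 0ℚ; 1ℚ; _<_) renaming (_≤_ to _≤ℚ_; _*_ to _*ℚ_)
import Data.Rational.Properties as ℚP
open import Data.Rational.Solver using (module +-*-Solver)
import Data.Rational.Unnormalised as ℚᵘ
import Data.Rational.Unnormalised.Properties as ℚᵘP
open import Data.Sum using (_⊎_; inj₁; inj₂; [_,_]′)
open import Data.Unit using (⊤; tt)
open import Data.Vec as Vec using (Vec; []; _∷_; toList; fromList)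
import Data.Vec.Properties as VecP
open import Data.Vec.Relation.Binary.Pointwise.Inductive as VPw using ([]; _∷_)
open import Function using (_∘_; id)
open import Function.Bundles using (_⇔_; mk⇔; Equivalence; Inverse)
open import Relation.Binary.Definitions using (tri<; tri≈; tri>)
open import Relation.Binary.PropositionalEquality
open import Relation.Binary.Structures using (IsTotalOrder)
open import Relation.Nullary using (¬_; Dec; yes; no; ¬?)
open import Relation.Nullary.Decidable using (⌊_⌋; decidable-stable; toWitness)

open Equivalence using (to; from)
open +-*-Solver using (solve; con; _:=_; _:+_; _:*_; _:-_; :-_)

-- The blocks of a monomorphic decomposition need not be intervals, so on their own they do not
-- present a member as a word of runs. Breaks do: they are intrinsic to the structure, and the runs
-- between them are intervals. The price is the number of pieces, since `ℓ + 1` blocks bound the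
-- breaks only quadratically. Runs therefore serve to present and count the members, while the
-- `ℓ + 1` blocks required of the infinite structures are recovered by compactness from the
-- decompositions of their finite parts. A finite chain has no automorphism but the identity, so
-- isomorphic structures on `Fin n` agree entry by entry. Counting up to isomorphism thus becomes
-- counting presentations in a normal form, and the normal form has to be chosen so that the set of
-- its length vectors remains accessible to slicing.

EM : Set₁
EM = ExcludedMiddle 0ℓ

-- Rigidity of finite chains

Increasing : ∀ {m} → (Fin m → ℕ) → Set
Increasing f = ∀ x y → x F.< y → f x ℕ.< f y

increasing-≥ : ∀ {m} (f : Fin (suc m) → ℕ) → Increasing f → ∀ x → f F.zero + toℕ x ≤ f x
increasing-≥ f inc F.zero = ≤-reflexive (+-identityʳ _)
increasing-≥ {suc m} f inc (F.suc x) = begin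
  f F.zero + suc (toℕ x)   ≡⟨ +-suc (f F.zero) (toℕ x) ⟩
  suc (f F.zero) + toℕ x   ≤⟨ +-monoˡ-≤ (toℕ x) (inc F.zero (F.suc F.zero) (s≤s z≤n)) ⟩
  f (F.suc F.zero) + toℕ x ≤⟨ increasing-≥ (f ∘ F.suc) (λ x y p → inc (F.suc x) (F.suc y) (s≤s p)) x ⟩
  f (F.suc x)              ∎
  where open ≤-Reasoning

increasing-inflationary : ∀ {m} (f : Fin m → ℕ) → Increasing f → ∀ x → toℕ x ≤ f x
increasing-inflationary {suc m} f inc x = ≤-trans (m≤n+m (toℕ x) (f F.zero)) (increasing-≥ f inc x)

-- Both `σ` and its inverse `τ` are strictly increasing, hence inflationary, which forces `σ` to be
-- the identity. From here on isomorphism of structures on `Fin n` is pointwise equality.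
iso-id : ∀ {k m} {P Q : RelsOn k m} → IsoRels P Q → ∀ i x y → P i x y ⇔ Q i x y
iso-id {k} {m} {P} {Q} (σ , (σ-inj , σ-surj) , mono , rels) i x y =
  subst₂ (λ a b → P i x y ⇔ Q i a b) (σ-id x) (σ-id y) (rels i x y)
  where
  τ : Fin m → Fin m
  τ y = proj₁ (σ-surj y)
  στ : ∀ y → σ (τ y) ≡ y
  στ y = proj₂ (σ-surj y) refl
  σ-inc : Increasing (toℕ ∘ σ)
  σ-inc x y x<y = ≤∧≢⇒< (to (mono x y) (<⇒≤ x<y))
    (λ eq → <⇒≢ x<y (cong toℕ (σ-inj (FP.toℕ-injective eq))))
  τ-inc : Increasing (toℕ ∘ τ)
  τ-inc x y x<y = ≰⇒> λ τy≤τx →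
    <⇒≱ x<y (subst₂ F._≤_ (στ y) (στ x) (to (mono (τ y) (τ x)) τy≤τx))
  σ-id : ∀ x → σ x ≡ x
  σ-id x = FP.toℕ-injective (≤-antisym
    (subst (λ z → toℕ (σ x) ≤ toℕ z) (σ-injτ x) (increasing-inflationary _ τ-inc (σ x)))
    (increasing-inflationary _ σ-inc x))
    where
    σ-injτ : ∀ x → τ (σ x) ≡ x
    σ-injτ x = σ-inj (στ (σ x))

id-iso : ∀ {k m} {P Q : RelsOn k m} → (∀ i x y → P i x y ⇔ Q i x y) → IsoRels P Q
id-iso eq = id , (id , λ y → y , id) , (λ _ _ → mk⇔ id id) , eq

bool-ext : ∀ {a b : Bool} → (a ≡ true ⇔ b ≡ true) → a ≡ b
bool-ext {false} {false} eq = refl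
bool-ext {false} {true}  eq = from eq refl
bool-ext {true}  {b}     eq = sym (to eq refl)

≡⇒⇔true : ∀ {a b : Bool} → a ≡ b → (a ≡ true ⇔ b ≡ true)
≡⇒⇔true refl = mk⇔ id id

_≗ₛ_ : ∀ {k n} → FinStr k n → FinStr k n → Set
s ≗ₛ t = ∀ i x y → s i x y ≡ t i x y

≅⇒≗ : ∀ {k n} (s t : FinStr k n) → s ≅ t → s ≗ₛ t
≅⇒≗ s t iso i x y = bool-ext (iso-id iso i x y)

≗⇒≅ : ∀ {k n} {s t : FinStr k n} → s ≗ₛ t → s ≅ t
≗⇒≅ eq = id-iso λ i x y → ≡⇒⇔true (eq i x y)

-- HasProfile C n is Enum _≅_ (C n).
Enum : {A : Set} → (A → A → Set) → (A → Set) → ℕ → Set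
Enum {A} _~_ P N =
  Σ[ reps ∈ (Fin N → A) ]
    ( (∀ j → P (reps j))
    × (∀ j j' → reps j ~ reps j' → j ≡ j')
    × (∀ a → P a → Σ[ j ∈ Fin N ] (a ~ reps j)))

-- Finite codes, enumerations and subsets

record Coded (A : Set) (_~_ : A → A → Set) : Set where
  field
    size          : ℕ
    decode        : Fin size → A
    encode        : A → Fin size
    decode-encode : ∀ a → decode (encode a) ~ a
    decode-inj    : ∀ c c' → decode c ~ decode c' → c ≡ c'

boolCoded : Coded Bool _≡_
boolCoded = record
  { size = 2 ; decode = Inverse.to FP.2↔Bool ; encode = Inverse.from FP.2↔Bool
  ; decode-encode = λ { false → refl ; true → refl }
  ; decode-inj = λ { F.zero F.zero _ → refl ; F.zero (F.suc F.zero) () ; (F.suc F.zero) F.zero () ; (F.suc F.zero) (F.suc F.zero) _ → refl } }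

funToFin-cong : ∀ {m n} {f g : Fin m → Fin n} → (∀ x → f x ≡ g x) → funToFin f ≡ funToFin g
funToFin-cong {zero}  eq = refl
funToFin-cong {suc m} eq = cong₂ F.combine (eq F.zero) (funToFin-cong (eq ∘ F.suc))

-- Function extensionality is not assumed, so a function type is finite only up to pointwise
-- equality. This is why `Coded` carries a relation instead of using `_≡_`.
funCoded : ∀ {A _~_} m → Coded A _~_ → Coded (Fin m → A) (λ f g → ∀ x → f x ~ g x)
funCoded {A} {_~_} m c = record
  { size = size ^ m
  ; decode = λ e x → decode (finToFun e x)
  ; encode = λ f → funToFin (encode ∘ f)
  ; decode-encode = λ f x → subst (λ e → decode e ~ f x)
      (sym (FP.finToFun-funToFin (encode ∘ f) x)) (decode-encode (f x))
  ; decode-inj = λ c c' eq → trans (sym (FP.funToFin-finToFin {m} c)) (trans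
      (funToFin-cong λ x → decode-inj _ _ (eq x)) (FP.funToFin-finToFin {m} c')) }
  where open Coded c

strCoded : ∀ k n → Coded (FinStr k n) _≗ₛ_
strCoded k n = funCoded k (funCoded n (funCoded n boolCoded))

module Enumeration (em : EM) {A : Set} {_~_ : A → A → Set}
                   (~-sym : ∀ {a b} → a ~ b → b ~ a) (P : A → Set) where

  -- Excluded middle decides whether the head satisfies `P` and whether it is already represented;
  -- only a new element of `P` is added.
  enum-image : ∀ X (r : Fin X → A) →
    Σ[ N ∈ ℕ ] Σ[ reps ∈ (Fin N → A) ]
      ( (∀ j → P (reps j))
      × (∀ j j' → reps j ~ reps j' → j ≡ j')
      × (∀ x → P (r x) → (r x ~ r x) → Σ[ j ∈ Fin N ] (r x ~ reps j)))
  enum-image zero r = 0 , (λ ()) , (λ ()) , (λ ()) , λ ()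
  enum-image (suc X) r with enum-image X (r ∘ F.suc)
  ... | N , reps , valid , inj , cover
      with em {P (r F.zero)} | em {Σ[ j ∈ Fin N ] (r F.zero ~ reps j)}
  ... | no ¬p | _ = N , reps , valid , inj ,
        λ { F.zero p _ → ⊥-elim (¬p p) ; (F.suc x) → cover x }
  ... | yes p | yes old = N , reps , valid , inj ,
        λ { F.zero _ _ → old ; (F.suc x) → cover x }
  ... | yes p | no new = suc N , reps' , valid' , inj' , cover'
    where
    reps' : Fin (suc N) → A
    reps' F.zero    = r F.zero
    reps' (F.suc j) = reps j
    valid' : ∀ j → P (reps' j)
    valid' F.zero    = p
    valid' (F.suc j) = valid j
    inj' : ∀ j j' → reps' j ~ reps' j' → j ≡ j'
    inj' F.zero    F.zero     _  = refl
    inj' F.zero    (F.suc j') eq = ⊥-elim (new (j' , eq))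
    inj' (F.suc j) F.zero     eq = ⊥-elim (new (j , ~-sym eq))
    inj' (F.suc j) (F.suc j') eq = cong F.suc (inj j j' eq)
    cover' : ∀ x → P (r x) → r x ~ r x → Σ[ j ∈ Fin (suc N) ] (r x ~ reps' j)
    cover' F.zero    _  r~r = F.zero , r~r
    cover' (F.suc x) px r~r with cover x px r~r
    ... | j , eq = F.suc j , eq

countFin-true : ∀ m (χ : Fin (suc m) → Bool) → χ F.zero ≡ true →
  countFin (suc m) χ ≡ suc (countFin m (χ ∘ F.suc))
countFin-true m χ eq with χ F.zero | eq
... | true | refl = refl

countFin-false : ∀ m (χ : Fin (suc m) → Bool) → χ F.zero ≡ false →
  countFin (suc m) χ ≡ countFin m (χ ∘ F.suc)
countFin-false m χ eq with χ F.zero | eq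
... | false | refl = refl

false≢true : ¬ (false ≡ true)
false≢true ()

record SubsetEnum (m : ℕ) (χ : Fin m → Bool) : Set where
  field
    size       : ℕ
    size≡      : countFin m χ ≡ size
    elem       : Fin size → Fin m
    elem-inc   : ∀ x y → x F.< y → elem x F.< elem y
    elem-sound : ∀ x → χ (elem x) ≡ true
    elem-onto  : ∀ y → χ y ≡ true → Σ[ x ∈ Fin size ] elem x ≡ y

subsetEnum : ∀ m χ → SubsetEnum m χ
subsetEnum zero χ = record
  { size = 0 ; size≡ = refl
  ; elem = λ () ; elem-inc = λ () ; elem-sound = λ () ; elem-onto = λ () }
subsetEnum (suc m) χ with χ F.zero in eq | subsetEnum m (χ ∘ F.suc)
... | false | S = record
  { size = size
  ; size≡ = trans (countFin-false m χ eq) size≡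
  ; elem = F.suc ∘ elem
  ; elem-inc = λ x y p → s≤s (elem-inc x y p)
  ; elem-sound = elem-sound
  ; elem-onto = λ { F.zero p → ⊥-elim (false≢true (trans (sym eq) p))
                  ; (F.suc y) p → let (x , q) = elem-onto y p in x , cong F.suc q } }
  where open SubsetEnum S
... | true | S = record
  { size = suc size
  ; size≡ = trans (countFin-true m χ eq) (cong suc size≡)
  ; elem = λ { F.zero → F.zero ; (F.suc x) → F.suc (elem x) }
  ; elem-inc = λ { F.zero (F.suc y) p → s≤s z≤n ; (F.suc x) (F.suc y) (s≤s p) → s≤s (elem-inc x y p) }
  ; elem-sound = λ { F.zero → eq ; (F.suc x) → elem-sound x }
  ; elem-onto = λ { F.zero p → F.zero , refl
                  ; (F.suc y) p → let (x , q) = elem-onto y p in F.suc x , cong F.suc q } }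
  where open SubsetEnum S

countFin-cong : ∀ m {χ χ' : Fin m → Bool} → (∀ x → χ x ≡ χ' x) → countFin m χ ≡ countFin m χ'
countFin-cong zero eq = refl
countFin-cong (suc m) {χ} {χ'} eq with χ F.zero | χ' F.zero | eq F.zero
... | true  | .true  | refl = cong suc (countFin-cong m (eq ∘ F.suc))
... | false | .false | refl = countFin-cong m (eq ∘ F.suc)

countFin-mono : ∀ m {χ χ' : Fin m → Bool} → (∀ x → χ x ≡ true → χ' x ≡ true) →
  countFin m χ ≤ countFin m χ'
countFin-mono zero sub = z≤n
countFin-mono (suc m) {χ} {χ'} sub with χ F.zero | χ' F.zero | sub F.zero
... | true  | true  | _ = s≤s (countFin-mono m (sub ∘ F.suc))
... | true  | false | h = ⊥-elim (false≢true (h refl))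
... | false | true  | _ = m≤n⇒m≤1+n (countFin-mono m (sub ∘ F.suc))
... | false | false | _ = countFin-mono m (sub ∘ F.suc)

countFin-∪ : ∀ m {χ χ₁ χ₂ : Fin m → Bool} →
  (∀ x → χ x ≡ true → χ₁ x ≡ true ⊎ χ₂ x ≡ true) →
  countFin m χ ≤ countFin m χ₁ + countFin m χ₂
countFin-∪ zero sub = z≤n
countFin-∪ (suc m) {χ} {χ₁} {χ₂} sub with χ F.zero | χ₁ F.zero | χ₂ F.zero | sub F.zero
... | true | true | true | _ = s≤s (≤-trans (countFin-∪ m (sub ∘ F.suc)) (+-monoʳ-≤ _ (n≤1+n _)))
... | true | true | false | _ = s≤s (countFin-∪ m (sub ∘ F.suc))
... | true | false | true | _ = ≤-trans (s≤s (countFin-∪ m (sub ∘ F.suc))) (≤-reflexive (sym (+-suc _ _)))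
... | true | false | false | h with h refl
...   | inj₁ ()
...   | inj₂ ()
countFin-∪ (suc m) sub | false | true | true | _ =
  ≤-trans (countFin-∪ m (sub ∘ F.suc)) (m≤n⇒m≤1+n (+-monoʳ-≤ _ (n≤1+n _)))
countFin-∪ (suc m) sub | false | true | false | _ = m≤n⇒m≤1+n (countFin-∪ m (sub ∘ F.suc))
countFin-∪ (suc m) sub | false | false | true | _ =
  ≤-trans (countFin-∪ m (sub ∘ F.suc)) (+-monoʳ-≤ _ (n≤1+n _))
countFin-∪ (suc m) sub | false | false | false | _ = countFin-∪ m (sub ∘ F.suc)

profile-exists : EM → ∀ {k} (C : Class k) → Hereditary C → ∀ n → Σ[ N ∈ ℕ ] HasProfile C n N
profile-exists em {k} C (closed , _) n
  with Enumeration.enum-image em {A = FinStr k n} {_~_ = _≅_}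
         (λ {s} {t} p → ≗⇒≅ λ i x y → sym (≅⇒≗ s t p i x y)) (C n) _ decode
  where open Coded (strCoded k n)
... | N , reps , valid , inj , cover = N , reps , valid , inj , cover'
  where
  open Coded (strCoded k n)
  cover' : ∀ s → C n s → Σ[ j ∈ Fin N ] (s ≅ reps j)
  cover' s Cs with cover (encode s) (closed n s _ Cs s≅) (≗⇒≅ λ _ _ _ → refl)
    where
    s≅ : s ≅ decode (encode s)
    s≅ = ≗⇒≅ λ i x y → sym (decode-encode s i x y)
  ... | j , eq = j , ≗⇒≅ λ i x y →
    trans (sym (decode-encode s i x y)) (≅⇒≗ _ (reps j) eq i x y)

-- Breaks and twins

-- Relations on all of ℕ, of which only the part below a separately given `n` is meaningful.
-- Positions can then be shifted and embedded without bounds in their types.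
NatStr : ℕ → Set
NatStr k = Fin k → ℕ → ℕ → Bool

fin : ∀ {k} n → NatStr k → FinStr k n
fin n g i x y = g i (toℕ x) (toℕ y)

ext : ∀ {k n} → FinStr k n → NatStr k
ext {n = n} s i x y with x <? n | y <? n
... | yes p | yes q = s i (fromℕ< p) (fromℕ< q)
... | _     | _     = false

fin-ext : ∀ {k n} (s : FinStr k n) → fin n (ext s) ≗ₛ s
fin-ext {n = n} s i x y with toℕ x <? n | toℕ y <? n
... | yes p | yes q = cong₂ (s i) (FP.fromℕ<-toℕ x p) (FP.fromℕ<-toℕ y q)
... | no ¬p | _     = ⊥-elim (¬p (FP.toℕ<n x))
... | yes _ | no ¬q = ⊥-elim (¬q (FP.toℕ<n y))

_≈[_]_ : ∀ {k} → NatStr k → ℕ → NatStr k → Set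
g ≈[ n ] g' = ∀ i x y → x ℕ.< n → y ℕ.< n → g i x y ≡ g' i x y

≗⇒≈ : ∀ {k n} {g g' : NatStr k} → fin n g ≗ₛ fin n g' → g ≈[ n ] g'
≗⇒≈ {g = g} {g'} eq i x y p q =
  subst₂ (λ x y → g i x y ≡ g' i x y) (FP.toℕ-fromℕ< p) (FP.toℕ-fromℕ< q) (eq i (fromℕ< p) (fromℕ< q))

<⇒inc : ∀ {k n m} (s : FinStr k n) {f : Fin m → Fin n} → (∀ x y → x F.< y → f x F.< f y) →
  StrictlyIncreasing (toStructure s) f
<⇒inc s inc x y p = <⇒≤ (inc x y p) , λ e → <⇒≢ (inc x y p) (cong toℕ e)

module _ {k : ℕ} {C : Class k} (her : Hereditary C) where

  member-≗ : ∀ {n} {s t : FinStr k n} → s ≗ₛ t → C n s → C n t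
  member-≗ {n} eq = λ Cs → proj₁ her n _ _ Cs (≗⇒≅ eq)

  member-≈ : ∀ {n g g'} → g ≈[ n ] g' → C n (fin n g) → C n (fin n g')
  member-≈ eq = member-≗ λ i x y → eq i _ _ (FP.toℕ<n x) (FP.toℕ<n y)

  member-increasing : ∀ {m n} g (f : Fin m → ℕ) → (∀ x → f x ℕ.< n) → Increasing f →
    C n (fin n g) → C m (λ i x y → g i (f x) (f y))
  member-increasing {m} {n} g f f<n f-inc Cg =
    member-≗ (λ i x y → cong₂ (g i) (toℕ-f' x) (toℕ-f' y)) (proj₂ her n m (fin n g) f' (<⇒inc (fin n g) inc) Cg)
    where
    f' : Fin m → Fin n
    f' x = fromℕ< (f<n x)
    toℕ-f' : ∀ x → toℕ (f' x) ≡ f x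
    toℕ-f' x = FP.toℕ-fromℕ< (f<n x)
    inc : ∀ x y → x F.< y → f' x F.< f' y
    inc x y x<y = subst₂ ℕ._<_ (sym (toℕ-f' x)) (sym (toℕ-f' y)) (f-inc x y x<y)

  member-restrict : ∀ {m n} g (f : ℕ → ℕ) → (∀ x → x ℕ.< m → f x ℕ.< n) →
    (∀ x y → x ℕ.< y → y ℕ.< m → f x ℕ.< f y) →
    C n (fin n g) → C m (fin m (λ i x y → g i (f x) (f y)))
  member-restrict g f f<n f-inc = member-increasing g (f ∘ toℕ) (λ x → f<n _ (FP.toℕ<n x))
    (λ x y x<y → f-inc _ _ x<y (FP.toℕ<n y))

-- Orientation of a pair of positions: 0, 1, 2 for <, =, >.
cmp : ℕ → ℕ → Fin 3
cmp zero    zero    = F.suc F.zero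
cmp zero    (suc y) = F.zero
cmp (suc x) zero    = F.suc (F.suc F.zero)
cmp (suc x) (suc y) = cmp x y

cmp-< : ∀ {x y} → x ℕ.< y → cmp x y ≡ F.zero
cmp-< {zero}  {suc y} p       = refl
cmp-< {suc x} {suc y} (s≤s p) = cmp-< p

cmp-> : ∀ {x y} → y ℕ.< x → cmp x y ≡ F.suc (F.suc F.zero)
cmp-> {suc x} {zero}  p       = refl
cmp-> {suc x} {suc y} (s≤s p) = cmp-> p

cmp≡0⇒< : ∀ x y → cmp x y ≡ F.zero → x ℕ.< y
cmp≡0⇒< zero    (suc y) e = s≤s z≤n
cmp≡0⇒< (suc x) (suc y) e = s≤s (cmp≡0⇒< x y e)

cmp-refl : ∀ x → cmp x x ≡ F.suc F.zero
cmp-refl zero    = refl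
cmp-refl (suc x) = cmp-refl x

cmp-mono : ∀ (P : ℕ → Set) (f : ℕ → ℕ) → (∀ x y → x ℕ.< y → P y → f x ℕ.< f y) →
  ∀ x y → P x → P y → cmp (f x) (f y) ≡ cmp x y
cmp-mono P f inc x y px py with <-cmp x y
... | tri< p _ _    = trans (cmp-< (inc x y p py)) (sym (cmp-< p))
... | tri≈ _ refl _ = trans (cmp-refl (f x)) (sym (cmp-refl x))
... | tri> _ _ p    = trans (cmp-> (inc y x p px)) (sym (cmp-> p))

cmp-suc : ∀ x z → z ≢ x → z ≢ suc x → cmp x z ≡ cmp (suc x) z × cmp z x ≡ cmp z (suc x)
cmp-suc x z z≢x z≢x' with <-cmp x z
... | tri< p _ _    = let q = ≤∧≢⇒< p (≢-sym z≢x') in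
  trans (cmp-< p) (sym (cmp-< q)) , trans (cmp-> p) (sym (cmp-> q))
... | tri≈ _ eq _   = ⊥-elim (z≢x (sym eq))
... | tri> _ _ p    = let q = m<n⇒m<1+n p in
  trans (cmp-> p) (sym (cmp-> q)) , trans (cmp-< p) (sym (cmp-< q))

-- When the loops at p and p + 1 differ, z is a dummy and may be ≥ n.
Distinguishes : ∀ {k} → ℕ → NatStr k → ℕ → ℕ → Set
Distinguishes {k} n g p z = Σ[ i ∈ Fin k ]
  ( g i p p ≢ g i (suc p) (suc p)
  ⊎ z ℕ.< n × (g i p z ≢ g i (suc p) z ⊎ g i z p ≢ g i z (suc p)))

Break : ∀ {k} → ℕ → NatStr k → ℕ → Set
Break n g p = Σ[ z ∈ ℕ ] (z ≢ p × z ≢ suc p × Distinguishes n g p z)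

Break-≈ : ∀ {k n p} {g g' : NatStr k} → g ≈[ n ] g' → suc p ℕ.< n → Break n g p → Break n g' p
Break-≈ {n = n} {p} {g} {g'} eq q (z , z≢p , z≢q , i , d) = z , z≢p , z≢q , i , d' d
  where
  p<n : p ℕ.< n
  p<n = <-trans (n<1+n p) q
  d' : _ ⊎ _ → _ ⊎ _
  d' (inj₁ h) = inj₁ (subst₂ _≢_ (eq i _ _ p<n p<n) (eq i _ _ q q) h)
  d' (inj₂ (z<n , inj₁ h)) = inj₂ (z<n , inj₁ (subst₂ _≢_ (eq i _ _ p<n z<n) (eq i _ _ q z<n) h))
  d' (inj₂ (z<n , inj₂ h)) = inj₂ (z<n , inj₂ (subst₂ _≢_ (eq i _ _ z<n p<n) (eq i _ _ z<n q) h))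

module _ {k n : ℕ} (g : NatStr k) {p : ℕ} (twin : ¬ Break n g p) where

  twin-loop : ∀ i → g i p p ≡ g i (suc p) (suc p)
  twin-loop i = decidable-stable (_ BP.≟ _) λ h →
    twin (suc (suc p) , 1+n≢p , 1+n≢n , i , inj₁ h)
    where
    1+n≢p : suc (suc p) ≢ p
    1+n≢p eq = <⇒≢ (m≤n⇒m≤1+n (n<1+n p)) (sym eq)

  twin-row : ∀ i z → z ℕ.< n → z ≢ p → z ≢ suc p → g i p z ≡ g i (suc p) z
  twin-row i z z<n z≢p z≢q = decidable-stable (_ BP.≟ _) λ h →
    twin (z , z≢p , z≢q , i , inj₂ (z<n , inj₁ h))

  twin-column : ∀ i z → z ℕ.< n → z ≢ p → z ≢ suc p → g i z p ≡ g i z (suc p)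
  twin-column i z z<n z≢p z≢q = decidable-stable (_ BP.≟ _) λ h →
    twin (z , z≢p , z≢q , i , inj₂ (z<n , inj₂ h))

-- Since `lab` is nondecreasing, two positions with equal labels have only that label between them,
-- and so are joined by a sequence of adjacent twins.
module Factor {k : ℕ} (n : ℕ) (g : NatStr k) (lab : ℕ → ℕ)
  (mono : ∀ x → lab x ≤ lab (suc x))
  (twins : ∀ x → suc x ℕ.< n → lab x ≡ lab (suc x) → ¬ Break n g x) where

  lab-mono : ∀ x d → lab x ≤ lab (x + d)
  lab-mono x zero    = ≤-reflexive (cong lab (sym (+-identityʳ x)))
  lab-mono x (suc d) = ≤-trans (lab-mono x d) (≤-trans (mono (x + d))
    (≤-reflexive (cong lab (sym (+-suc x d)))))

  squeeze : ∀ x d → lab x ≡ lab (x + suc d) →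
    lab x ≡ lab (x + d) × lab (x + d) ≡ lab (suc (x + d))
  squeeze x d eq = lx , trans (sym lx) (trans eq (cong lab (+-suc x d)))
    where
    lx : lab x ≡ lab (x + d)
    lx = ≤-antisym (lab-mono x d) (≤-trans (mono (x + d))
      (≤-reflexive (trans (cong lab (sym (+-suc x d))) (sym eq))))

  loop+ : ∀ i x d → x + d ℕ.< n → lab x ≡ lab (x + d) → g i x x ≡ g i (x + d) (x + d)
  loop+ i x zero    _ _  = cong₂ (g i) (sym (+-identityʳ x)) (sym (+-identityʳ x))
  loop+ i x (suc d) p eq with squeeze x d eq
  ... | e₁ , e₂ = trans (loop+ i x d (<-trans (n<1+n _) p') e₁)
      (trans (twin-loop g (twins (x + d) p' e₂) i) (cong₂ (g i) (sym (+-suc x d)) (sym (+-suc x d))))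
    where
    p' : suc (x + d) ℕ.< n
    p' = subst (ℕ._< n) (+-suc x d) p

  -- Being twins says nothing about the relations between the two twins themselves, so `z` has to
  -- lie outside the interval that the moving end sweeps over.
  move+ : ∀ i x d z → x + d ℕ.< n → z ℕ.< n → lab x ≡ lab (x + d) → z ℕ.< x ⊎ x + d ℕ.< z →
    g i x z ≡ g i (x + d) z × g i z x ≡ g i z (x + d)
  move+ i x zero    z _ _ _ _ = cong (λ x → g i x z) (sym (+-identityʳ x)) , cong (g i z) (sym (+-identityʳ x))
  move+ i x (suc d) z p z<n eq side with squeeze x d eq
  ... | e₁ , e₂ = let (r , c) = move+ i x d z (<-trans (n<1+n _) p') z<n e₁ (side' side) in
      trans r (trans (twin-row g tw i z z<n ≢₁ ≢₂) (cong (λ x → g i x z) (sym (+-suc x d))))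
    , trans c (trans (twin-column g tw i z z<n ≢₁ ≢₂) (cong (g i z) (sym (+-suc x d))))
    where
    p' : suc (x + d) ℕ.< n
    p' = subst (ℕ._< n) (+-suc x d) p
    tw = twins (x + d) p' e₂
    side' : z ℕ.< x ⊎ x + suc d ℕ.< z → z ℕ.< x ⊎ x + d ℕ.< z
    side' (inj₁ q) = inj₁ q
    side' (inj₂ q) = inj₂ (<-trans (n<1+n _) (subst (ℕ._< z) (+-suc x d) q))
    apart : ∀ {y} → x ≤ y → y ≤ x + suc d → z ℕ.< x ⊎ x + suc d ℕ.< z → z ≢ y
    apart x≤y _ (inj₁ q) eq = <⇒≱ q (≤-trans x≤y (≤-reflexive (sym eq)))
    apart _ y≤ (inj₂ q) eq = <⇒≱ q (≤-trans (≤-reflexive eq) y≤)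
    ≢₁ : z ≢ x + d
    ≢₁ = apart (m≤m+n x d) (+-monoʳ-≤ x (n≤1+n d)) side
    ≢₂ : z ≢ suc (x + d)
    ≢₂ = apart (m≤n⇒m≤1+n (m≤m+n x d)) (≤-reflexive (sym (+-suc x d))) side

  loop-≤ : ∀ i {x x'} → x ≤ x' → x' ℕ.< n → lab x ≡ lab x' → g i x x ≡ g i x' x'
  loop-≤ i {x} {x'} x≤x' p eq = subst (λ x' → x' ℕ.< n → lab x ≡ lab x' → g i x x ≡ g i x' x')
    (m+[n∸m]≡n x≤x') (loop+ i x (x' ∸ x)) p eq

  move-≤ : ∀ i {x x'} z → x ≤ x' → x' ℕ.< n → z ℕ.< n → lab x ≡ lab x' → z ℕ.< x ⊎ x' ℕ.< z →
    g i x z ≡ g i x' z × g i z x ≡ g i z x'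
  move-≤ i {x} {x'} z x≤x' p q eq side =
    subst (λ x' → x' ℕ.< n → z ℕ.< n → lab x ≡ lab x' → z ℕ.< x ⊎ x' ℕ.< z →
      g i x z ≡ g i x' z × g i z x ≡ g i z x')
      (m+[n∸m]≡n x≤x') (λ p q → move+ i x (x' ∸ x) z p q) p q eq side

  loops : ∀ i {x x'} → x ℕ.< n → x' ℕ.< n → lab x ≡ lab x' → g i x x ≡ g i x' x'
  loops i {x} {x'} p p' eq with ≤-total x x'
  ... | inj₁ q = loop-≤ i q p' eq
  ... | inj₂ q = sym (loop-≤ i q p (sym eq))

  -- Ends that move outwards never meet each other, whereas ends that move inwards might. Two
  -- arbitrary pairs are therefore compared in `ordered` through the pair with the smaller left end
  -- and the larger right end.
  spread : ∀ i {x y x' y'} → x' ≤ x → x ℕ.< y → y ≤ y' → y' ℕ.< n →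
    lab x ≡ lab x' → lab y ≡ lab y' → g i x y ≡ g i x' y' × g i y x ≡ g i y' x'
  spread i {x} {y} {x'} {y'} x'≤x x<y y≤y' y'<n ex ey =
    let (r₁ , c₁) = move-≤ i y x'≤x (<-trans x<y y<n) y<n (sym ex) (inj₂ x<y)
        (r₂ , c₂) = move-≤ i x' y≤y' y'<n x'<n ey (inj₁ (≤-<-trans x'≤x x<y))
    in trans (sym r₁) c₂ , trans (sym c₁) r₂
    where
    y<n = ≤-<-trans y≤y' y'<n
    x'<n = <-trans (≤-<-trans x'≤x x<y) y<n

  ordered : ∀ i {x y x' y'} → x ℕ.< y → y ℕ.< n → x' ℕ.< y' → y' ℕ.< n →
    lab x ≡ lab x' → lab y ≡ lab y' → g i x y ≡ g i x' y' × g i y x ≡ g i y' x'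
  ordered i {x} {y} {x'} {y'} x<y y<n x'<y' y'<n ex ey with ≤-total x x' | ≤-total y y'
  ... | inj₁ p | inj₁ q =
    let (r , c) = spread i {x} {y} ≤-refl x<y q y'<n refl ey
        (r' , c') = spread i {x'} {y'} p x'<y' ≤-refl y'<n (sym ex) refl
    in trans r (sym r') , trans c (sym c')
  ... | inj₁ p | inj₂ q =
    let (r , c) = spread i {x'} {y'} p x'<y' q y<n (sym ex) (sym ey) in sym r , sym c
  ... | inj₂ p | inj₁ q = spread i p x<y q y'<n ex ey
  ... | inj₂ p | inj₂ q =
    let (r , c) = spread i {x} {y} p x<y ≤-refl y<n ex refl
        (r' , c') = spread i {x'} {y'} ≤-refl x'<y' q y<n refl (sym ey)
    in trans r (sym r') , trans c (sym c')

  factor : ∀ i {x y x' y'} → x ℕ.< n → y ℕ.< n → x' ℕ.< n → y' ℕ.< n →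
    lab x ≡ lab x' → lab y ≡ lab y' → cmp x y ≡ cmp x' y' → g i x y ≡ g i x' y'
  factor i {x} {y} {x'} {y'} x<n y<n x'<n y'<n ex ey ec with <-cmp x y | <-cmp x' y'
  ... | tri< p _ _ | tri< p' _ _ = proj₁ (ordered i p y<n p' y'<n ex ey)
  ... | tri≈ _ refl _ | tri≈ _ refl _ = loops i x<n x'<n ex
  ... | tri> _ _ p | tri> _ _ p' = proj₂ (ordered i p x<n p' x'<n ey ex)
  ... | tri< p _ _ | tri≈ _ refl _ with () ← trans (sym (cmp-< p)) (trans ec (cmp-refl x'))
  ... | tri< p _ _ | tri> _ _ p' with () ← trans (sym (cmp-< p)) (trans ec (cmp-> p'))
  ... | tri≈ _ refl _ | tri< p' _ _ with () ← trans (sym (cmp-refl x)) (trans ec (cmp-< p'))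
  ... | tri≈ _ refl _ | tri> _ _ p' with () ← trans (sym (cmp-refl x)) (trans ec (cmp-> p'))
  ... | tri> _ _ p | tri< p' _ _ with () ← trans (sym (cmp-> p)) (trans ec (cmp-< p'))
  ... | tri> _ _ p | tri≈ _ refl _ with () ← trans (sym (cmp-> p)) (trans ec (cmp-refl x'))

-- Run lengths and inflation

-- Index of the run containing position x, for consecutive runs of the given lengths;
-- meaningful for x < sum m only.
loc : List ℕ → ℕ → ℕ
loc []          x       = 0
loc (zero ∷ m)  x       = suc (loc m x)
loc (suc a ∷ m) zero    = 0
loc (suc a ∷ m) (suc x) = loc (a ∷ m) x

loc-mono : ∀ m x → loc m x ≤ loc m (suc x)
loc-mono []          x       = z≤n
loc-mono (zero ∷ m)  x       = s≤s (loc-mono m x)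
loc-mono (suc a ∷ m) zero    = z≤n
loc-mono (suc a ∷ m) (suc x) = loc-mono (a ∷ m) x

loc-mono-≤ : ∀ m {x y} → x ≤ y → loc m x ≤ loc m y
loc-mono-≤ m {x} {y} x≤y = subst (λ y → loc m x ≤ loc m y) (m+[n∸m]≡n x≤y) (go (y ∸ x))
  where
  go : ∀ d → loc m x ≤ loc m (x + d)
  go zero    = ≤-reflexive (cong (loc m) (sym (+-identityʳ x)))
  go (suc d) = ≤-trans (go d) (≤-trans (loc-mono m (x + d)) (≤-reflexive (cong (loc m) (sym (+-suc x d)))))

loc-<-reflect : ∀ m {x y} → loc m x ℕ.< loc m y → x ℕ.< y
loc-<-reflect m p = ≰⇒> λ q → <⇒≱ p (loc-mono-≤ m q)

loc-shift : ∀ a m x → loc (a ∷ m) (a + x) ≡ suc (loc m x)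
loc-shift zero    m x = refl
loc-shift (suc a) m x = loc-shift a m x

loc-head : ∀ a m x → x ℕ.< a → loc (a ∷ m) x ≡ 0
loc-head (suc a) m zero    p       = refl
loc-head (suc a) m (suc x) (s≤s p) = loc-head a m x p

loc<length : ∀ m x → x ℕ.< sum m → loc m x ℕ.< length m
loc<length (zero ∷ m)  x       p       = s≤s (loc<length m x p)
loc<length (suc a ∷ m) zero    p       = s≤s z≤n
loc<length (suc a ∷ m) (suc x) (s≤s p) = loc<length (a ∷ m) x p

Positive : List ℕ → Set
Positive = All (1 ≤_)

loc-zero : ∀ {m} → Positive m → loc m 0 ≡ 0
loc-zero []              = refl
loc-zero (s≤s z≤n ∷ pos) = refl

-- An empty run would make the label skip a value; positivity excludes this.
loc-step : ∀ m x → Positive m → suc x ℕ.< sum m →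
  loc m x ≡ loc m (suc x) ⊎ suc (loc m x) ≡ loc m (suc x)
loc-step (suc zero ∷ m) zero (_ ∷ pos) p = inj₂ (cong suc (sym (loc-zero pos)))
loc-step (suc zero ∷ m) (suc x) (_ ∷ pos) (s≤s p) with loc-step m x pos p
... | inj₁ e = inj₁ (cong suc e)
... | inj₂ e = inj₂ (cong suc e)
loc-step (suc (suc a) ∷ m) zero pos p = inj₁ refl
loc-step (suc (suc a) ∷ m) (suc x) (_ ∷ pos) (s≤s p) = loc-step (suc a ∷ m) x (s≤s z≤n ∷ pos) p

-- Used in `canonical-up` to find, in the shorter vector, the boundary with the same labels as a
-- given boundary of the longer one.
boundary : ∀ m a → Positive m → suc a ℕ.< length m →
  Σ[ x ∈ ℕ ] (suc x ℕ.< sum m × loc m x ≡ a × loc m (suc x) ≡ suc a)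
boundary (suc zero ∷ suc b ∷ m) zero pos p = 0 , s≤s (s≤s z≤n) , refl , refl
boundary (suc zero ∷ m) (suc a) (_ ∷ pos) (s≤s p) with boundary m a pos p
... | x , q , e , e' = suc x , s≤s q , cong suc e , cong suc e'
boundary (suc (suc b) ∷ m) a (_ ∷ pos) p with boundary (suc b ∷ m) a (s≤s z≤n ∷ pos) p
... | x , q , e , e' = suc x , s≤s q , e , e'
boundary (suc zero ∷ []) zero pos (s≤s ())
boundary (suc zero ∷ zero ∷ m) zero (_ ∷ () ∷ _) p
boundary (zero ∷ _) _ (() ∷ _) p

extend : Bool → List ℕ → List ℕ
extend true  m       = 1 ∷ m
-- A default that `runs` never reaches, as `runs (suc n)` is nonempty; it is chosen so that
-- `sum-extend` and `positive-extend` hold without a side condition.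
extend false []      = 1 ∷ []
extend false (a ∷ m) = suc a ∷ m

-- Run lengths of an n-element chain cut after every x with β x.
runs : ℕ → (ℕ → Bool) → List ℕ
runs zero          β = []
runs (suc zero)    β = 1 ∷ []
runs (suc (suc n)) β = extend (β 0) (runs (suc n) (β ∘ suc))

sum-extend : ∀ b m → sum (extend b m) ≡ suc (sum m)
sum-extend true  m       = refl
sum-extend false []      = refl
sum-extend false (a ∷ m) = refl

sum-runs : ∀ n β → sum (runs n β) ≡ n
sum-runs zero          β = refl
sum-runs (suc zero)    β = refl
sum-runs (suc (suc n)) β =
  trans (sum-extend (β 0) _) (cong suc (sum-runs (suc n) (β ∘ suc)))

positive-extend : ∀ b {m} → Positive m → Positive (extend b m)
positive-extend true  pos       = s≤s z≤n ∷ pos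
positive-extend false []        = s≤s z≤n ∷ []
positive-extend false (p ∷ pos) = s≤s z≤n ∷ pos

positive-runs : ∀ n β → Positive (runs n β)
positive-runs zero          β = []
positive-runs (suc zero)    β = s≤s z≤n ∷ []
positive-runs (suc (suc n)) β = positive-extend (β 0) (positive-runs (suc n) (β ∘ suc))

length-runs : ∀ n β → length (runs (suc n) β) ≡ suc (countFin n (β ∘ toℕ))
length-runs zero    β = refl
length-runs (suc n) β with β 0 | runs (suc n) (β ∘ suc) | length-runs n (β ∘ suc)
... | true  | m     | ih = cong suc ih
... | false | a ∷ m | ih = cong suc (ℕP.suc-injective ih)
... | false | []    | ()

length-runs-≤ : ∀ n β → length (runs n β) ≤ suc (countFin (n ∸ 1) (β ∘ toℕ))
length-runs-≤ zero    β = z≤n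
length-runs-≤ (suc n) β = ≤-reflexive (length-runs n β)

loc-runs : ∀ n β x → suc x ℕ.< n →
  loc (runs n β) (suc x) ≡ (if β x then suc (loc (runs n β) x) else loc (runs n β) x)
loc-runs (suc (suc n)) β zero (s≤s p)
  with β 0 | runs (suc n) (β ∘ suc) | positive-runs (suc n) (β ∘ suc) | sum-runs (suc n) (β ∘ suc)
... | true  | m         | pos     | _ = cong suc (loc-zero pos)
... | false | suc a ∷ m | pos     | _ = refl
... | false | zero ∷ m  | () ∷ _  | _
... | false | []        | _       | ()
loc-runs (suc (suc n)) β (suc x) (s≤s p)
  with β 0 | β (suc x) | runs (suc n) (β ∘ suc) | loc-runs (suc n) (β ∘ suc) x p | positive-runs (suc n) (β ∘ suc) | sum-runs (suc n) (β ∘ suc)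
... | true  | true  | m | ih | _ | _ = cong suc ih
... | true  | false | m | ih | _ | _ = cong suc ih
... | false | true  | a ∷ m | ih | _ | _ = ih
... | false | false | a ∷ m | ih | _ | _ = ih
... | false | _ | [] | _ | _ | ()

runs-cong : ∀ n {β β'} → (∀ x → suc x ℕ.< n → β x ≡ β' x) → runs n β ≡ runs n β'
runs-cong zero          eq = refl
runs-cong (suc zero)    eq = refl
runs-cong (suc (suc n)) eq = cong₂ extend (eq 0 (s≤s (s≤s z≤n)))
  (runs-cong (suc n) (λ x p → eq (suc x) (s≤s p)))

jump : List ℕ → ℕ → Bool
jump m x = not (loc m x ≡ᵇ loc m (suc x))

-- Positive run lengths are determined by where the label changes; an entry zero would leave no
-- trace among the cuts.
runs-jump : ∀ m → Positive m → runs (sum m) (jump m) ≡ m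
runs-jump [] _ = refl
runs-jump (suc zero ∷ []) _ = refl
runs-jump (suc zero ∷ suc b ∷ m) (_ ∷ pos) = cong (1 ∷_) (runs-jump (suc b ∷ m) pos)
runs-jump (suc (suc a) ∷ m) (_ ∷ pos) = cong (extend false) (runs-jump (suc a ∷ m) (s≤s z≤n ∷ pos))
runs-jump (suc zero ∷ zero ∷ m) (_ ∷ () ∷ _)
runs-jump (zero ∷ _) (() ∷ _)

-- Order embedding of the chain with run lengths m into the one with longer runs m',
-- matching run by run.
emb : List ℕ → List ℕ → ℕ → ℕ
emb (zero ∷ m)  (a' ∷ m')     x       = a' + emb m m' x
emb (suc a ∷ m) (suc a' ∷ m') zero    = zero
emb (suc a ∷ m) (suc a' ∷ m') (suc x) = suc (emb (a ∷ m) (a' ∷ m') x)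
emb _           _             x       = x

emb< : ∀ {m m'} → LPw.Pointwise _≤_ m m' → ∀ x → x ℕ.< sum m → emb m m' x ℕ.< sum m'
emb< {zero ∷ m}  {a' ∷ m'}     (_ ∷ ps)     x       q       = +-monoʳ-< a' (emb< ps x q)
emb< {suc a ∷ m} {suc a' ∷ m'} (s≤s p ∷ ps) zero    q       = s≤s z≤n
emb< {suc a ∷ m} {suc a' ∷ m'} (s≤s p ∷ ps) (suc x) (s≤s q) = s≤s (emb< (p ∷ ps) x q)

emb-inc : ∀ {m m'} → LPw.Pointwise _≤_ m m' → ∀ x y → x ℕ.< y → emb m m' x ℕ.< emb m m' y
emb-inc [] x y q = q
emb-inc {zero ∷ m}  {a' ∷ m'} (_ ∷ ps) x y q = +-monoʳ-< a' (emb-inc ps x y q)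
emb-inc {suc a ∷ m} {suc a' ∷ m'} (s≤s p ∷ ps) zero (suc y) q = s≤s z≤n
emb-inc {suc a ∷ m} {suc a' ∷ m'} (s≤s p ∷ ps) (suc x) (suc y) (s≤s q) = s≤s (emb-inc (p ∷ ps) x y q)

loc-emb : ∀ {m m'} → LPw.Pointwise _≤_ m m' → ∀ x → x ℕ.< sum m → loc m' (emb m m' x) ≡ loc m x
loc-emb {zero ∷ m}  {a' ∷ m'} (_ ∷ ps) x q = trans (loc-shift a' m' _) (cong suc (loc-emb ps x q))
loc-emb {suc a ∷ m} {suc a' ∷ m'} (s≤s p ∷ ps) zero q = refl
loc-emb {suc a ∷ m} {suc a' ∷ m'} (s≤s p ∷ ps) (suc x) (s≤s q) = loc-emb (p ∷ ps) x q

-- This is the minimum of `a` and `K`. A monotone truncation is wanted, because `mono-inflate` uses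
-- that the blocks of an increasing sequence do not decrease.
clamp : ∀ K → ℕ → Fin (suc K)
clamp K       zero    = F.zero
clamp zero    (suc a) = F.zero
clamp (suc K) (suc a) = F.suc (clamp K a)

toℕ-clamp : ∀ {K a} → a ≤ K → toℕ (clamp K a) ≡ a
toℕ-clamp {K}     {zero}  p       = refl
toℕ-clamp {suc K} {suc a} (s≤s p) = cong suc (toℕ-clamp p)

-- The orientation matters inside a single run. Some entries are never read, such as those with `a`
-- below `b` and the orientation of `>`; `Canonical` fixes them to `false`, as otherwise many tables
-- would present the same structure.
Table : ℕ → ℕ → Set
Table k K = Fin k → Fin (suc K) → Fin (suc K) → Fin 3 → Bool

_≈ₜ_ : ∀ {k K} → Table k K → Table k K → Set
Q ≈ₜ Q' = ∀ i a b o → Q i a b o ≡ Q' i a b o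

tableCoded : ∀ k K → Coded (Table k K) _≈ₜ_
tableCoded k K = funCoded k (funCoded (suc K) (funCoded (suc K) (funCoded 3 boolCoded)))

inflate : ∀ {k K} → Table k K → List ℕ → NatStr k
inflate {K = K} Q m i x y = Q i (clamp K (loc m x)) (clamp K (loc m y)) (cmp x y)

inflate-emb : ∀ {k K} (Q : Table k K) {m m'} → LPw.Pointwise _≤_ m m' →
  (λ i x y → inflate Q m' i (emb m m' x) (emb m m' y)) ≈[ sum m ] inflate Q m
inflate-emb {K = K} Q {m} {m'} m≤m' i x y p q =
  trans (cong₂ (λ a b → Q i (clamp K a) (clamp K b) (cmp (emb m m' x) (emb m m' y)))
               (loc-emb m≤m' x p) (loc-emb m≤m' y q))
        (cong (Q i _ _) (cmp-mono (ℕ._< sum m) (emb m m') (λ x y r _ → emb-inc m≤m' x y r) x y p q))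

inflate-down : ∀ {k K} {C : Class k} → Hereditary C → (Q : Table k K) → ∀ {m m'} → LPw.Pointwise _≤_ m m' →
  C (sum m') (fin (sum m') (inflate Q m')) → C (sum m) (fin (sum m) (inflate Q m))
inflate-down her Q {m} {m'} m≤m' Cm' = member-≈ her {g' = inflate Q m} (inflate-emb Q m≤m')
  (member-restrict her (inflate Q m') (emb m m') (emb< m≤m') (λ x y r _ → emb-inc m≤m' x y r) Cm')

inflate-twin : ∀ {k K n} (Q : Table k K) m {x} → loc m x ≡ loc m (suc x) → ¬ Break n (inflate Q m) x
inflate-twin {K = K} Q m {x} eq (z , z≢x , z≢x' , i , inj₁ d) =
  d (cong₂ (λ a o → Q i (clamp K a) (clamp K a) o) eq (trans (cmp-refl x) (sym (cmp-refl (suc x)))))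
inflate-twin {K = K} Q m {x} eq (z , z≢x , z≢x' , i , inj₂ (_ , inj₁ d)) =
  d (cong₂ (λ a o → Q i (clamp K a) _ o) eq (proj₁ (cmp-suc x z z≢x z≢x')))
inflate-twin {K = K} Q m {x} eq (z , z≢x , z≢x' , i , inj₂ (_ , inj₂ d)) =
  d (cong₂ (λ a o → Q i _ (clamp K a) o) eq (proj₂ (cmp-suc x z z≢x z≢x')))

-- Canonical presentations

Realised : ℕ → List ℕ → ∀ {K} → Fin (suc K) → Fin (suc K) → Fin 3 → Set
Realised n m {K} a b o = Σ[ x ∈ ℕ ] Σ[ y ∈ ℕ ]
  (x ℕ.< n × y ℕ.< n × clamp K (loc m x) ≡ a × clamp K (loc m y) ≡ b × cmp x y ≡ o)

-- Among the pairs (Q , m) with the same inflation, exactly one is canonical.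
record Canonical {k K} (Q : Table k K) (m : List ℕ) : Set where
  field
    positive   : Positive m
    reduced    : ∀ x → suc x ℕ.< sum m → loc m x ≢ loc m (suc x) → Break (sum m) (inflate Q m) x
    normalised : ∀ i a b o → Realised (sum m) m a b o ⊎ Q i a b o ≡ false

positive-up : ∀ {m m'} → LPw.Pointwise _≤_ m m' → Positive m → Positive m'
positive-up [] [] = []
positive-up (p ∷ ps) (q ∷ qs) = ≤-trans q p ∷ positive-up ps qs

module _ {k K : ℕ} (Q : Table k K) {m m' : List ℕ} (m≤m' : LPw.Pointwise _≤_ m m') where

  realised-up : ∀ {a b : Fin (suc K)} {o} → Realised (sum m) m a b o → Realised (sum m') m' a b o
  realised-up (x , y , p , q , ea , eb , eo) =
    emb m m' x , emb m m' y , emb< m≤m' x p , emb< m≤m' y q ,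
    trans (cong (clamp K) (loc-emb m≤m' x p)) ea ,
    trans (cong (clamp K) (loc-emb m≤m' y q)) eb ,
    trans (cmp-mono (ℕ._< sum m) (emb m m') (λ x y r _ → emb-inc m≤m' x y r) x y p q) eo

  -- The witness `z` travels along `emb`, but `x` and `x'` need only agree in their labels. Since
  -- the label jumps right after `x'`, `emb` sends `x` to at most `x'` and `suc x` to at least
  -- `suc x'`. So the image of `z` stays on its side and avoids both positions.
  break-up : ∀ {x x'} → suc x ℕ.< sum m →
    loc m x ≡ loc m' x' → loc m (suc x) ≡ loc m' (suc x') → loc m' x' ℕ.< loc m' (suc x') →
    Break (sum m) (inflate Q m) x → Break (sum m') (inflate Q m') x'
  break-up {x} {x'} p e e' jmp (z , z≢x , z≢x⁺ , i , inj₁ d) =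
    suc (suc x') , (λ eq → <⇒≢ (m≤n⇒m≤1+n (n<1+n x')) (sym eq)) , 1+n≢n , i , inj₁ λ eq →
      d (trans (same x x' e) (trans eq (sym (same (suc x) (suc x') e'))))
    where
    same : ∀ x x' → loc m x ≡ loc m' x' → inflate Q m i x x ≡ inflate Q m' i x' x'
    same x x' e = cong₂ (λ a o → Q i (clamp K a) (clamp K a) o) e (trans (cmp-refl x) (sym (cmp-refl x')))
  break-up {x} {x'} p e e' jmp (z , z≢x , z≢x⁺ , i , inj₂ (z<n , d)) =
    z' , z'≢x , z'≢x⁺ , i , inj₂ (emb< m≤m' z z<n , d' d)
    where
    z' : ℕ
    z' = emb m m' z
    ez : loc m' z' ≡ loc m z
    ez = loc-emb m≤m' z z<n
    side : z ℕ.< x × z' ℕ.< x' ⊎ suc x ℕ.< z × suc x' ℕ.< z'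
    side with <-cmp z x
    ... | tri< q _ _ = inj₁ (q , <-≤-trans (emb-inc m≤m' z x q) (s≤s⁻¹ (loc-<-reflect m'
          (subst (ℕ._< loc m' (suc x')) (trans (sym e) (sym (loc-emb m≤m' x (<-trans (n<1+n x) p)))) jmp))))
    ... | tri≈ _ q _ = ⊥-elim (z≢x q)
    ... | tri> _ _ q = inj₂ (q⁺ , ≤-<-trans (loc-<-reflect m'
          (subst (loc m' x' ℕ.<_) (trans (sym e') (sym (loc-emb m≤m' (suc x) p))) jmp))
          (emb-inc m≤m' (suc x) z q⁺))
      where
      q⁺ : suc x ℕ.< z
      q⁺ = ≤∧≢⇒< q (≢-sym z≢x⁺)
    z'≢x : z' ≢ x'
    z'≢x eq with side
    ... | inj₁ (_ , q) = <⇒≢ q eq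
    ... | inj₂ (_ , q) = <⇒≢ (<-trans (n<1+n x') q) (sym eq)
    z'≢x⁺ : z' ≢ suc x'
    z'≢x⁺ eq with side
    ... | inj₁ (_ , q) = <⇒≢ (m<n⇒m<1+n q) eq
    ... | inj₂ (_ , q) = <⇒≢ q (sym eq)
    cmp-same : (cmp x z ≡ cmp x' z' × cmp z x ≡ cmp z' x')
             × (cmp (suc x) z ≡ cmp (suc x') z' × cmp z (suc x) ≡ cmp z' (suc x'))
    cmp-same with side
    ... | inj₁ (q , q') = (trans (cmp-> q) (sym (cmp-> q')) , trans (cmp-< q) (sym (cmp-< q')))
      , (trans (cmp-> (m<n⇒m<1+n q)) (sym (cmp-> (m<n⇒m<1+n q')))
        , trans (cmp-< (m<n⇒m<1+n q)) (sym (cmp-< (m<n⇒m<1+n q'))))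
    ... | inj₂ (q , q') = (trans (cmp-< (<-trans (n<1+n x) q)) (sym (cmp-< (<-trans (n<1+n x') q')))
        , trans (cmp-> (<-trans (n<1+n x) q)) (sym (cmp-> (<-trans (n<1+n x') q'))))
      , (trans (cmp-< q) (sym (cmp-< q')) , trans (cmp-> q) (sym (cmp-> q')))
    entry : ∀ {x y x' y'} → loc m x ≡ loc m' x' → loc m y ≡ loc m' y' → cmp x y ≡ cmp x' y' →
      inflate Q m i x y ≡ inflate Q m' i x' y'
    entry ex ey ec = trans (cong₂ (λ a b → Q i (clamp K a) (clamp K b) _) ex ey) (cong (Q i _ _) ec)
    d' : _ ⊎ _ → _ ⊎ _
    d' (inj₁ h) = inj₁ λ eq → h (trans (entry e (sym ez) (proj₁ (proj₁ cmp-same)))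
      (trans eq (sym (entry e' (sym ez) (proj₁ (proj₂ cmp-same))))))
    d' (inj₂ h) = inj₂ λ eq → h (trans (entry (sym ez) e (proj₂ (proj₁ cmp-same)))
      (trans eq (sym (entry (sym ez) e' (proj₂ (proj₂ cmp-same))))))

  -- By positivity every boundary of `m'` separates labels `a` and `a + 1`. As `m` is positive and
  -- of the same length, it has a boundary with these labels too, and the break there is carried
  -- over.
  canonical-up : Canonical Q m → Canonical Q m'
  canonical-up can = record
    { positive = pos' ; reduced = reduced' ; normalised = normalised' }
    where
    open Canonical can
    pos' : Positive m'
    pos' = positive-up m≤m' positive
    reduced' : ∀ x' → suc x' ℕ.< sum m' → loc m' x' ≢ loc m' (suc x') → Break (sum m') (inflate Q m') x'
    reduced' x' p ne with loc-step m' x' pos' p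
    ... | inj₁ e = ⊥-elim (ne e)
    ... | inj₂ e with boundary m (loc m' x') positive
                   (subst₂ ℕ._<_ (sym e) (sym (LPw.Pointwise-length m≤m')) (loc<length m' (suc x') p))
    ... | x , q , ex , ex⁺ = break-up q ex (trans ex⁺ e) (≤-reflexive e)
          (reduced x q λ eq → 1+n≢n (trans (sym ex⁺) (trans (sym eq) ex)))
    normalised' : ∀ i a b o → Realised (sum m') m' a b o ⊎ Q i a b o ≡ false
    normalised' i a b o with normalised i a b o
    ... | inj₁ r = inj₁ (realised-up r)
    ... | inj₂ r = inj₂ r

module Runs (em : EM) where

  cut : ∀ {k} → ℕ → NatStr k → ℕ → Bool
  cut n g x = ⌊ em {Break n g x} ⌋

  breaks : ∀ {k} → ℕ → NatStr k → ℕ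
  breaks n g = countFin (n ∸ 1) (cut n g ∘ toℕ)

  module _ {k K : ℕ} (n : ℕ) (g : NatStr k) (few : breaks n g ≤ K) where

    runLengths : List ℕ
    runLengths = runs n (cut n g)

    length≤ : length runLengths ≤ suc K
    length≤ = ≤-trans (length-runs-≤ n (cut n g)) (s≤s few)

    sum≡ : sum runLengths ≡ n
    sum≡ = sum-runs n (cut n g)

    private
      m : List ℕ
      m = runLengths

      lab : ℕ → ℕ
      lab = loc m

      lab≤K : ∀ x → x ℕ.< n → lab x ≤ K
      lab≤K x p = s≤s⁻¹ (≤-trans (loc<length m x (subst (x ℕ.<_) (sym sum≡) p)) length≤)

      clamp-inj : ∀ {x y} → x ℕ.< n → y ℕ.< n → clamp K (lab x) ≡ clamp K (lab y) → lab x ≡ lab y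
      clamp-inj {x} {y} p q eq =
        trans (sym (toℕ-clamp (lab≤K x p))) (trans (cong toℕ eq) (toℕ-clamp (lab≤K y q)))

      twins : ∀ x → suc x ℕ.< n → lab x ≡ lab (suc x) → ¬ Break n g x
      twins x p eq br with em {Break n g x} | loc-runs n (cut n g) x p
      ... | yes _  | e = 1+n≢n (trans (sym e) (sym eq))
      ... | no ¬br | _ = ¬br br

      cuts : ∀ x → suc x ℕ.< n → lab x ≢ lab (suc x) → Break n g x
      cuts x p ne with em {Break n g x} | loc-runs n (cut n g) x p
      ... | yes br | _ = br
      ... | no _   | e = ⊥-elim (ne (sym e))

    -- Any realising pair may be read off, as `factor` makes the value independent of the choice.
    -- The value `false` elsewhere is what `normalised` asks for.
    table : Table k K
    table i a b o with em {Realised n m a b o}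
    ... | yes (x , y , _) = g i x y
    ... | no _            = false

    inflate-table : g ≈[ n ] inflate table m
    inflate-table i x y p q with em {Realised n m (clamp K (lab x)) (clamp K (lab y)) (cmp x y)}
    ... | yes (x' , y' , p' , q' , ex , ey , eo) =
      Factor.factor n g lab (loc-mono m) twins i p q p' q'
        (clamp-inj p p' (sym ex)) (clamp-inj q q' (sym ey)) (sym eo)
    ... | no ¬r = ⊥-elim (¬r (x , y , p , q , refl , refl , refl))

    canonical : Canonical table m
    canonical = record
      { positive = positive-runs n (cut n g) ; reduced = reduced ; normalised = normalised }
      where
      reduced : ∀ x → suc x ℕ.< sum m → lab x ≢ lab (suc x) → Break (sum m) (inflate table m) x
      reduced rewrite sum≡ = λ x p ne → Break-≈ inflate-table p (cuts x p ne)
      normalised : ∀ i a b o → Realised (sum m) m a b o ⊎ table i a b o ≡ false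
      normalised i a b o with em {Realised n m a b o}
      ... | yes r = inj₁ (subst (λ n → Realised n m a b o) (sym sum≡) r)
      ... | no _  = inj₂ refl

  module _ {k K n : ℕ} (g : NatStr k) where

    -- Neighbours in one run of `m` are twins by `inflate-twin`, and neighbours across a boundary
    -- form a break by `reduced`. So the breaks of `g` are exactly the boundaries, and `m` can be
    -- read off `g`.
    canonical-runs : ∀ {Q : Table k K} {m} → Canonical Q m → sum m ≡ n → g ≈[ n ] inflate Q m →
      runs n (cut n g) ≡ m
    canonical-runs {Q} {m} can refl eq =
      trans (runs-cong (sum m) same) (runs-jump m positive)
      where
      open Canonical can
      same : ∀ x → suc x ℕ.< sum m → cut (sum m) g x ≡ jump m x
      same x p with em {Break (sum m) g x} | loc m x ≡ᵇ loc m (suc x) in e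
      ... | yes br | true  = ⊥-elim (inflate-twin Q m (≡ᵇ⇒≡ _ _ (subst T (sym e) _)) (Break-≈ eq p br))
      ... | yes br | false = refl
      ... | no ¬br | true  = refl
      ... | no ¬br | false = ⊥-elim (¬br (Break-≈ (λ i x y p q → sym (eq i x y p q)) p
              (reduced x p λ eq → subst T e (≡⇒≡ᵇ _ _ eq))))

  -- The run lengths are recovered from the common structure. A realised table entry is then a value
  -- of that structure, and an entry that is not realised is `false` in both tables.
  canonical-unique : ∀ {k K n} {Q Q' : Table k K} {m m'} → Canonical Q m → Canonical Q' m' →
    sum m ≡ n → sum m' ≡ n → inflate Q m ≈[ n ] inflate Q' m' → m ≡ m' × Q ≈ₜ Q'
  canonical-unique {n = n} {Q} {Q'} {m} {m'} can can' s s' eq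
    with trans (sym (canonical-runs (inflate Q m) can s λ _ _ _ _ _ → refl))
               (canonical-runs (inflate Q m) can' s' eq)
  ... | refl = refl , λ i a b o → tables i a b o (Canonical.normalised can i a b o) (Canonical.normalised can' i a b o)
    where
    tables : ∀ i a b o → Realised (sum m) m a b o ⊎ Q i a b o ≡ false →
      Realised (sum m) m a b o ⊎ Q' i a b o ≡ false → Q i a b o ≡ Q' i a b o
    tables i a b o (inj₁ (x , y , p , q , refl , refl , refl)) _ =
      eq i x y (subst (x ℕ.<_) s p) (subst (y ℕ.<_) s q)
    tables i a b o (inj₂ _) (inj₁ (x , y , p , q , refl , refl , refl)) =
      eq i x y (subst (x ℕ.<_) s p) (subst (y ℕ.<_) s q)
    tables i a b o (inj₂ e) (inj₂ e') = trans e (sym e')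

-- Few breaks and monomorphic decompositions

clamp-mono : ∀ K {a b} → a ≤ b → clamp K a F.≤ clamp K b
clamp-mono K       {zero}          p       = z≤n
clamp-mono zero    {suc a} {suc b} p       = z≤n
clamp-mono (suc K) {suc a} {suc b} (s≤s p) = s≤s (clamp-mono K p)

toNat : Bool → ℕ
toNat true  = 1
toNat false = 0

countFin-suc : ∀ m (χ : Fin (suc m) → Bool) →
  countFin (suc m) χ ≡ toNat (χ F.zero) + countFin m (χ ∘ F.suc)
countFin-suc m χ with χ F.zero
... | true  = refl
... | false = refl

countFin-none : ∀ m {χ : Fin m → Bool} → (∀ x → χ x ≡ false) → countFin m χ ≡ 0
countFin-none zero    none = refl
countFin-none (suc m) {χ} none = trans (countFin-false m χ (none F.zero)) (countFin-none m (none ∘ F.suc))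

hits : ∀ {m b} → (Fin m → Fin b) → Fin b → Fin m → Bool
hits h j x = ⌊ h x F.≟ j ⌋

occurrences : ∀ {m b} → (Fin m → Fin b) → Fin b → ℕ
occurrences {m} h j = countFin m (hits h j)

⌊⌋-true : ∀ {A : Set} (d : Dec A) → A → ⌊ d ⌋ ≡ true
⌊⌋-true (yes _) _ = refl
⌊⌋-true (no ¬a) a = ⊥-elim (¬a a)

⌊⌋-false : ∀ {A : Set} (d : Dec A) → ¬ A → ⌊ d ⌋ ≡ false
⌊⌋-false (yes a) ¬a = ⊥-elim (¬a a)
⌊⌋-false (no _)  _  = refl

⌊⌋-sound : ∀ {A : Set} (d : Dec A) → ⌊ d ⌋ ≡ true → A
⌊⌋-sound (yes a) _ = a

Monotone : ∀ {m b} → (Fin m → Fin b) → Set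
Monotone h = ∀ x y → x F.≤ y → h x F.≤ h y

head-≮ : ∀ {m b} (h h' : Fin (suc m) → Fin b) → Monotone h' →
  (∀ j → occurrences h j ≡ occurrences h' j) → ¬ (h F.zero F.< h' F.zero)
head-≮ {m} h h' mono' eq lt with trans (sym one) (trans (eq (h F.zero)) none)
  where
  one : occurrences h (h F.zero) ≡ suc (occurrences (h ∘ F.suc) (h F.zero))
  one = countFin-true m (hits h (h F.zero)) (⌊⌋-true (h F.zero F.≟ h F.zero) refl)
  none : occurrences h' (h F.zero) ≡ 0
  none = countFin-none (suc m) λ x → ⌊⌋-false (h' x F.≟ h F.zero) λ e →
    <⇒≱ lt (subst (h' F.zero F.≤_) e (mono' F.zero x z≤n))
... | ()

-- A sorted word is determined by the number of occurrences of each letter: its head is its least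
-- letter, and equal heads can be cancelled.
monotone-≗ : ∀ m {b} (h h' : Fin m → Fin b) → Monotone h → Monotone h' →
  (∀ j → occurrences h j ≡ occurrences h' j) → ∀ x → h x ≡ h' x
monotone-≗ (suc m) h h' mono mono' eq = λ
  { F.zero → heads
  ; (F.suc x) → monotone-≗ m (h ∘ F.suc) (h' ∘ F.suc)
      (λ x y p → mono (F.suc x) (F.suc y) (s≤s p)) (λ x y p → mono' (F.suc x) (F.suc y) (s≤s p))
      tails x }
  where
  heads : h F.zero ≡ h' F.zero
  heads = FP.toℕ-injective (≤-antisym
    (≮⇒≥ (head-≮ h' h mono (sym ∘ eq))) (≮⇒≥ (head-≮ h h' mono' eq)))
  tails : ∀ j → occurrences (h ∘ F.suc) j ≡ occurrences (h' ∘ F.suc) j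
  tails j = +-cancelˡ-≡ (toNat ⌊ h F.zero F.≟ j ⌋) _ _ (begin
    toNat ⌊ h F.zero F.≟ j ⌋ + occurrences (h ∘ F.suc) j    ≡⟨ countFin-suc m (hits h j) ⟨
    occurrences h j                                          ≡⟨ eq j ⟩
    occurrences h' j                                         ≡⟨ countFin-suc m (hits h' j) ⟩
    toNat ⌊ h' F.zero F.≟ j ⌋ + occurrences (h' ∘ F.suc) j  ≡⟨ cong (λ v → toNat ⌊ v F.≟ j ⌋ + _) heads ⟨
    toNat ⌊ h F.zero F.≟ j ⌋ + occurrences (h' ∘ F.suc) j   ∎)
    where open ≡-Reasoning

inc⇒< : ∀ {k n m} (s : FinStr k n) {f : Fin m → Fin n} → StrictlyIncreasing (toStructure s) f →
  ∀ x y → x F.< y → f x F.< f y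
inc⇒< s inc x y p = ≤∧≢⇒< (proj₁ (inc x y p)) (proj₂ (inc x y p) ∘ FP.toℕ-injective)

<⇒≤-mono : ∀ {m} {f : Fin m → ℕ} → Increasing f → ∀ x y → x F.≤ y → f x ≤ f y
<⇒≤-mono {f = f} inc x y p with m≤n⇒m<n∨m≡n p
... | inj₁ q = <⇒≤ (inc x y q)
... | inj₂ e = ≤-reflexive (cong f (FP.toℕ-injective e))

mono-≗ : ∀ {k n b} {s t : FinStr k n} → s ≗ₛ t → MonoDecomp (toStructure s) b → MonoDecomp (toStructure t) b
mono-≗ {s = s} {t} eq (blk , H) = blk , λ m f f' inc inc' counts →
  ≗⇒≅ λ i x y → trans (sym (eq i (f x) (f y)))
    (trans (≅⇒≗ (restrictFin s f) (restrictFin s f') (H m f f' inc inc' counts) i x y) (eq i (f' x) (f' y)))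

-- The blocks are intervals, so along an increasing enumeration they form a sorted word, which the
-- block counts determine. Blocks and orientation together give every table entry.
mono-inflate : ∀ {k K n} (Q : Table k K) m →
  MonoDecomp (toStructure (fin n (inflate Q m))) (suc K)
mono-inflate {K = K} {n} Q m = blk , H
  where
  s = fin n (inflate Q m)
  blk : Fin n → Fin (suc K)
  blk x = clamp K (loc m (toℕ x))
  blk-mono : ∀ {l} {f : Fin l → Fin n} → StrictlyIncreasing (toStructure s) f → Monotone (blk ∘ f)
  blk-mono inc x y p = clamp-mono K (loc-mono-≤ m (<⇒≤-mono (inc⇒< s inc) x y p))
  H : ∀ l (f f' : Fin l → Fin n) → _ → _ → _ → _
  H l f f' inc inc' counts = ≗⇒≅ λ i x y →
    trans (cong₂ (λ a b → Q i a b (cmp (toℕ (f x)) (toℕ (f y)))) (labels x) (labels y)) (cong (Q i _ _)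
      (trans (cmp-inc inc x y) (sym (cmp-inc inc' x y))))
    where
    labels : ∀ x → blk (f x) ≡ blk (f' x)
    labels = monotone-≗ l (blk ∘ f) (blk ∘ f') (blk-mono inc) (blk-mono inc') counts
    cmp-inc : ∀ {f : Fin l → Fin n} → StrictlyIncreasing (toStructure s) f →
      ∀ x y → cmp (toℕ (f x)) (toℕ (f y)) ≡ cmp (toℕ x) (toℕ y)
    cmp-inc {f} inc x y with <-cmp (toℕ x) (toℕ y)
    ... | tri< p _ _ = trans (cmp-< (inc⇒< s inc x y p)) (sym (cmp-< p))
    ... | tri> _ _ p = trans (cmp-> (inc⇒< s inc y x p)) (sym (cmp-> p))
    ... | tri≈ _ e _ with FP.toℕ-injective e
    ... | refl = trans (cmp-refl (toℕ (f x))) (sym (cmp-refl (toℕ x)))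

module FewBreaks (em : EM) {k n b : ℕ} (g : NatStr k) (decomp : MonoDecomp (toStructure (fin n g)) b) where

  open Runs em

  private
    s = fin n g

    blk : Fin n → Fin b
    blk = proj₁ decomp

    G : Fin k → Fin n → Fin n → Bool
    G i x y = g i (toℕ x) (toℕ y)

    count : ∀ {l} → Vec (Fin n) l → Fin b → ℕ
    count []      j = 0
    count (x ∷ v) j = toNat ⌊ blk x F.≟ j ⌋ + count v j

    occurrences-lookup : ∀ {l} (v : Vec (Fin n) l) j → occurrences (blk ∘ Vec.lookup v) j ≡ count v j
    occurrences-lookup []      j = refl
    occurrences-lookup (x ∷ v) j =
      trans (countFin-suc _ (hits (blk ∘ Vec.lookup (x ∷ v)) j)) (cong (toNat ⌊ blk x F.≟ j ⌋ +_) (occurrences-lookup v j))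

    Inc : ∀ {l} → Vec (Fin n) l → Set
    Inc v = ∀ x y → x F.< y → Vec.lookup v x F.< Vec.lookup v y

    -- Rigidity matches the two subsets by rank: entries at equal ranks agree even when the elements
    -- there lie in different blocks. Only subsets of at most three elements are compared below.
    same : ∀ {l} (v w : Vec (Fin n) l) → Inc v → Inc w → (∀ j → count v j ≡ count w j) →
      ∀ i x y → G i (Vec.lookup v x) (Vec.lookup v y) ≡ G i (Vec.lookup w x) (Vec.lookup w y)
    same v w incv incw eq = ≅⇒≗ (restrictFin s (Vec.lookup v)) (restrictFin s (Vec.lookup w))
      (proj₂ decomp _ (Vec.lookup v) (Vec.lookup w) (<⇒inc s incv) (<⇒inc s incw)
        λ j → trans (occurrences-lookup v j) (trans (eq j) (sym (occurrences-lookup w j))))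

    inc₁ : ∀ x → Inc (x ∷ [])
    inc₁ x F.zero F.zero ()

    inc₂ : ∀ {x y} → x F.< y → Inc (x ∷ y ∷ [])
    inc₂ p F.zero (F.suc F.zero) _ = p
    inc₂ p (F.suc F.zero) (F.suc F.zero) (s≤s ())

    inc₃ : ∀ {x y z} → x F.< y → y F.< z → Inc (x ∷ y ∷ z ∷ [])
    inc₃ p q F.zero (F.suc F.zero) _ = p
    inc₃ {x} {y} {z} p q F.zero (F.suc (F.suc F.zero)) _ = FP.<-trans {i = x} {y} {z} p q
    inc₃ p q (F.suc F.zero) (F.suc (F.suc F.zero)) _ = q
    inc₃ p q (F.suc F.zero) (F.suc F.zero) (s≤s ())
    inc₃ p q (F.suc (F.suc F.zero)) (F.suc F.zero) (s≤s ())
    inc₃ p q (F.suc (F.suc F.zero)) (F.suc (F.suc F.zero)) (s≤s (s≤s ()))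

    #_ : Fin b → Fin b → ℕ
    (# a) j = toNat ⌊ a F.≟ j ⌋

    swap : ∀ {a b a' b'} (c : ℕ) → a ≡ b' → b ≡ a' → a + (b + c) ≡ a' + (b' + c)
    swap {a} {b} c refl refl = trans (sym (+-assoc a b c)) (trans (cong (_+ c) (+-comm a b)) (+-assoc b a c))

    loop-eq : ∀ {x x'} → blk x ≡ blk x' → ∀ i → G i x x ≡ G i x' x'
    loop-eq {x} {x'} e i = same (x ∷ []) (x' ∷ []) (inc₁ x) (inc₁ x')
      (λ j → cong (λ a → (# a) j + 0) e) i F.zero F.zero

    pair-eq : ∀ {x y x' y'} → x F.< y → x' F.< y' → blk x ≡ blk x' → blk y ≡ blk y' →
      ∀ i → G i x y ≡ G i x' y' × G i y x ≡ G i y' x'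
    pair-eq {x} {y} {x'} {y'} p p' ex ey i =
      eq F.zero (F.suc F.zero) , eq (F.suc F.zero) F.zero
      where
      eq = same (x ∷ y ∷ []) (x' ∷ y' ∷ []) (inc₂ p) (inc₂ p')
        (λ j → cong₂ (λ a b → (# a) j + ((# b) j + 0)) ex ey) i

    -- Both pairs meet the same two blocks, but in opposite order. Matching by rank then relates `x`
    -- to `x'` although their blocks may differ; this is what makes elements of different blocks
    -- comparable.
    swapped-loop : ∀ {x y x' y'} → x F.< y → x' F.< y' → blk x ≡ blk y' → blk y ≡ blk x' →
      ∀ i → G i x x ≡ G i x' x'
    swapped-loop {x} {y} {x'} {y'} p p' ex ey i =
      same (x ∷ y ∷ []) (x' ∷ y' ∷ []) (inc₂ p) (inc₂ p')
        (λ j → swap 0 (cong (λ a → (# a) j) ex) (cong (λ a → (# a) j) ey)) i F.zero F.zero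

    swapped-left : ∀ {x y x' y' z} → x F.< y → y F.< z → x' F.< y' → y' F.< z →
      blk x ≡ blk y' → blk y ≡ blk x' → ∀ i → G i x z ≡ G i x' z × G i z x ≡ G i z x'
    swapped-left {x} {y} {x'} {y'} {z} p q p' q' ex ey i =
      eq F.zero (F.suc (F.suc F.zero)) , eq (F.suc (F.suc F.zero)) F.zero
      where
      eq = same (x ∷ y ∷ z ∷ []) (x' ∷ y' ∷ z ∷ []) (inc₃ p q) (inc₃ p' q')
        (λ j → swap _ (cong (λ a → (# a) j) ex) (cong (λ a → (# a) j) ey)) i

    swapped-right : ∀ {x y x' y' z} → z F.< x → x F.< y → z F.< x' → x' F.< y' →
      blk x ≡ blk y' → blk y ≡ blk x' → ∀ i → G i z x ≡ G i z x' × G i x z ≡ G i x' z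
    swapped-right {x} {y} {x'} {y'} {z} p q p' q' ex ey i =
      eq F.zero (F.suc F.zero) , eq (F.suc F.zero) F.zero
      where
      eq = same (z ∷ x ∷ y ∷ []) (z ∷ x' ∷ y' ∷ []) (inc₃ p q) (inc₃ p' q')
        (λ j → cong ((# blk z) j +_) (swap 0 (cong (λ a → (# a) j) ex) (cong (λ a → (# a) j) ey))) i

  private
    <-next : ∀ {p q : Fin n} → toℕ q ≡ suc (toℕ p) → p F.< q
    <-next {p} e = subst (toℕ p ℕ.<_) (sym e) (n<1+n _)

    next-≤ : ∀ {p q r : Fin n} → toℕ q ≡ suc (toℕ p) → p F.< r → blk q ≢ blk r → q F.< r
    next-≤ {p} {q} {r} e p<r ne = ≤∧≢⇒< (subst (_≤ toℕ r) (sym e) p<r)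
      λ e → ne (cong blk (FP.toℕ-injective e))

  -- If `p` and `q` share a block, monomorphy applies directly. Otherwise the blocks of
  -- `q₀ < p < q < p₂` alternate. Comparing `p, q` with `q, p₂`, possibly with `z` added on the
  -- left, matches `p` with `q`. For `z` on the right, `p, q, z` is compared with `q₀, p, z`, which
  -- matches `p` with `q₀`; then `q₀` is replaced by `q` inside their common block.
  middle-twin : ∀ {p₀ q₀ p q p₂ : Fin n} →
    toℕ q₀ ≡ suc (toℕ p₀) → toℕ q ≡ suc (toℕ p) →
    p₀ F.< p → p F.< p₂ →
    blk p₀ ≡ blk p → blk p₂ ≡ blk p → blk q₀ ≡ blk q →
    ¬ Break n g (toℕ p)
  middle-twin {p₀} {q₀} {p} {q} {p₂} e₀ e p₀<p p<p₂ ep₀ ep₂ eq₀ (z , z≢p , z≢q , i , d) with blk p F.≟ blk q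
  ... | yes α≡β = differ d
    where
    differ : ¬ _
    differ (inj₁ h) = h (subst (λ q → g i (toℕ p) (toℕ p) ≡ g i q q) e (loop-eq α≡β i))
    differ (inj₂ (z<n , h)) = sides h'
      where
      z' : Fin n
      z' = fromℕ< z<n
      ez : toℕ z' ≡ z
      ez = FP.toℕ-fromℕ< z<n
      h' : G i p z' ≢ G i q z' ⊎ G i z' p ≢ G i z' q
      h' = subst₂ (λ q z → g i (toℕ p) z ≢ g i q z ⊎ g i z (toℕ p) ≢ g i z q) (sym e) (sym ez) h
      both : G i p z' ≡ G i q z' × G i z' p ≡ G i z' q
      both with <-cmp z (toℕ p)
      ... | tri< r _ _ = let (a , b) = pair-eq {z'} {p} {z'} {q} (subst (ℕ._< toℕ p) (sym ez) r)
                               (subst₂ ℕ._<_ (sym ez) (sym e) (m<n⇒m<1+n r)) refl α≡β i in b , a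
      ... | tri≈ _ r _ = ⊥-elim (z≢p r)
      ... | tri> _ _ r = pair-eq {p} {z'} {q} {z'} (subst (toℕ p ℕ.<_) (sym ez) r)
                               (subst₂ ℕ._<_ (sym e) (sym ez) (≤∧≢⇒< r (≢-sym z≢q))) α≡β refl i
      sides : ¬ _
      sides (inj₁ h) = h (proj₁ both)
      sides (inj₂ h) = h (proj₂ both)
  ... | no α≢β = differ d
    where
    q₀<p : q₀ F.< p
    q₀<p = next-≤ e₀ p₀<p λ eq → α≢β (trans (sym eq) eq₀)
    q<p₂ : q F.< p₂
    q<p₂ = next-≤ e p<p₂ λ eq → α≢β (sym (trans eq ep₂))
    differ : ¬ _
    differ (inj₁ h) = h (subst (λ q → g i (toℕ p) (toℕ p) ≡ g i q q) e
      (swapped-loop {p} {q} {q} {p₂} (<-next e) q<p₂ (sym ep₂) refl i))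
    differ (inj₂ (z<n , h)) = sides h'
      where
      z' : Fin n
      z' = fromℕ< z<n
      ez : toℕ z' ≡ z
      ez = FP.toℕ-fromℕ< z<n
      h' : G i p z' ≢ G i q z' ⊎ G i z' p ≢ G i z' q
      h' = subst₂ (λ q z → g i (toℕ p) z ≢ g i q z ⊎ g i z (toℕ p) ≢ g i z q) (sym e) (sym ez) h
      both : G i p z' ≡ G i q z' × G i z' p ≡ G i z' q
      both with <-cmp z (toℕ p)
      ... | tri< r _ _ =
        let z<p = subst (ℕ._< toℕ p) (sym ez) r
            z<q = subst₂ ℕ._<_ (sym ez) (sym e) (m<n⇒m<1+n r)
            (a , b) = swapped-right {p} {q} {q} {p₂} {z'} z<p (<-next e) z<q q<p₂ (sym ep₂) refl i
        in b , a
      ... | tri≈ _ r _ = ⊥-elim (z≢p r)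
      ... | tri> _ _ r =
        let p<z = subst (toℕ p ℕ.<_) (sym ez) r
            q<z = subst₂ ℕ._<_ (sym e) (sym ez) (≤∧≢⇒< r (≢-sym z≢q))
            (a , b) = swapped-left {p} {q} {q₀} {p} {z'} (<-next e) q<z q₀<p p<z refl (sym eq₀) i
            (a' , b') = pair-eq {q₀} {z'} {q} {z'} (FP.<-trans {i = q₀} {p} {z'} q₀<p p<z) q<z eq₀ refl i
        in trans a a' , trans b b'
      sides : ¬ _
      sides (inj₁ h) = h (proj₁ both)
      sides (inj₂ h) = h (proj₂ both)

  -- The pair of labels alone would give only two breaks in a collision. The extra bit records
  -- whether an earlier break has the same labels: in a collision the later break has one, hence so
  -- does the earlier, and three breaks with equal labels appear.
  few-breaks : breaks n g ≤ b * b * 2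
  few-breaks = ≮⇒≥ λ many → absurd (FP.pigeonhole (subst (b * b * 2 ℕ.<_) size≡ many) key)
    where
    open SubsetEnum (subsetEnum (n ∸ 1) (cut n g ∘ toℕ))
    pos< : ∀ t → suc (toℕ (elem t)) ℕ.< n
    pos< t = lemma n (FP.toℕ<n (elem t))
      where
      lemma : ∀ n {x} → x ℕ.< n ∸ 1 → suc x ℕ.< n
      lemma (suc n) p = s≤s p
    p : Fin size → Fin n
    p t = fromℕ< (<-trans (n<1+n _) (pos< t))
    q : Fin size → Fin n
    q t = fromℕ< (pos< t)
    toℕ-p : ∀ t → toℕ (p t) ≡ toℕ (elem t)
    toℕ-p t = FP.toℕ-fromℕ< (<-trans (n<1+n _) (pos< t))
    toℕ-q : ∀ t → toℕ (q t) ≡ suc (toℕ (p t))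
    toℕ-q t = trans (FP.toℕ-fromℕ< (pos< t)) (cong suc (sym (toℕ-p t)))
    p-inc : ∀ t u → t F.< u → p t F.< p u
    p-inc t u r = subst₂ ℕ._<_ (sym (toℕ-p t)) (sym (toℕ-p u)) (elem-inc t u r)
    p-break : ∀ t → Break n g (toℕ (p t))
    p-break t = subst (Break n g) (sym (toℕ-p t)) (⌊⌋-sound (em {Break n g (toℕ (elem t))}) (elem-sound t))
    labels : Fin size → Fin (b * b)
    labels t = F.combine (blk (p t)) (blk (q t))
    Earlier : Fin size → Set
    Earlier t = Σ[ u ∈ Fin size ] (u F.< t × labels u ≡ labels t)
    flag : ∀ {A : Set} → Dec A → Fin 2
    flag (yes _) = F.zero
    flag (no _)  = F.suc F.zero
    key : Fin size → Fin (b * b * 2)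
    key t = F.combine (labels t) (flag (em {Earlier t}))
    absurd : ¬ (∃₂ λ t u → t F.< u × key t ≡ key u)
    absurd (t , u , t<u , eq) with FP.combine-injective (labels t) _ (labels u) _ eq
    ... | el , ef with em {Earlier t} | em {Earlier u}
    ... | yes (v , v<t , el') | _ =
      let (ep , _) = FP.combine-injective (blk (p t)) (blk (q t)) (blk (p u)) (blk (q u)) el
          (ep' , eq') = FP.combine-injective (blk (p v)) (blk (q v)) (blk (p t)) (blk (q t)) el'
      in middle-twin (toℕ-q v) (toℕ-q t) (p-inc v t v<t) (p-inc t u t<u) ep' (sym ep) eq' (p-break t)
    ... | no _ | no ¬earlier = ¬earlier (t , t<u , el)
    ... | no _ | yes _ with () ← ef

-- Exponential growth

countFin-between : ∀ N (χ₀ χ₁ : Fin N → Bool) → (∀ x → χ₀ x ≡ true → χ₁ x ≡ true) →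
  ∀ n → countFin N χ₀ ≤ n → n ≤ countFin N χ₁ →
  Σ[ χ ∈ (Fin N → Bool) ] ((∀ x → χ₀ x ≡ true → χ x ≡ true) × (∀ x → χ x ≡ true → χ₁ x ≡ true) × countFin N χ ≡ n)
countFin-between zero χ₀ χ₁ sub n p q = χ₀ , (λ ()) , (λ ()) , sym (n≤0⇒n≡0 q)
countFin-between (suc N) χ₀ χ₁ sub n p q with χ₀ F.zero in e₀ | χ₁ F.zero in e₁
... | true | false with () ← trans (sym (sub F.zero e₀)) e₁
countFin-between (suc N) χ₀ χ₁ sub (suc n) (s≤s p) (s≤s q) | true | true
  with countFin-between N (χ₀ ∘ F.suc) (χ₁ ∘ F.suc) (sub ∘ F.suc) n p q
... | χ , low , high , eq = (λ { F.zero → true ; (F.suc x) → χ x })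
    , (λ { F.zero _ → refl ; (F.suc x) → low x }) , (λ { F.zero _ → e₁ ; (F.suc x) → high x }) , cong suc eq
countFin-between (suc N) χ₀ χ₁ sub n p q | false | false
  with countFin-between N (χ₀ ∘ F.suc) (χ₁ ∘ F.suc) (sub ∘ F.suc) n p q
... | χ , low , high , eq = (λ { F.zero → false ; (F.suc x) → χ x })
    , (λ { F.zero e → trans (sym e₀) e ; (F.suc x) → low x }) , (λ { F.zero () ; (F.suc x) → high x }) , eq
countFin-between (suc N) χ₀ χ₁ sub n p q | false | true with m≤n⇒m<n∨m≡n q
... | inj₂ refl = χ₁ , sub , (λ _ → id) , countFin-true N χ₁ e₁
... | inj₁ q' with countFin-between N (χ₀ ∘ F.suc) (χ₁ ∘ F.suc) (sub ∘ F.suc) n p (s≤s⁻¹ q')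
... | χ , low , high , eq = (λ { F.zero → false ; (F.suc x) → χ x })
    , (λ { F.zero e → trans (sym e₀) e ; (F.suc x) → low x }) , (λ { F.zero () ; (F.suc x) → high x }) , eq

hit : ∀ {m} → (Fin m → ℕ) → ℕ → Bool
hit f y = ⌊ FP.any? (λ t → y ≟ f t) ⌋

countFin-hit : ∀ N {m} (f : Fin m → ℕ) → countFin N (hit f ∘ toℕ) ≤ m
countFin-hit N {m} f = subst (_≤ m) (sym size≡) (FP.injective⇒≤ {f = index} index-inj)
  where
  open SubsetEnum (subsetEnum N (hit f ∘ toℕ))
  found : ∀ x → ∃ λ t → toℕ (elem x) ≡ f t
  found x = ⌊⌋-sound (FP.any? (λ t → toℕ (elem x) ≟ f t)) (elem-sound x)
  index : Fin size → Fin m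
  index x = proj₁ (found x)
  index-inj : ∀ {x y} → index x ≡ index y → x ≡ y
  index-inj {x} {y} eq with FP.<-cmp x y
  ... | tri≈ _ e _ = e
  ... | tri< p _ _ = ⊥-elim (<⇒≢ (elem-inc x y p)
          (trans (proj₂ (found x)) (trans (cong f eq) (sym (proj₂ (found y))))))
  ... | tri> _ _ p = ⊥-elim (<⇒≢ (elem-inc y x p)
          (trans (proj₂ (found y)) (trans (cong f (sym eq)) (sym (proj₂ (found x))))))

countFin-all : ∀ N → countFin N (λ _ → true) ≡ N
countFin-all zero    = refl
countFin-all (suc N) = cong suc (countFin-all N)

-- (p , z) stands for a break at p witnessed by z.
Separate : ℕ × ℕ → ℕ × ℕ → Set
Separate (p , z) (p' , z') = p' ≢ suc p × p' ≢ z × suc p' ≢ z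

Independent : ℕ × ℕ → ℕ × ℕ → Set
Independent a a' = proj₁ a ≢ proj₁ a' × Separate a a' × Separate a' a

without : ℕ → List (ℕ × ℕ) → List (ℕ × ℕ)
without v = filter (λ a → ¬? (proj₁ a ≟ v))

Apart : ℕ × ℕ → ℕ × ℕ → Set
Apart a a' = proj₁ a ≢ proj₁ a'

length-without : ∀ v {L} → AllPairs Apart L → length L ≤ suc (length (without v L))
length-without v {[]}    []       = z≤n
length-without v {a ∷ L} (ap ∷ aps) with proj₁ a ≟ v
... | no ne = ≤-trans (s≤s (length-without v aps)) (≤-reflexive (cong (suc ∘ length)
      (sym (LP.filter-accept (λ a → ¬? (proj₁ a ≟ v)) ne))))
... | yes e = s≤s (≤-reflexive (cong length (sym (trans
      (LP.filter-reject (λ a → ¬? (proj₁ a ≟ v)) (λ ne → ne e))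
      (LP.filter-all (λ a → ¬? (proj₁ a ≟ v)) (All.map (λ ne e' → ne (trans e (sym e'))) ap))))))

-- Any four positions may be avoided, so one in five breaks survives.
greedy : ∀ {_≺_ : ℕ × ℕ → ℕ × ℕ → Set} {V : ℕ × ℕ → Set} →
  (∀ {a a'} → V a → V a' → a ≺ a' → Apart a a') →
  (∀ {a a'} → V a → V a' → a ≺ a' → proj₁ a ≢ proj₂ a' × suc (proj₁ a) ≢ proj₂ a') →
  ∀ m L → 5 * m ≤ length L → AllPairs _≺_ L → All V L →
  Σ[ P ∈ (Fin m → ℕ × ℕ) ] ((∀ t → V (P t)) × (∀ t u → t ≢ u → Independent (P t) (P u)))
greedy _ _ zero L _ _ _ = (λ ()) , (λ ()) , λ ()
greedy {_≺_} {V} apart back (suc m) (a@(p , z) ∷ L) len (a≺ ∷ ≺L) (va ∷ vL)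
  = P' , valid' , ind'
  where
  ≺⇒Apart : ∀ {L} → All V L → AllPairs _≺_ L → AllPairs Apart L
  ≺⇒Apart []        []        = []
  ≺⇒Apart (v ∷ vs) (q ∷ qs) =
    All.zipWith (λ (v' , r) → apart v v' r) (vs , q) ∷ ≺⇒Apart vs qs
  W : ℕ → List (ℕ × ℕ) → List (ℕ × ℕ)
  W = without
  L₁ L₂ L₃ K : List (ℕ × ℕ)
  -- A later break `p'` must have `p'` and `p' + 1` different from `z`, which forbids `z` and
  -- `z - 1`; neither break may be the successor of the other, which forbids `p - 1` and `p + 1`.
  -- Truncated subtraction can at worst discard one break more.
  L₁ = W (z ∸ 1) L
  L₂ = W z L₁
  L₃ = W (p ∸ 1) L₂
  K  = W (suc p) L₃
  keepAll : ∀ {Q : ℕ × ℕ → Set} v {L} → All Q L → All Q (W v L)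
  keepAll v = AllP.filter⁺ (λ a → ¬? (proj₁ a ≟ v))
  keepPairs : ∀ {R : ℕ × ℕ → ℕ × ℕ → Set} v {L} → AllPairs R L → AllPairs R (W v L)
  keepPairs v = APP.filter⁺ (λ a → ¬? (proj₁ a ≟ v))
  dropped : ∀ v L → All (λ a → proj₁ a ≢ v) (W v L)
  dropped v L = AllP.all-filter (λ a → ¬? (proj₁ a ≟ v)) L
  keptPairs : ∀ {R : ℕ × ℕ → ℕ × ℕ → Set} → AllPairs R L → AllPairs R K
  keptPairs = keepPairs _ ∘ keepPairs _ ∘ keepPairs _ ∘ keepPairs _
  keptAll : ∀ {Q : ℕ × ℕ → Set} → All Q L → All Q K
  keptAll = keepAll _ ∘ keepAll _ ∘ keepAll _ ∘ keepAll _
  pairs = ≺⇒Apart vL ≺L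
  K-long : 5 * m ≤ length K
  K-long = s≤s⁻¹ (s≤s⁻¹ (s≤s⁻¹ (s≤s⁻¹ (s≤s⁻¹ (begin
    5 + 5 * m                                              ≡⟨ *-suc 5 m ⟨
    5 * suc m                                              ≤⟨ len ⟩
    1 + length L                                           ≤⟨ s≤s (length-without (z ∸ 1) pairs) ⟩
    2 + length L₁    ≤⟨ s≤s (s≤s (length-without z {L₁} (keepPairs _ pairs))) ⟩
    3 + length L₂    ≤⟨ s≤s (s≤s (s≤s (length-without (p ∸ 1) {L₂} (keepPairs _ (keepPairs _ pairs))))) ⟩
    4 + length L₃
      ≤⟨ s≤s (s≤s (s≤s (s≤s (length-without (suc p) {L₃} (keepPairs _ (keepPairs _ (keepPairs _ pairs))))))) ⟩
    5 + length K ∎)))))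
    where open ≤-Reasoning
  Q : ℕ × ℕ → Set
  Q b = V b × Independent a b
  indK : All Q K
  indK = All.zipWith combine
    ( keptAll (All.zip (vL , a≺))
    , All.zip (dropped (suc p) L₃ , All.zip (keepAll (suc p) {L₃} (dropped (p ∸ 1) L₂)
        , All.zip (keepAll (suc p) {L₃} (keepAll (p ∸ 1) {L₂} (dropped z L₁))
                  , keepAll (suc p) {L₃} (keepAll (p ∸ 1) {L₂} (keepAll z {L₁} (dropped (z ∸ 1) L)))))))
    where
    combine : ∀ {b} → (V b × a ≺ b) ×
      (proj₁ b ≢ suc p × proj₁ b ≢ p ∸ 1 × proj₁ b ≢ z × proj₁ b ≢ z ∸ 1) → Q b
    combine ((vb , a≺b) , n₁ , n₂ , n₃ , n₄) = vb , apart va vb a≺b ,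
      (n₁ , n₃ , λ e → n₄ (cong (_∸ 1) e)) ,
      ((λ e → n₂ (cong (_∸ 1) (sym e))) , back va vb a≺b)
  rest = greedy {_≺_} {Q} (λ (v , _) (v' , _) → apart v v') (λ (v , _) (v' , _) → back v v')
           m K K-long (keptPairs ≺L) indK
  P = proj₁ rest
  P' : Fin (suc m) → ℕ × ℕ
  P' F.zero    = a
  P' (F.suc t) = P t
  valid' : ∀ t → V (P' t)
  valid' F.zero    = va
  valid' (F.suc t) = proj₁ (proj₁ (proj₂ rest) t)
  ind' : ∀ t u → t ≢ u → Independent (P' t) (P' u)
  ind' F.zero F.zero ne = ⊥-elim (ne refl)
  ind' F.zero (F.suc u) _ = proj₂ (proj₁ (proj₂ rest) u)
  ind' (F.suc t) F.zero _ =
    let (ne , s , s') = proj₂ (proj₁ (proj₂ rest) t) in (≢-sym ne) , s' , s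
  ind' (F.suc t) (F.suc u) ne = proj₂ (proj₂ rest) t u (ne ∘ cong F.suc)

module Perturb {k : ℕ} {C : Class k} (her : Hereditary C) {N : ℕ} (g : NatStr k) (Cg : C N (fin N g))
  {m : ℕ} (p z : Fin m → ℕ)
  (p< : ∀ t → suc (p t) ℕ.< N) (z≢p : ∀ t → z t ≢ p t) (z≢p⁺ : ∀ t → z t ≢ suc (p t))
  (dist : ∀ t → Distinguishes N g (p t) (z t))
  (ind : ∀ t u → t ≢ u → Independent (p t , z t) (p u , z u))
  {n : ℕ} (2m≤n : m + m ≤ n) (n+m≤N : n + m ≤ N) where

  private
    z≢p' : ∀ t u → z t ≢ p u
    z≢p' t u e with t F.≟ u
    ... | yes refl = z≢p t e
    ... | no ne = proj₁ (proj₂ (proj₁ (proj₂ (ind t u ne)))) (sym e)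

    z≢p⁺' : ∀ t u → z t ≢ suc (p u)
    z≢p⁺' t u e with t F.≟ u
    ... | yes refl = z≢p⁺ t e
    ... | no ne = proj₂ (proj₂ (proj₁ (proj₂ (ind t u ne)))) (sym e)

    p≢p⁺ : ∀ t u → p t ≢ suc (p u)
    p≢p⁺ t u e with t F.≟ u
    ... | yes refl = 1+n≢n (sym e)
    ... | no ne = proj₁ (proj₂ (proj₂ (ind t u ne))) e

    p-inj : ∀ t u → p t ≡ p u → t ≡ u
    p-inj t u e with t F.≟ u
    ... | yes eq = eq
    ... | no ne = ⊥-elim (proj₁ (ind t u ne) e)

    hit-sound : ∀ (f : Fin m → ℕ) y → hit f y ≡ true → ∃ λ t → y ≡ f t
    hit-sound f y = ⌊⌋-sound (FP.any? (λ t → y ≟ f t))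

    hit-complete : ∀ (f : Fin m → ℕ) {y} t → y ≡ f t → hit f y ≡ true
    hit-complete f {y} t e = ⌊⌋-true (FP.any? (λ t → y ≟ f t)) (t , e)

    -- The chosen `n` positions must include all `p t` and those witnesses that lie below `N`, so
    -- that differences remain visible, and must avoid all `p t + 1`, so that each `p t` has room to
    -- move. The hypotheses on `n`, `m` and `N` make these bounds compatible with size `n`.
    lower upper : Fin N → Bool
    lower x = hit p (toℕ x) ∨ hit z (toℕ x)
    upper x = not (hit (suc ∘ p) (toℕ x))

    ∨-true : ∀ {a b} → a ∨ b ≡ true → a ≡ true ⊎ b ≡ true
    ∨-true {true}  _ = inj₁ refl
    ∨-true {false} e = inj₂ e

    ∨-left : ∀ {a b} → a ≡ true → a ∨ b ≡ true
    ∨-left refl = refl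

    ∨-right : ∀ {a b} → b ≡ true → a ∨ b ≡ true
    ∨-right {true}  _ = refl
    ∨-right {false} e = e

    lower⊆upper : ∀ x → lower x ≡ true → upper x ≡ true
    lower⊆upper x e with hit (suc ∘ p) (toℕ x) in e'
    ... | false = refl
    ... | true with hit-sound (suc ∘ p) (toℕ x) e' | ∨-true {hit p (toℕ x)} e
    ... | t , eq | inj₁ h = let (u , eq') = hit-sound p (toℕ x) h in ⊥-elim (p≢p⁺ u t (trans (sym eq') eq))
    ... | t , eq | inj₂ h = let (u , eq') = hit-sound z (toℕ x) h in ⊥-elim (z≢p⁺' u t (trans (sym eq') eq))

    lower≤ : countFin N lower ≤ n
    lower≤ = ≤-trans (countFin-∪ N {lower} (λ x e → ∨-true e))
      (≤-trans (+-mono-≤ (countFin-hit N p) (countFin-hit N z)) 2m≤n)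

    upper≥ : n ≤ countFin N upper
    upper≥ = +-cancelʳ-≤ m n (countFin N upper) (begin
      n + m                                              ≤⟨ n+m≤N ⟩
      N                                                  ≡⟨ countFin-all N ⟨
      countFin N (λ _ → true)                            ≤⟨ countFin-∪ N (λ x _ → split (hit (suc ∘ p) (toℕ x))) ⟩
      countFin N upper + countFin N (hit (suc ∘ p) ∘ toℕ) ≤⟨ +-monoʳ-≤ _ (countFin-hit N (suc ∘ p)) ⟩
      countFin N upper + m                               ∎)
      where
      open ≤-Reasoning
      split : ∀ b → not b ≡ true ⊎ b ≡ true
      split true  = inj₂ refl
      split false = inj₁ refl

    base = countFin-between N lower upper lower⊆upper n lower≤ upper≥

  open SubsetEnum (subsetEnum N (proj₁ base))

  private
    size≡n : n ≡ size
    size≡n = trans (sym (proj₂ (proj₂ (proj₂ base)))) size≡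

    f : Fin n → ℕ
    f x = toℕ (elem (subst Fin size≡n x))

    f-inc : Increasing f
    f-inc x y x<y = elem-inc _ _ (lemma size≡n x<y)
      where
      lemma : ∀ {l} (e : n ≡ l) → x F.< y → subst Fin e x F.< subst Fin e y
      lemma refl r = r

    f-onto : ∀ y → y ℕ.< N → hit p y ∨ hit z y ≡ true → ∃ λ x → f x ≡ y
    f-onto y y<N h with elem-onto (fromℕ< y<N) (proj₁ (proj₂ base) _
        (subst (λ y → hit p y ∨ hit z y ≡ true) (sym (FP.toℕ-fromℕ< y<N)) h))
    ... | x , e = subst Fin (sym size≡n) x ,
        trans (cong (toℕ ∘ elem) (subst-subst-sym size≡n)) (trans (cong toℕ e) (FP.toℕ-fromℕ< y<N))

    f≢p⁺ : ∀ x t → f x ≢ suc (p t)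
    f≢p⁺ x t e = clash (hit-complete (suc ∘ p) t e) (proj₁ (proj₂ (proj₂ base)) _ (elem-sound (subst Fin size≡n x)))
      where
      clash : ∀ {b} → b ≡ true → not b ≡ true → ⊥
      clash refl ()

    move : (Fin m → Bool) → ∀ y → Dec (∃ λ t → y ≡ p t) → ℕ
    move w y (yes (t , _)) = if w t then suc y else y
    move w y (no _)        = y

    shift : (Fin m → Bool) → ℕ → ℕ
    shift w y = move w y (FP.any? (λ t → y ≟ p t))

    shift-p : ∀ w t → shift w (p t) ≡ (if w t then suc (p t) else p t)
    shift-p w t = lemma (FP.any? (λ u → p t ≟ p u))
      where
      lemma : ∀ d → move w (p t) d ≡ (if w t then suc (p t) else p t)
      lemma (yes (u , e)) = cong (λ u → if w u then suc (p t) else p t) (sym (p-inj t u e))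
      lemma (no ne)       = ⊥-elim (ne (t , refl))

    shift-z : ∀ w t → shift w (z t) ≡ z t
    shift-z w t = lemma (FP.any? (λ u → z t ≟ p u))
      where
      lemma : ∀ d → move w (z t) d ≡ z t
      lemma (yes (u , e)) = ⊥-elim (z≢p' t u e)
      lemma (no _)        = refl

    shift-cases : ∀ w y → shift w y ≡ y ⊎ (shift w y ≡ suc y × ∃ λ t → y ≡ p t)
    shift-cases w y = lemma (FP.any? (λ t → y ≟ p t))
      where
      lemma : ∀ d → move w y d ≡ y ⊎ (move w y d ≡ suc y × ∃ λ t → y ≡ p t)
      lemma (no _) = inj₁ refl
      lemma (yes (t , e)) with w t
      ... | true  = inj₂ (refl , t , e)
      ... | false = inj₁ refl

    Shifted : (Fin m → Bool) → ℕ → Set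
    Shifted w y = shift w y ≡ y ⊎ (shift w y ≡ suc y × ∃ λ t → y ≡ p t)

    shift-≥ : ∀ w y → y ≤ shift w y
    shift-≥ w y = lemma (shift-cases w y)
      where
      lemma : Shifted w y → y ≤ shift w y
      lemma (inj₁ e)       = ≤-reflexive (sym e)
      lemma (inj₂ (e , _)) = ≤-trans (n≤1+n y) (≤-reflexive (sym e))

    shift-< : ∀ w y → y ℕ.< N → shift w y ℕ.< N
    shift-< w y y<N = lemma (shift-cases w y)
      where
      lemma : Shifted w y → shift w y ℕ.< N
      lemma (inj₁ e)            = subst (ℕ._< N) (sym e) y<N
      lemma (inj₂ (e , t , e')) = subst (ℕ._< N) (sym e) (subst (λ y → suc y ℕ.< N) (sym e') (p< t))

    -- A moved value becomes `p t + 1`, which `f` avoids, so the next value of `f` is still strictly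
    -- larger.
    shift-f-inc : ∀ w → Increasing (shift w ∘ f)
    shift-f-inc w x y x<y = ≤-trans (lemma (shift-cases w (f x))) (shift-≥ w (f y))
      where
      lemma : Shifted w (f x) → shift w (f x) ℕ.< f y
      lemma (inj₁ e) = subst (ℕ._< f y) (sym e) (f-inc x y x<y)
      lemma (inj₂ (e , t , e')) = subst (ℕ._< f y) (sym e)
        (≤∧≢⇒< (f-inc x y x<y) λ eq → f≢p⁺ y t (trans (sym eq) (cong suc e')))

  perturbed : (Fin m → Bool) → FinStr k n
  perturbed w i x y = g i (shift w (f x)) (shift w (f y))

  perturbed∈C : ∀ w → C n (perturbed w)
  perturbed∈C w = member-increasing her g (shift w ∘ f)
    (λ x → shift-< w (f x) (FP.toℕ<n _)) (shift-f-inc w) Cg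

  private
    -- Shifting preserves ranks. At the rank of `p t` one structure sees `p t` and the other
    -- `p t + 1`, while the rank of `z t` carries `z t` in both; equality there would contradict
    -- `dist t`.
    conflict : ∀ w w' → perturbed w ≗ₛ perturbed w' → ∀ t → w t ≡ false → w' t ≡ true → ⊥
    conflict w w' eq t e e' = differ (proj₂ (dist t))
      where
      i : Fin k
      i = proj₁ (dist t)
      at-p : ∃ λ x → f x ≡ p t
      at-p = f-onto (p t) (<-trans (n<1+n _) (p< t)) (∨-left (hit-complete p t refl))
      x : Fin n
      x = proj₁ at-p
      low : shift w (f x) ≡ p t
      low = trans (cong (shift w) (proj₂ at-p)) (trans (shift-p w t) (cong (λ b → if b then _ else _) e))
      high : shift w' (f x) ≡ suc (p t)
      high = trans (cong (shift w') (proj₂ at-p)) (trans (shift-p w' t) (cong (λ b → if b then _ else _) e'))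
      differ : ¬ (g i (p t) (p t) ≢ g i (suc (p t)) (suc (p t))
                 ⊎ z t ℕ.< N × (g i (p t) (z t) ≢ g i (suc (p t)) (z t) ⊎ g i (z t) (p t) ≢ g i (z t) (suc (p t))))
      differ (inj₁ h) = h (subst₂ (λ a b → g i a a ≡ g i b b) low high (eq i x x))
      differ (inj₂ (z<N , h)) = sides h
        where
        at-z : ∃ λ y → f y ≡ z t
        at-z = f-onto (z t) z<N (∨-right {hit p (z t)} (hit-complete z t refl))
        y : Fin n
        y = proj₁ at-z
        fixed : ∀ w → shift w (f y) ≡ z t
        fixed w = trans (cong (shift w) (proj₂ at-z)) (shift-z w t)
        sides : ¬ (g i (p t) (z t) ≢ g i (suc (p t)) (z t) ⊎ g i (z t) (p t) ≢ g i (z t) (suc (p t)))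
        sides (inj₁ h) = h (subst₂ _≡_ (cong₂ (g i) low (fixed w)) (cong₂ (g i) high (fixed w')) (eq i x y))
        sides (inj₂ h) = h (subst₂ _≡_ (cong₂ (g i) (fixed w) low) (cong₂ (g i) (fixed w') high) (eq i y x))

  perturbed-inj : ∀ w w' → perturbed w ≗ₛ perturbed w' → ∀ t → w t ≡ w' t
  perturbed-inj w w' eq t = lemma (w t) (w' t) refl refl
    where
    lemma : ∀ a b → w t ≡ a → w' t ≡ b → w t ≡ w' t
    lemma true  true  e e' = trans e (sym e')
    lemma false false e e' = trans e (sym e')
    lemma false true  e e' = ⊥-elim (conflict w w' eq t e e')
    lemma true  false e e' = ⊥-elim (conflict w' w (λ i x y → sym (eq i x y)) t e' e)

  profile-≥ : ∀ {M} → HasProfile C n M → 2 ^ m ≤ M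
  profile-≥ {M} (reps , _ , _ , cover) = FP.injective⇒≤ {f = index} index-inj
    where
    open Coded (funCoded m boolCoded) using (decode; decode-inj)
    rep : ∀ c → Σ[ j ∈ Fin M ] (perturbed (decode c) ≅ reps j)
    rep c = cover (perturbed (decode c)) (perturbed∈C (decode c))
    index : Fin (2 ^ m) → Fin M
    index c = proj₁ (rep c)
    index-inj : ∀ {c c'} → index c ≡ index c' → c ≡ c'
    index-inj {c} {c'} eq = decode-inj c c' (perturbed-inj _ _ λ i x y →
      trans (≅⇒≗ _ (reps (index c)) (proj₂ (rep c)) i x y)
        (trans (cong (λ j → reps j i x y) eq) (sym (≅⇒≗ _ (reps (index c')) (proj₂ (rep c')) i x y))))

module ManyBreaks (em : EM) {k : ℕ} {C : Class k} (her : Hereditary C) where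

  open Runs em

  cut-sound : ∀ n (g : NatStr k) p → cut n g p ≡ true → Break n g p
  cut-sound n g p = ⌊⌋-sound (em {Break n g p})

  module _ {N : ℕ} (g : NatStr k) (Cg : C N (fin N g)) (m : ℕ) where

    private
      -- Discarding breaks keeps the later ones off an earlier witness, but a single break could
      -- coincide with the witnesses of many later ones. If all witnesses lie on one side and the
      -- breaks are listed towards that side, every later witness lies beyond every earlier break.
      -- This supplies the second hypothesis of `greedy`.
      Right Left : ℕ → Set
      Right p = Σ[ z ∈ ℕ ] (suc p ℕ.< z × Distinguishes N g p z)
      Left p  = Σ[ z ∈ ℕ ] (z ℕ.< p × Distinguishes N g p z)

      break-side : ∀ {p} → Break N g p → Right p ⊎ Left p
      break-side {p} (z , z≢p , z≢p⁺ , d) with <-cmp z p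
      ... | tri< r _ _ = inj₂ (z , r , d)
      ... | tri≈ _ e _ = ⊥-elim (z≢p e)
      ... | tri> _ _ r = inj₁ (z , ≤∧≢⇒< r (≢-sym z≢p⁺) , d)

      χ : (ℕ → Set) → Fin (N ∸ 1) → Bool
      χ S x = ⌊ em {S (toℕ x)} ⌋

      covered : breaks N g ≤ countFin (N ∸ 1) (χ Right) + countFin (N ∸ 1) (χ Left)
      covered = countFin-∪ (N ∸ 1) {cut N g ∘ toℕ} {χ Right} {χ Left} λ x e → side (break-side (cut-sound N g (toℕ x) e))
        where
        side : ∀ {x} → Right (toℕ x) ⊎ Left (toℕ x) → χ Right x ≡ true ⊎ χ Left x ≡ true
        side (inj₁ r) = inj₁ (⌊⌋-true em r)
        side (inj₂ l) = inj₂ (⌊⌋-true em l)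

      bound : ∀ {n} → n ℕ.< N ∸ 1 → suc n ℕ.< N
      bound = lemma N
        where
        lemma : ∀ N {n} → n ℕ.< N ∸ 1 → suc n ℕ.< N
        lemma (suc N) p = s≤s p

      Valid : (ℕ → ℕ → Set) → ℕ × ℕ → Set
      Valid S (p , z) = suc p ℕ.< N × S p z × Distinguishes N g p z

    Selection : Set
    Selection = Σ[ P ∈ (Fin m → ℕ × ℕ) ]
      ( (∀ t → suc (proj₁ (P t)) ℕ.< N × proj₂ (P t) ≢ proj₁ (P t) × proj₂ (P t) ≢ suc (proj₁ (P t))
             × Distinguishes N g (proj₁ (P t)) (proj₂ (P t)))
      × (∀ t u → t ≢ u → Independent (P t) (P u)))

    select-right : 5 * m ≤ countFin (N ∸ 1) (χ Right) → Selection
    select-right many =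
      let (P , valid , ind) = greedy {λ a b → proj₁ a ℕ.< proj₁ b} {Valid (λ p z → suc p ℕ.< z)}
            (λ _ _ → <⇒≢)
            (λ _ (_ , r , _) q → <⇒≢ (<-trans q (<-trans (n<1+n _) r)) , <⇒≢ (≤-<-trans q (<-trans (n<1+n _) r)))
            m (tabulate pick) (subst (5 * m ≤_) (sym (LP.length-tabulate pick)) (subst (5 * m ≤_) size≡ many))
            (APP.tabulate⁺-< (λ {t} {u} q → elem-inc t u q))
            (AllP.tabulate⁺ λ t → bound (FP.toℕ<n (elem t)) , proj₂ (witness t))
      in P , (λ t → let (a , r , d) = valid t in
           a , (λ e → <⇒≢ (<-trans (n<1+n _) r) (sym e)) , (λ e → <⇒≢ r (sym e)) , d) , ind
      where
      open SubsetEnum (subsetEnum (N ∸ 1) (χ Right))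
      witness : ∀ t → Right (toℕ (elem t))
      witness t = ⌊⌋-sound em (elem-sound t)
      pick : Fin size → ℕ × ℕ
      pick t = toℕ (elem t) , proj₁ (witness t)

    select-left : 5 * m ≤ countFin (N ∸ 1) (χ Left) → Selection
    select-left many =
      let (P , valid , ind) = greedy {λ a b → proj₁ b ℕ.< proj₁ a} {Valid (λ p z → z ℕ.< p)}
            (λ _ _ q → ≢-sym (<⇒≢ q))
            (λ _ (_ , r , _) q → (λ e → <⇒≢ (<-trans r q) (sym e))
                               , (λ e → <⇒≢ (<-trans r (m<n⇒m<1+n q)) (sym e)))
            m (tabulate pick) (subst (5 * m ≤_) (sym (LP.length-tabulate pick)) (subst (5 * m ≤_) size≡ many))
            (APP.tabulate⁺-< (λ {t} {u} q → elem-inc _ _ (opposite-< t u q)))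
            (AllP.tabulate⁺ λ t → bound (FP.toℕ<n (elem (F.opposite t))) , proj₂ (witness (F.opposite t)))
      in P , (λ t → let (a , r , d) = valid t in
           a , <⇒≢ r , <⇒≢ (m<n⇒m<1+n r) , d) , ind
      where
      open SubsetEnum (subsetEnum (N ∸ 1) (χ Left))
      witness : ∀ t → Left (toℕ (elem t))
      witness t = ⌊⌋-sound em (elem-sound t)
      pick : Fin size → ℕ × ℕ
      -- Reversing the enumeration lists the breaks in decreasing order, towards their witnesses on
      -- the left.
      pick t = toℕ (elem (F.opposite t)) , proj₁ (witness (F.opposite t))
      opposite-< : ∀ (t u : Fin size) → t F.< u → F.opposite u F.< F.opposite t
      opposite-< t u q = subst₂ ℕ._<_ (sym (FP.opposite-prop u)) (sym (FP.opposite-prop t))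
        (∸-monoʳ-< (s≤s q) (FP.toℕ<n u))

    select : 5 * m + 5 * m ≤ breaks N g → Selection
    select many with 5 * m ≤? countFin (N ∸ 1) (χ Right)
    ... | yes r = select-right r
    ... | no ¬r = select-left (≮⇒≥ λ l →
      <⇒≱ (+-mono-< (≰⇒> ¬r) l) (≤-trans many covered))

  breaks≤ : ∀ N (g : NatStr k) → breaks N g ≤ N
  breaks≤ N g = ≤-trans (≤-trans (countFin-mono (N ∸ 1) (λ _ _ → refl)) (≤-reflexive (countFin-all (N ∸ 1)))) (m∸n≤m N 1)

  profile-exponential : (∀ K → Σ[ n ∈ ℕ ] Σ[ s ∈ FinStr k n ] (C n s × K ℕ.< breaks n (ext s))) →
    ∀ n M → HasProfile C n M → 2 ^ ⌊ n /2⌋ ≤ M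
  profile-exponential unbounded n M prof = result
    where
    m K N : ℕ
    m = ⌊ n /2⌋
    -- The first summand leaves at least `5 * m` breaks on one side, of which `greedy` keeps `m`.
    -- The second makes `N` at least `n + m`, because there are at most `N` breaks.
    K = (5 * m + 5 * m) + (n + m)
    witness = unbounded K
    N = proj₁ witness
    g : NatStr k
    g = ext (proj₁ (proj₂ witness))
    Cg : C N (fin N g)
    Cg = member-≗ her (λ i x y → sym (fin-ext (proj₁ (proj₂ witness)) i x y)) (proj₁ (proj₂ (proj₂ witness)))
    many : K ℕ.< breaks N g
    many = proj₂ (proj₂ (proj₂ witness))
    sel : Selection g Cg m
    sel = select g Cg m (≤-trans (m≤m+n _ (n + m)) (<⇒≤ many))
    P = proj₁ sel
    valid = proj₁ (proj₂ sel)
    2m≤n : m + m ≤ n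
    2m≤n = ≤-trans (+-monoʳ-≤ m (⌊n/2⌋≤⌈n/2⌉ n)) (≤-reflexive (⌊n/2⌋+⌈n/2⌉≡n n))
    result : 2 ^ m ≤ M
    result = Perturb.profile-≥ her g Cg (proj₁ ∘ P) (proj₂ ∘ P)
      (λ t → proj₁ (valid t)) (λ t → proj₁ (proj₂ (valid t))) (λ t → proj₁ (proj₂ (proj₂ (valid t))))
      (λ t → proj₂ (proj₂ (proj₂ (valid t)))) (proj₂ (proj₂ sel)) 2m≤n
      (≤-trans (m≤n+m (n + m) (5 * m + 5 * m)) (≤-trans (<⇒≤ many) (breaks≤ N g))) prof

-- Counting in down-closed and up-closed sets

Down Up : ∀ {K} → (Vec ℕ K → Set) → Set
Down X = ∀ {v w} → VPw.Pointwise _≤_ v w → X w → X v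
Up   X = ∀ {v w} → VPw.Pointwise _≤_ v w → X v → X w

pointwise-refl : ∀ {K} {v : Vec ℕ K} → VPw.Pointwise _≤_ v v
pointwise-refl = VPw.refl ≤-refl

antitone-≤ : ∀ {A : Set} (D : ℕ → A → Set) → (∀ i v → D (suc i) v → D i v) →
  ∀ {i j} → i ≤ j → ∀ v → D j v → D i v
antitone-≤ D anti {i} {j} i≤j v d = go (j ∸ i) (subst (λ j → D j v) (sym (m+[n∸m]≡n i≤j)) d)
  where
  go : ∀ e → D (i + e) v → D i v
  go zero    d = subst (λ j → D j v) (+-identityʳ i) d
  go (suc e) d = go e (anti (i + e) v (subst (λ j → D j v) (+-suc i e) d))

maximum : (ℕ → ℕ) → ℕ → ℕ
maximum f zero    = f 0
maximum f (suc n) = f (suc n) ⊔ maximum f n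

≤-maximum : ∀ f n {a} → a ≤ n → f a ≤ maximum f n
≤-maximum f zero    z≤n = ≤-refl
≤-maximum f (suc n) p with m≤n⇒m<n∨m≡n p
... | inj₁ q    = ≤-trans (≤-maximum f n (s≤s⁻¹ q)) (m≤n⊔m (f (suc n)) _)
... | inj₂ refl = m≤m⊔n (f (suc n)) _

-- Eventual polynomiality expressed through iterated forward differences, one of which eventually
-- vanishes. Closure properties become structural inductions over ℕ, and coefficients enter only in
-- `poly⇒newton`.
data Poly (f : ℕ → ℕ) : Set where
  vanishing : ∀ n₀ → (∀ n → n₀ ≤ n → f n ≡ 0) → Poly f
  summing   : ∀ {g} → Poly g → ∀ n₀ → (∀ n → n₀ ≤ n → f (suc n) ≡ f n + g n) → Poly f

poly-+ : ∀ {f f'} → Poly f → Poly f' → Poly (λ n → f n + f' n)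
poly-+ (vanishing n₀ z) (vanishing n₁ z') = vanishing (n₀ ⊔ n₁) λ n p →
  cong₂ _+_ (z n (m⊔n≤o⇒m≤o n₀ n₁ p)) (z' n (m⊔n≤o⇒n≤o n₀ n₁ p))
poly-+ {f} {f'} (vanishing n₀ z) (summing {g} P n₁ s) = summing P (n₀ ⊔ n₁) λ n p →
  let p₀ = m⊔n≤o⇒m≤o n₀ n₁ p in
  trans (cong₂ _+_ (trans (z (suc n) (m≤n⇒m≤1+n p₀)) (sym (z n p₀))) (s n (m⊔n≤o⇒n≤o n₀ n₁ p)))
        (sym (+-assoc (f n) (f' n) (g n)))
poly-+ {f} {f'} (summing {g} P n₀ s) (vanishing n₁ z) = summing P (n₀ ⊔ n₁) λ n p →
  let p₁ = m⊔n≤o⇒n≤o n₀ n₁ p in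
  trans (cong₂ _+_ (s n (m⊔n≤o⇒m≤o n₀ n₁ p)) (trans (z (suc n) (m≤n⇒m≤1+n p₁)) (sym (z n p₁))))
  (trans (+-assoc (f n) (g n) (f' n)) (trans (cong (f n +_) (+-comm (g n) (f' n))) (sym (+-assoc (f n) (f' n) (g n)))))
poly-+ {f} {f'} (summing {g} P n₀ s) (summing {g'} P' n₁ s') = summing (poly-+ P P') (n₀ ⊔ n₁) λ n p →
  trans (cong₂ _+_ (s n (m⊔n≤o⇒m≤o n₀ n₁ p)) (s' n (m⊔n≤o⇒n≤o n₀ n₁ p))) (interchange (f n) (g n) (f' n) (g' n))
  where
  interchange : ∀ a b c d → (a + b) + (c + d) ≡ (a + c) + (b + d)
  interchange a b c d = trans (+-assoc a b (c + d)) (trans (cong (a +_)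
    (trans (sym (+-assoc b c d)) (trans (cong (_+ d) (+-comm b c)) (+-assoc c b d)))) (sym (+-assoc a c (b + d))))

delay : (ℕ → ℕ) → ℕ → ℕ
delay f zero    = 0
delay f (suc n) = f n

poly-delay : ∀ {f} → Poly f → Poly (delay f)
poly-delay (vanishing n₀ z) = vanishing (suc n₀) λ { (suc n) (s≤s p) → z n p }
poly-delay (summing P n₀ s) = summing (poly-delay P) (suc n₀) λ { (suc n) (s≤s p) → s n p }

poly-suc : ∀ {f} → Poly f → Poly (f ∘ suc)
poly-suc (vanishing n₀ z) = vanishing n₀ λ n p → z (suc n) (m≤n⇒m≤1+n p)
poly-suc (summing P n₀ s) = summing (poly-suc P) n₀ λ n p → s (suc n) (m≤n⇒m≤1+n p)

sumFin : ∀ Y → (Fin Y → ℕ) → ℕ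
sumFin zero    f = 0
sumFin (suc Y) f = f F.zero + sumFin Y (f ∘ F.suc)

poly-sumFin : ∀ Y {f : Fin Y → ℕ → ℕ} → (∀ y → Poly (f y)) → Poly (λ n → sumFin Y (λ y → f y n))
poly-sumFin zero    P = vanishing 0 λ _ _ → refl
poly-sumFin (suc Y) P = poly-+ (P F.zero) (poly-sumFin Y (P ∘ F.suc))

enum-⊎ : ∀ {A₁ A₂ B : Set} {P₁ : A₁ → Set} {P₂ : A₂ → Set} {Q : B → Set} (h₁ : A₁ → B) (h₂ : A₂ → B) →
  (∀ {a} → P₁ a → Q (h₁ a)) → (∀ {a} → P₂ a → Q (h₂ a)) →
  (∀ {a a'} → h₁ a ≡ h₁ a' → a ≡ a') → (∀ {a a'} → h₂ a ≡ h₂ a' → a ≡ a') → (∀ {a a'} → h₁ a ≢ h₂ a') →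
  (∀ b → Q b → (Σ[ a ∈ A₁ ] (P₁ a × b ≡ h₁ a)) ⊎ (Σ[ a ∈ A₂ ] (P₂ a × b ≡ h₂ a))) →
  ∀ {m n} → Enum _≡_ P₁ m → Enum _≡_ P₂ n → Enum _≡_ Q (m + n)
enum-⊎ {B = B} {Q = Q} h₁ h₂ q₁ q₂ inj-h₁ inj-h₂ disjoint cases {m} {n}
  (r₁ , valid₁ , inj-r₁ , cover₁) (r₂ , valid₂ , inj-r₂ , cover₂) =
  r ∘ splitAt m , (λ j → valid (splitAt m j)) , inj , cover
  where
  r : Fin m ⊎ Fin n → B
  r = [ h₁ ∘ r₁ , h₂ ∘ r₂ ]′
  valid : ∀ j → Q (r j)
  valid (inj₁ j) = q₁ (valid₁ j)
  valid (inj₂ j) = q₂ (valid₂ j)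
  r-inj : ∀ j j' → r j ≡ r j' → j ≡ j'
  r-inj (inj₁ j) (inj₁ j') e = cong inj₁ (inj-r₁ j j' (inj-h₁ e))
  r-inj (inj₂ j) (inj₂ j') e = cong inj₂ (inj-r₂ j j' (inj-h₂ e))
  r-inj (inj₁ j) (inj₂ j') e = ⊥-elim (disjoint e)
  r-inj (inj₂ j) (inj₁ j') e = ⊥-elim (disjoint (sym e))
  inj : ∀ j j' → r (splitAt m j) ≡ r (splitAt m j') → j ≡ j'
  inj j j' e = trans (sym (FP.join-splitAt m n j))
    (trans (cong (F.join m n) (r-inj (splitAt m j) (splitAt m j') e)) (FP.join-splitAt m n j'))
  cover : ∀ b → Q b → Σ[ j ∈ Fin (m + n) ] b ≡ r (splitAt m j)
  cover b qb with cases b qb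
  ... | inj₁ (a , pa , e) = let (j , e') = cover₁ a pa in
        F.join m n (inj₁ j) , trans e (trans (cong h₁ e') (cong r (sym (FP.splitAt-join m n (inj₁ j)))))
  ... | inj₂ (a , pa , e) = let (j , e') = cover₂ a pa in
        F.join m n (inj₂ j) , trans e (trans (cong h₂ e') (cong r (sym (FP.splitAt-join m n (inj₂ j)))))

enum-map : ∀ {A B : Set} {P : A → Set} {Q : B → Set} (h : A → B) →
  (∀ {a} → P a → Q (h a)) → (∀ {a a'} → h a ≡ h a' → a ≡ a') →
  (∀ b → Q b → Σ[ a ∈ A ] (P a × b ≡ h a)) → ∀ {n} → Enum _≡_ P n → Enum _≡_ Q n
enum-map h q inj-h cases (r , valid , inj-r , cover) =
  h ∘ r , (λ j → q (valid j)) , (λ j j' e → inj-r j j' (inj-h e)) , λ b qb →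
    let (a , pa , e) = cases b qb ; (j , e') = cover a pa in j , trans e (cong h e')

enum-Σ : ∀ Y {A : Fin Y → Set} {P : ∀ y → A y → Set} {N : Fin Y → ℕ} →
  (∀ y → Enum _≡_ (P y) (N y)) → Enum {A = Σ (Fin Y) A} _≡_ (λ (y , a) → P y a) (sumFin Y N)
enum-Σ zero    E = (λ ()) , (λ ()) , (λ ()) , λ ()
enum-Σ (suc Y) {A} {P} E =
  enum-⊎ {A₁ = A F.zero} {A₂ = Σ (Fin Y) (A ∘ F.suc)} (λ a → F.zero , a) (λ (y , a) → F.suc y , a) id id
    (λ { refl → refl }) (λ { refl → refl }) (λ ())
    (λ { (F.zero , a) p → inj₁ (a , p , refl) ; (F.suc y , a) p → inj₂ ((y , a) , p , refl) })
    (E F.zero) (enum-Σ Y (E ∘ F.suc))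

OfSize : ∀ {K} → (Vec ℕ K → Set) → ℕ → Vec ℕ K → Set
OfSize X n v = X v × sum (toList v) ≡ n

CountedBy : ∀ {K} → (Vec ℕ K → Set) → (ℕ → ℕ) → Set
CountedBy X f = ∀ n → Enum _≡_ (OfSize X n) (f n)

raise : ∀ {K} → Vec ℕ (suc K) → Vec ℕ (suc K)
raise (i ∷ v) = suc i ∷ v

enum-head : ∀ {K} {X : Vec ℕ (suc K) → Set} {m} →
  Enum _≡_ (OfSize (X ∘ (0 ∷_)) 0) m → Enum _≡_ (OfSize X 0) m
enum-head = enum-map (0 ∷_) id (λ { refl → refl }) λ { (zero ∷ v) p → v , p , refl }

enum-cons : ∀ {K} {X : Vec ℕ (suc K) → Set} {m m' n} →
  Enum _≡_ (OfSize (X ∘ raise) n) m → Enum _≡_ (OfSize (X ∘ (0 ∷_)) (suc n)) m' →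
  Enum _≡_ (OfSize X (suc n)) (m + m')
enum-cons = enum-⊎ raise (0 ∷_) (λ { {i ∷ v} (x , e) → x , cong suc e }) id
  (λ { {i ∷ v} {j ∷ w} refl → refl }) (λ { refl → refl }) (λ { {i ∷ v} () })
  λ { (zero ∷ v) p → inj₂ (v , p , refl) ; (suc i ∷ v) (x , e) → inj₁ (i ∷ v , (x , ℕP.suc-injective e) , refl) }

StableFrom : ∀ {K} → ℕ → (Vec ℕ (suc K) → Set) → Set
StableFrom i₀ X = ∀ i v → i₀ ≤ i → X (i₀ ∷ v) ⇔ X (i ∷ v)

-- The vectors to be counted form a set that is neither up-closed nor down-closed. Tameness keeps
-- just what slicing needs, and is inherited by intersections and complements, so up-closed sets are
-- covered as complements of down-closed ones.
Tame : ∀ K → (Vec ℕ K → Set) → Set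
Tame zero    X = ⊤
Tame (suc K) X = (∀ i → Tame K (X ∘ (i ∷_))) × Σ[ i₀ ∈ ℕ ] StableFrom i₀ X

tame-∩ : ∀ K {X Y : Vec ℕ K → Set} → Tame K X → Tame K Y → Tame K (λ v → X v × Y v)
tame-∩ zero _ _ = tt
tame-∩ (suc K) {X} {Y} (tX , i₀ , sX) (tY , i₁ , sY) =
  (λ i → tame-∩ K (tX i) (tY i)) , i₀ ⊔ i₁ , λ i v p →
    let iX = sX i v (m⊔n≤o⇒m≤o i₀ i₁ p) ; iY = sY i v (m⊔n≤o⇒n≤o i₀ i₁ p)
        jX = sX (i₀ ⊔ i₁) v (m≤m⊔n i₀ i₁) ; jY = sY (i₀ ⊔ i₁) v (m≤n⊔m i₀ i₁) in
    mk⇔ (λ (x , y) → to iX (from jX x) , to iY (from jY y))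
        (λ (x , y) → to jX (from iX x) , to jY (from iY y))

enum-⇔ : ∀ {K} {X Y : Vec ℕ K → Set} → (∀ v → X v ⇔ Y v) → ∀ {n N} →
  Enum _≡_ (OfSize X n) N → Enum _≡_ (OfSize Y n) N
enum-⇔ eq = enum-map id (λ {v} (x , e) → to (eq v) x , e) id
  (λ v (y , e) → v , (from (eq v) y , e) , refl)

Within : ℕ → Maybe ℕ → Set
Within a (just b) = a ≤ b
Within a nothing  = ⊤

InBox : ∀ {K} → Vec ℕ K → Vec (Maybe ℕ) K → Set
InBox = VPw.Pointwise Within

module Counting (em : EM) where

  stable : ∀ {P : Set} → ¬ ¬ P → P
  stable = decidable-stable em

  -- The slices at height a stabilise to their limit L a, and L itself stabilises at some a₀;
  -- beyond a₀ every slice is squeezed between L a₀ and L a.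
  stabilise : ∀ K (D : ℕ → Vec ℕ K → Set) → (∀ i → Down (D i)) → (∀ i v → D (suc i) v → D i v) →
    Σ[ i₀ ∈ ℕ ] (∀ i v → i₀ ≤ i → D i₀ v → D i v)
  stabilise zero D down anti with em {Σ[ i ∈ ℕ ] ¬ D i []}
  ... | yes (i₀ , ¬d) = i₀ , λ { i [] _ d → ⊥-elim (¬d d) }
  ... | no none       = 0 , λ { i [] _ _ → stable λ ¬d → none (i , ¬d) }
  stabilise (suc K) D down anti = i₁ , step
    where
    slice : ∀ a → Σ[ i₀ ∈ ℕ ] (∀ i v → i₀ ≤ i → D i₀ (a ∷ v) → D i (a ∷ v))
    slice a = stabilise K (λ i v → D i (a ∷ v)) (λ i p → down i (≤-refl ∷ p)) (λ i v → anti i (a ∷ v))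
    L : ℕ → Vec ℕ K → Set
    L a v = ∀ i → D i (a ∷ v)
    limit = stabilise K L (λ a p l i → down i (≤-refl ∷ p) (l i))
      (λ a v l i → down i (n≤1+n a ∷ pointwise-refl) (l i))
    a₀ i₁ : ℕ
    a₀ = proj₁ limit
    i₁ = maximum (proj₁ ∘ slice) a₀
    low : ∀ {a} → a ≤ a₀ → ∀ v → D i₁ (a ∷ v) → L a v
    low {a} p v d i with ≤-total (proj₁ (slice a)) i
    ... | inj₁ q = proj₂ (slice a) i v q (antitone-≤ D anti (≤-maximum (proj₁ ∘ slice) a₀ p) (a ∷ v) d)
    ... | inj₂ q = antitone-≤ D anti (≤-trans q (≤-maximum (proj₁ ∘ slice) a₀ p)) (a ∷ v) d
    step : ∀ i v → i₁ ≤ i → D i₁ v → D i v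
    step i (a ∷ v) _ d with ≤-total a a₀
    ... | inj₁ p = low p v d i
    ... | inj₂ p = proj₂ limit a v p (low ≤-refl v (down i₁ (p ∷ pointwise-refl) d)) i

  tame-down : ∀ K {X : Vec ℕ K → Set} → Down X → Tame K X
  tame-down zero    down = tt
  tame-down (suc K) {X} down =
    (λ i → tame-down K (λ p → down (≤-refl ∷ p))) ,
    let (i₀ , s) = stabilise K (λ i v → X (i ∷ v)) (λ i p → down (≤-refl ∷ p))
                     (λ i v → down (n≤1+n i ∷ pointwise-refl)) in
    i₀ , λ i v p → mk⇔ (s i v p) (down (p ∷ pointwise-refl))

  tame-¬ : ∀ K {X : Vec ℕ K → Set} → Tame K (λ v → ¬ X v) → Tame K X
  tame-¬ zero    _ = tt
  tame-¬ (suc K) (t , i₀ , s) = (λ i → tame-¬ K (t i)) , i₀ , λ i v p →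
    mk⇔ (λ x → stable λ ¬y → from (s i v p) ¬y x) (λ y → stable λ ¬x → to (s i v p) ¬x y)

  tame-up : ∀ K {X : Vec ℕ K → Set} → Up X → Tame K X
  tame-up K up = tame-¬ K (tame-down K λ p ¬x x → ¬x (up p x))

  -- Vectors of size `n + 1` either have head 0, which is a count in dimension `K`, or are raised
  -- from vectors of size `n`. The inner recursion runs on the index from which the slices are
  -- stable.
  tame-count : ∀ K (X : Vec ℕ K → Set) → Tame K X → Σ[ f ∈ (ℕ → ℕ) ] (Poly f × CountedBy X f)
  tame-count zero X _ with em {X []}
  ... | no ¬x = (λ _ → 0) , vanishing 0 (λ _ _ → refl) ,
        λ n → (λ ()) , (λ ()) , (λ ()) , λ { [] (x , _) → ⊥-elim (¬x x) }
  ... | yes x = (λ { zero → 1 ; (suc _) → 0 }) , vanishing 1 (λ { (suc n) _ → refl }) ,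
        λ { zero    → (λ _ → []) , (λ _ → x , refl) , (λ { F.zero F.zero _ → refl }) , λ { [] _ → F.zero , refl }
          ; (suc n) → (λ ()) , (λ ()) , (λ ()) , λ { [] (_ , ()) } }
  tame-count (suc K) X (tame , i₀ , s) = slices i₀ X tame s
    where
    slices : ∀ i₀ (X : Vec ℕ (suc K) → Set) → (∀ i → Tame K (X ∘ (i ∷_))) → StableFrom i₀ X →
      Σ[ f ∈ (ℕ → ℕ) ] (Poly f × CountedBy X f)
    -- All slices agree, so `raise` maps `X` onto its vectors with positive head. Hence the count
    -- has difference `f₀ (suc n)`, which is one `summing` step.
    slices zero X tame s = F , summing (poly-suc P₀) 0 (λ _ _ → refl) , count
      where
      head = tame-count K (X ∘ (0 ∷_)) (tame 0)
      f₀ = proj₁ head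
      P₀ = proj₁ (proj₂ head)
      count₀ = proj₂ (proj₂ head)
      F : ℕ → ℕ
      F zero    = f₀ 0
      F (suc n) = F n + f₀ (suc n)
      raised : ∀ v → X v ⇔ X (raise v)
      raised (i ∷ v) = mk⇔ (to (s (suc i) v z≤n) ∘ from (s i v z≤n)) (to (s i v z≤n) ∘ from (s (suc i) v z≤n))
      count : CountedBy X F
      count zero    = enum-head (count₀ 0)
      count (suc n) = enum-cons (enum-⇔ raised (count n)) (count₀ (suc n))
    -- The set `X ∘ raise` is stable one index earlier; `delay` accounts for the unit that raising
    -- adds to the size.
    slices (suc i₀) X tame s = F , poly-F , count
      where
      head = tame-count K (X ∘ (0 ∷_)) (tame 0)
      f₀ = proj₁ head
      tail = slices i₀ (X ∘ raise) (tame ∘ suc) (λ i v p → s (suc i) v (s≤s p))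
      f₁ = proj₁ tail
      F : ℕ → ℕ
      F n = delay f₁ n + f₀ n
      poly-F : Poly F
      poly-F = poly-+ (poly-delay (proj₁ (proj₂ tail))) (proj₁ (proj₂ head))
      count : CountedBy X F
      count zero    = enum-head (proj₂ (proj₂ head) 0)
      count (suc n) = enum-cons (proj₂ (proj₂ tail) n) (proj₂ (proj₂ head) (suc n))

  -- A head `i` below `i₀` contributes boxes capped at `i`. All slices from `i₀` on coincide, so one
  -- family of boxes with unbounded head covers the rest.
  boxes : ∀ K (X : Vec ℕ K → Set) → Down X → Σ[ bs ∈ List (Vec (Maybe ℕ) K) ]
    ((∀ v → X v → Σ[ u ∈ _ ] (u ∈ bs × InBox v u)) × (∀ u → u ∈ bs → ∀ v → InBox v u → X v))
  boxes zero X down with em {X []}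
  ... | yes x = ([] ∷ []) , (λ { [] _ → [] , here refl , [] }) , λ { [] _ [] _ → x }
  ... | no ¬x = [] , (λ { [] x → ⊥-elim (¬x x) }) , λ _ ()
  boxes (suc K) X down = gather i₀ ++ top , cover , sound
    where
    stab = proj₂ (tame-down (suc K) down)
    i₀ = proj₁ stab
    slice : ∀ i → _
    slice i = boxes K (X ∘ (i ∷_)) (λ p → down (≤-refl ∷ p))
    gather : ℕ → List (Vec (Maybe ℕ) (suc K))
    gather zero    = []
    gather (suc i) = List.map (just i ∷_) (proj₁ (slice i)) ++ gather i
    top = List.map (nothing ∷_) (proj₁ (slice i₀))
    gather⁺ : ∀ {i} j → i ℕ.< j → ∀ {u} → u ∈ proj₁ (slice i) → (just i ∷ u) ∈ gather j
    gather⁺ (suc j) p m with m≤n⇒m<n∨m≡n (s≤s⁻¹ p)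
    ... | inj₁ q    = ∈-++⁺ʳ (List.map (just j ∷_) (proj₁ (slice j))) (gather⁺ j q m)
    ... | inj₂ refl = ∈-++⁺ˡ (∈-map⁺ (just j ∷_) m)
    gather⁻ : ∀ j {u} → u ∈ gather j → ∀ v → InBox v u → X v
    gather⁻ (suc j) m v b with ∈-++⁻ (List.map (just j ∷_) (proj₁ (slice j))) m
    ... | inj₂ m' = gather⁻ j m' v b
    ... | inj₁ m' with ∈-map⁻ (just j ∷_) m'
    ...   | u , m'' , refl with v | b
    ...   | a ∷ v | p ∷ b = down (p ∷ pointwise-refl) (proj₂ (proj₂ (slice j)) u m'' v b)
    cover : ∀ v → X v → Σ[ u ∈ _ ] (u ∈ gather i₀ ++ top × InBox v u)
    cover (i ∷ v) x with i <? i₀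
    ... | yes p = let (u , m , b) = proj₁ (proj₂ (slice i)) v x in
          just i ∷ u , ∈-++⁺ˡ (gather⁺ i₀ p m) , ≤-refl ∷ b
    ... | no ¬p = let (u , m , b) = proj₁ (proj₂ (slice i₀)) v (from (proj₂ stab i v (≮⇒≥ ¬p)) x) in
          nothing ∷ u , ∈-++⁺ʳ (gather i₀) (∈-map⁺ (nothing ∷_) m) , tt ∷ b
    sound : ∀ u → u ∈ gather i₀ ++ top → ∀ v → InBox v u → X v
    sound u m v b with ∈-++⁻ (gather i₀) m
    ... | inj₁ m' = gather⁻ i₀ m' v b
    ... | inj₂ m' with ∈-map⁻ (nothing ∷_) m'
    ...   | u' , m'' , refl with v | b
    ...   | a ∷ v | _ ∷ b with ≤-total i₀ a
    ...     | inj₁ p = to (proj₂ stab a v p) (proj₂ (proj₂ (slice i₀)) u' m'' v b)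
    ...     | inj₂ p = down (p ∷ pointwise-refl) (proj₂ (proj₂ (slice i₀)) u' m'' v b)

-- Polynomials over ℚ

toℚᵘ-ℕtoℚ : ∀ n → ℚ.toℚᵘ (ℕtoℚ n) ℚᵘ.≃ ℚᵘ.mkℚᵘ (ℤ.+ n) 0
toℚᵘ-ℕtoℚ n = ℚP.toℚᵘ-fromℚᵘ (ℚᵘ.mkℚᵘ (ℤ.+ n) 0)

ℕtoℚ-+ : ∀ a b → ℕtoℚ (a + b) ≡ ℕtoℚ a ℚ.+ ℕtoℚ b
ℕtoℚ-+ a b = ℚP.toℚᵘ-injective (begin
  ℚ.toℚᵘ (ℕtoℚ (a + b))                       ≈⟨ toℚᵘ-ℕtoℚ (a + b) ⟩
  ℚᵘ.mkℚᵘ (ℤ.+ (a + b)) 0                        ≈⟨ ℚᵘ.*≡* (cong (ℤ._* ℤ.+ 1) (sym (cong₂ ℤ._+_ (ℤP.*-identityʳ (ℤ.+ a)) (ℤP.*-identityʳ (ℤ.+ b))))) ⟩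
  ℚᵘ.mkℚᵘ (ℤ.+ a) 0 ℚᵘ.+ ℚᵘ.mkℚᵘ (ℤ.+ b) 0        ≈⟨ ℚᵘP.+-cong (toℚᵘ-ℕtoℚ a) (toℚᵘ-ℕtoℚ b) ⟨
  ℚ.toℚᵘ (ℕtoℚ a) ℚᵘ.+ ℚ.toℚᵘ (ℕtoℚ b)       ≈⟨ ℚP.toℚᵘ-homo-+ (ℕtoℚ a) (ℕtoℚ b) ⟨
  ℚ.toℚᵘ (ℕtoℚ a ℚ.+ ℕtoℚ b)                  ∎)
  where open ℚᵘP.≃-Reasoning

nonNegative-ℕtoℚ : ∀ n → ℚ.NonNegative (ℕtoℚ n)
nonNegative-ℕtoℚ n = ℚP.normalize-nonNeg n 1

ℕtoℚ-mono : ∀ {a b} → a ≤ b → ℕtoℚ a ℚ.≤ ℕtoℚ b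
ℕtoℚ-mono {a} {b} a≤b = subst (ℕtoℚ a ℚ.≤_)
  (trans (sym (ℕtoℚ-+ a (b ∸ a))) (cong ℕtoℚ (m+[n∸m]≡n a≤b))) 
  (subst (ℚ._≤ ℕtoℚ a ℚ.+ ℕtoℚ (b ∸ a)) (ℚP.+-identityʳ (ℕtoℚ a))
    (ℚP.+-monoʳ-≤ (ℕtoℚ a) (ℚP.nonNegative⁻¹ (ℕtoℚ (b ∸ a)) {{nonNegative-ℕtoℚ (b ∸ a)}})))

-- The base is a rational below the square root of 2. The factor absorbs the rounding of `n / 2` for
-- odd `n`, for which anything up to 4/5 would do.
½ 5/4 : ℚ
½   = ℤ.+ 1 ℚ./ 2
5/4 = ℤ.+ 5 ℚ./ 4

-- Two steps multiply the left side by (5/4)² ≤ 2.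
exponential-bound : ∀ n → ½ ℚ.* (5/4 ^ℚ n) ℚ.≤ ℕtoℚ (2 ^ ⌊ n /2⌋)
exponential-bound zero          = toWitness {a? = ½ ℚ.* 1ℚ ℚP.≤? ℕtoℚ 1} _
exponential-bound (suc zero)    = toWitness {a? = ½ ℚ.* (5/4 ℚ.* 1ℚ) ℚP.≤? ℕtoℚ 1} _
exponential-bound (suc (suc n)) = begin
  ½ ℚ.* (5/4 ℚ.* (5/4 ℚ.* q))      ≡⟨ solve 3 (λ a c q → a :* (c :* (c :* q)) := (c :* c) :* (a :* q)) refl ½ 5/4 q ⟩
  (5/4 ℚ.* 5/4) ℚ.* (½ ℚ.* q)      ≤⟨ ℚP.*-monoˡ-≤-nonNeg (5/4 ℚ.* 5/4) (exponential-bound n) ⟩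
  (5/4 ℚ.* 5/4) ℚ.* y              ≤⟨ ℚP.*-monoʳ-≤-nonNeg y {{nonNegative-ℕtoℚ (2 ^ h)}} (toWitness {a? = (5/4 ℚ.* 5/4) ℚP.≤? (1ℚ ℚ.+ 1ℚ)} _) ⟩
  (1ℚ ℚ.+ 1ℚ) ℚ.* y                ≡⟨ ℚP.*-distribʳ-+ y 1ℚ 1ℚ ⟩
  1ℚ ℚ.* y ℚ.+ 1ℚ ℚ.* y            ≡⟨ cong₂ ℚ._+_ (ℚP.*-identityˡ y) (ℚP.*-identityˡ y) ⟩
  y ℚ.+ y                          ≡⟨ ℕtoℚ-+ (2 ^ h) (2 ^ h) ⟨
  ℕtoℚ (2 ^ h + 2 ^ h)             ≡⟨ cong (λ z → ℕtoℚ (2 ^ h + z)) (+-identityʳ (2 ^ h)) ⟨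
  ℕtoℚ (2 ^ suc h)                 ∎
  where
  open ℚP.≤-Reasoning
  q = 5/4 ^ℚ n
  h = ⌊ n /2⌋
  y = ℕtoℚ (2 ^ h)

falling : ℕ → ℚ → ℚ
falling zero    x = 1ℚ
falling (suc i) x = x ℚ.* falling i (x ℚ.- 1ℚ)

-- The power rule for forward differences. It makes falling factorials the convenient basis for
-- undoing `summing`.
falling-suc : ∀ i x → falling (suc i) (1ℚ ℚ.+ x) ≡ falling (suc i) x ℚ.+ ℕtoℚ (suc i) ℚ.* falling i x
falling-suc zero x = solve 1 (λ x → (con 1ℚ :+ x) :* con 1ℚ := x :* con 1ℚ :+ con 1ℚ :* con 1ℚ) refl x
falling-suc (suc i) x = begin
  (1ℚ ℚ.+ x) ℚ.* falling (suc i) (1ℚ ℚ.+ x ℚ.- 1ℚ)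
    ≡⟨ cong (λ z → (1ℚ ℚ.+ x) ℚ.* falling (suc i) z) (solve 1 (λ x → con 1ℚ :+ x :- con 1ℚ := x) refl x) ⟩
  (1ℚ ℚ.+ x) ℚ.* F
    ≡⟨ solve 2 (λ x F → (con 1ℚ :+ x) :* F := x :* F :+ F) refl x F ⟩
  x ℚ.* F ℚ.+ F
    ≡⟨ cong (λ z → x ℚ.* z ℚ.+ F) (trans (cong (falling (suc i)) (solve 1 (λ x → x := con 1ℚ :+ (x :- con 1ℚ)) refl x)) (falling-suc i y)) ⟩
  x ℚ.* (falling (suc i) y ℚ.+ c ℚ.* falling i y) ℚ.+ x ℚ.* falling i y
    ≡⟨ solve 4 (λ x a c b → x :* (a :+ c :* b) :+ x :* b := x :* a :+ (con 1ℚ :+ c) :* (x :* b)) refl x (falling (suc i) y) c (falling i y) ⟩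
  x ℚ.* falling (suc i) y ℚ.+ (1ℚ ℚ.+ c) ℚ.* F
    ≡⟨ cong (λ z → x ℚ.* falling (suc i) y ℚ.+ z ℚ.* F) (sym (ℕtoℚ-+ 1 (suc i))) ⟩
  x ℚ.* falling (suc i) y ℚ.+ ℕtoℚ (suc (suc i)) ℚ.* F ∎
  where
  open ≡-Reasoning
  y c F : ℚ
  y = x ℚ.- 1ℚ
  c = ℕtoℚ (suc i)
  F = falling (suc i) x

newton : ℕ → List ℚ → ℚ → ℚ
newton i []       x = 0ℚ
newton i (c ∷ cs) x = c ℚ.* falling i x ℚ.+ newton (suc i) cs x

nonZero-ℕtoℚ : ∀ i → ℚ.NonZero (ℕtoℚ (suc i))
nonZero-ℕtoℚ i = ℚP.pos⇒nonZero (ℕtoℚ (suc i)) {{ℚP.normalize-pos (suc i) 1}}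

1/suc : ℕ → ℚ
1/suc i = ℚ.1/_ (ℕtoℚ (suc i)) {{nonZero-ℕtoℚ i}}

1/suc-inverse : ∀ i → 1/suc i ℚ.* ℕtoℚ (suc i) ≡ 1ℚ
1/suc-inverse i = ℚP.*-inverseˡ (ℕtoℚ (suc i)) {{nonZero-ℕtoℚ i}}

-- Termwise discrete integration of a Newton series: the coefficient of degree `i` is divided by
-- `i + 1` and moves to degree `i + 1`.
antidifference : ℕ → List ℚ → List ℚ
antidifference i []       = []
antidifference i (c ∷ cs) = c ℚ.* 1/suc i ∷ antidifference (suc i) cs

newton-suc : ∀ i cs x → newton (suc i) (antidifference i cs) (1ℚ ℚ.+ x)
                      ≡ newton (suc i) (antidifference i cs) x ℚ.+ newton i cs x
newton-suc i []       x = sym (ℚP.+-identityʳ 0ℚ)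
newton-suc i (c ∷ cs) x = begin
  c ℚ.* r ℚ.* falling (suc i) (1ℚ ℚ.+ x) ℚ.+ newton (suc (suc i)) ds (1ℚ ℚ.+ x)
    ≡⟨ cong₂ (λ a b → c ℚ.* r ℚ.* a ℚ.+ b) (falling-suc i x) (newton-suc (suc i) cs x) ⟩
  c ℚ.* r ℚ.* (F ℚ.+ s ℚ.* f) ℚ.+ (N ℚ.+ n)
    ≡⟨ solve 7 (λ c r F s f N n → c :* r :* (F :+ s :* f) :+ (N :+ n) := c :* r :* F :+ N :+ (c :* (r :* s) :* f :+ n)) refl c r F s f N n ⟩
  c ℚ.* r ℚ.* F ℚ.+ N ℚ.+ (c ℚ.* (r ℚ.* s) ℚ.* f ℚ.+ n)
    ≡⟨ cong (λ z → c ℚ.* r ℚ.* F ℚ.+ N ℚ.+ (z ℚ.* f ℚ.+ n)) (trans (cong (c ℚ.*_) (1/suc-inverse i)) (ℚP.*-identityʳ c)) ⟩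
  c ℚ.* r ℚ.* F ℚ.+ N ℚ.+ (c ℚ.* f ℚ.+ n) ∎
  where
  open ≡-Reasoning
  ds = antidifference (suc i) cs
  r s F f N n : ℚ
  r = 1/suc i
  s = ℕtoℚ (suc i)
  F = falling (suc i) x
  f = falling i x
  N = newton (suc (suc i)) ds x
  n = newton (suc i) cs x

poly⇒newton : ∀ {f} → Poly f → Σ[ cs ∈ List ℚ ] Σ[ n₀ ∈ ℕ ] (∀ n → n₀ ≤ n → ℕtoℚ (f n) ≡ newton 0 cs (ℕtoℚ n))
poly⇒newton (vanishing n₀ z) = [] , n₀ , λ n p → cong ℕtoℚ (z n p)
poly⇒newton {f} (summing {g} P n₀ s) with poly⇒newton P
... | cs , n₁ , eq = c ∷ ds , n₂ , λ n p → subst (λ n → ℕtoℚ (f n) ≡ newton 0 (c ∷ ds) (ℕtoℚ n)) (m+[n∸m]≡n p) (from-n₂ (n ∸ n₂))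
  where
  n₂ = n₀ ⊔ n₁
  ds = antidifference 0 cs
  c : ℚ
  -- The constant of summation, fixed by requiring agreement at `n₂`; equal differences from there
  -- on propagate it.
  c = ℕtoℚ (f n₂) ℚ.- newton 1 ds (ℕtoℚ n₂)
  from-n₂ : ∀ d → ℕtoℚ (f (n₂ + d)) ≡ newton 0 (c ∷ ds) (ℕtoℚ (n₂ + d))
  from-n₂ zero = subst (λ n → ℕtoℚ (f n) ≡ newton 0 (c ∷ ds) (ℕtoℚ n)) (sym (+-identityʳ n₂))
    (solve 2 (λ a b → a := (a :- b) :* con 1ℚ :+ b) refl (ℕtoℚ (f n₂)) (newton 1 ds (ℕtoℚ n₂)))
  from-n₂ (suc d) = subst (λ n → ℕtoℚ (f n) ≡ newton 0 (c ∷ ds) (ℕtoℚ n)) (sym (+-suc n₂ d)) (begin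
    ℕtoℚ (f (suc m))                                ≡⟨ cong ℕtoℚ (s m (≤-trans (m≤m⊔n n₀ n₁) (m≤m+n n₂ d))) ⟩
    ℕtoℚ (f m + g m)                                ≡⟨ ℕtoℚ-+ (f m) (g m) ⟩
    ℕtoℚ (f m) ℚ.+ ℕtoℚ (g m)                       ≡⟨ cong₂ ℚ._+_ (from-n₂ d) (eq m (≤-trans (m≤n⊔m n₀ n₁) (m≤m+n n₂ d))) ⟩
    c ℚ.* 1ℚ ℚ.+ newton 1 ds x ℚ.+ newton 0 cs x    ≡⟨ ℚP.+-assoc (c ℚ.* 1ℚ) _ _ ⟩
    c ℚ.* 1ℚ ℚ.+ (newton 1 ds x ℚ.+ newton 0 cs x)  ≡⟨ cong (c ℚ.* 1ℚ ℚ.+_) (newton-suc 0 cs x) ⟨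
    c ℚ.* 1ℚ ℚ.+ newton 1 ds (1ℚ ℚ.+ x)             ≡⟨ cong (λ z → c ℚ.* 1ℚ ℚ.+ newton 1 ds z) (ℕtoℚ-+ 1 m) ⟨
    c ℚ.* 1ℚ ℚ.+ newton 1 ds (ℕtoℚ (suc m))         ∎)
    where
    open ≡-Reasoning
    m = n₂ + d
    x = ℕtoℚ m

infixl 6 _⊕_

_⊕_ : List ℚ → List ℚ → List ℚ
[]       ⊕ q        = q
(a ∷ p)  ⊕ []       = a ∷ p
(a ∷ p)  ⊕ (b ∷ q)  = a ℚ.+ b ∷ p ⊕ q

scale : ℚ → List ℚ → List ℚ
scale c = List.map (c ℚ.*_)

eval-⊕ : ∀ p q x → evalPoly (p ⊕ q) x ≡ evalPoly p x ℚ.+ evalPoly q x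
eval-⊕ []      q       x = sym (ℚP.+-identityˡ _)
eval-⊕ (a ∷ p) []      x = sym (ℚP.+-identityʳ _)
eval-⊕ (a ∷ p) (b ∷ q) x = trans (cong (λ z → a ℚ.+ b ℚ.+ x ℚ.* z) (eval-⊕ p q x))
  (solve 5 (λ a b x p q → a :+ b :+ x :* (p :+ q) := a :+ x :* p :+ (b :+ x :* q)) refl a b x (evalPoly p x) (evalPoly q x))

eval-scale : ∀ c p x → evalPoly (scale c p) x ≡ c ℚ.* evalPoly p x
eval-scale c []      x = sym (ℚP.*-zeroʳ c)
eval-scale c (a ∷ p) x = trans (cong (λ z → c ℚ.* a ℚ.+ x ℚ.* z) (eval-scale c p x))
  (solve 4 (λ c a x p → c :* a :+ x :* (c :* p) := c :* (a :+ x :* p)) refl c a x (evalPoly p x))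

-- Horner's rule for substituting `x - 1`: the product with `x - 1` is the list shifted by one place
-- minus the list itself.
precede : List ℚ → List ℚ
precede []      = []
precede (a ∷ p) = (a ∷ []) ⊕ (0ℚ ∷ precede p) ⊕ scale (ℚ.- 1ℚ) (precede p)

eval-precede : ∀ p x → evalPoly (precede p) x ≡ evalPoly p (x ℚ.- 1ℚ)
eval-precede []      x = refl
eval-precede (a ∷ p) x = begin
  evalPoly ((a ∷ []) ⊕ (0ℚ ∷ r) ⊕ scale (ℚ.- 1ℚ) r) x
    ≡⟨ eval-⊕ ((a ∷ []) ⊕ (0ℚ ∷ r)) (scale (ℚ.- 1ℚ) r) x ⟩
  evalPoly ((a ∷ []) ⊕ (0ℚ ∷ r)) x ℚ.+ evalPoly (scale (ℚ.- 1ℚ) r) x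
    ≡⟨ cong₂ ℚ._+_ (eval-⊕ (a ∷ []) (0ℚ ∷ r) x) (eval-scale (ℚ.- 1ℚ) r x) ⟩
  a ℚ.+ x ℚ.* 0ℚ ℚ.+ (0ℚ ℚ.+ x ℚ.* e) ℚ.+ (ℚ.- 1ℚ) ℚ.* e
    ≡⟨ solve 3 (λ a x e → a :+ x :* con 0ℚ :+ (con 0ℚ :+ x :* e) :+ (:- con 1ℚ) :* e := a :+ (x :- con 1ℚ) :* e) refl a x e ⟩
  a ℚ.+ (x ℚ.- 1ℚ) ℚ.* e
    ≡⟨ cong (λ z → a ℚ.+ (x ℚ.- 1ℚ) ℚ.* z) (eval-precede p x) ⟩
  a ℚ.+ (x ℚ.- 1ℚ) ℚ.* evalPoly p (x ℚ.- 1ℚ) ∎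
  where
  open ≡-Reasoning
  r = precede p
  e = evalPoly r x

fallingPoly : ℕ → List ℚ
fallingPoly zero    = 1ℚ ∷ []
fallingPoly (suc i) = 0ℚ ∷ precede (fallingPoly i)

eval-falling : ∀ i x → evalPoly (fallingPoly i) x ≡ falling i x
eval-falling zero    x = trans (cong (1ℚ ℚ.+_) (ℚP.*-zeroʳ x)) (ℚP.+-identityʳ 1ℚ)
eval-falling (suc i) x = trans (ℚP.+-identityˡ _)
  (cong (x ℚ.*_) (trans (eval-precede (fallingPoly i) x) (eval-falling i (x ℚ.- 1ℚ))))

newtonPoly : ℕ → List ℚ → List ℚ
newtonPoly i []       = []
newtonPoly i (c ∷ cs) = scale c (fallingPoly i) ⊕ newtonPoly (suc i) cs

eval-newton : ∀ i cs x → evalPoly (newtonPoly i cs) x ≡ newton i cs x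
eval-newton i []       x = refl
eval-newton i (c ∷ cs) x = trans (eval-⊕ (scale c (fallingPoly i)) _ x)
  (cong₂ ℚ._+_ (trans (eval-scale c (fallingPoly i) x) (cong (c ℚ.*_) (eval-falling i x))) (eval-newton (suc i) cs x))

poly⇒eval : ∀ {f} → Poly f → Σ[ p ∈ List ℚ ] Σ[ n₀ ∈ ℕ ] (∀ n → n₀ ≤ n → ℕtoℚ (f n) ≡ evalPoly p (ℕtoℚ n))
poly⇒eval P with poly⇒newton P
... | cs , n₀ , eq = newtonPoly 0 cs , n₀ , λ n p → trans (eq n p) (sym (eval-newton 0 cs (ℕtoℚ n)))

-- Sums of chains

finBound : ∀ {n} (f : Fin n → ℕ) → Σ[ N ∈ ℕ ] (∀ x → f x ℕ.< N)
finBound {zero}  f = 0 , λ ()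
finBound {suc n} f with finBound (f ∘ F.suc)
... | N , p = suc (f F.zero) ⊔ N , λ
  { F.zero    → m≤m⊔n _ N
  ; (F.suc x) → ≤-trans (p x) (m≤n⊔m (suc (f F.zero)) N) }

-- König's lemma for colourings of ℕ with finitely many colours: `local` makes the condition at `N`
-- depend on a finite initial segment, and `anti` makes the conditions cumulative.
module Compactness (em : EM) {ℓ : ℕ} (G : ℕ → (ℕ → Fin (suc ℓ)) → Set)
  (local : ∀ N {c c'} → (∀ x → x ℕ.< N → c x ≡ c' x) → G N c → G N c')
  (anti : ∀ {M N c} → M ≤ N → G N c → G M c)
  (finitely : ∀ N → Σ[ c ∈ (ℕ → Fin (suc ℓ)) ] G N c) where

  private
    Extendable : ℕ → (ℕ → Fin (suc ℓ)) → Set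
    Extendable i c = ∀ N → Σ[ d ∈ (ℕ → Fin (suc ℓ)) ] ((∀ x → x ℕ.< i → d x ≡ c x) × G N d)

    update : (ℕ → Fin (suc ℓ)) → ℕ → Fin (suc ℓ) → ℕ → Fin (suc ℓ)
    update c i a x with x ≟ i
    ... | yes _ = a
    ... | no _  = c x

    update-same : ∀ c i a → update c i a i ≡ a
    update-same c i a with i ≟ i
    ... | yes _ = refl
    ... | no ne = ⊥-elim (ne refl)

    update-other : ∀ c i a x → x ≢ i → update c i a x ≡ c x
    update-other c i a x ne with x ≟ i
    ... | yes e = ⊥-elim (ne e)
    ... | no _  = refl

    stable : ∀ {P : Set} → ¬ ¬ P → P
    stable = decidable-stable em

    -- If each colour at `i` failed at some stage, then a stage beyond all of these finitely many
    -- would admit no extension of the first `i` values, by `anti`.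
    extend-by : ∀ i c → Extendable i c → Σ[ a ∈ Fin (suc ℓ) ] Extendable (suc i) (update c i a)
    extend-by i c ext = stable λ none →
      let
        fails : ∀ a → Σ[ N ∈ ℕ ] ¬ (Σ[ d ∈ _ ] ((∀ x → x ℕ.< suc i → d x ≡ update c i a x) × G N d))
        fails a = stable λ always → none (a , λ N → stable λ ¬d → always (N , ¬d))
        (N , bound) = finBound (proj₁ ∘ fails)
        (d , agree , Gd) = ext N
      in proj₂ (fails (d i)) (d , agrees d agree , anti (<⇒≤ (bound (d i))) Gd)
      where
      agrees : ∀ d → (∀ x → x ℕ.< i → d x ≡ c x) → ∀ x → x ℕ.< suc i → d x ≡ update c i (d i) x
      agrees d agree x p with m≤n⇒m<n∨m≡n (s≤s⁻¹ p)
      ... | inj₂ refl = sym (update-same c x (d x))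
      ... | inj₁ q    = trans (agree x q) (sym (update-other c i (d i) x (<⇒≢ q)))

    stage : ∀ i → Σ[ c ∈ (ℕ → Fin (suc ℓ)) ] Extendable i c
    stage zero    = (λ _ → F.zero) , λ N → proj₁ (finitely N) , (λ _ ()) , proj₂ (finitely N)
    stage (suc i) = let (c , ext) = stage i ; (a , ext') = extend-by i c ext in update c i a , ext'

    -- A diagonal: the value at `x` is set at stage `x + 1`, and later updates affect only larger
    -- arguments.
    limit : ℕ → Fin (suc ℓ)
    limit x = proj₁ (stage (suc x)) x

    stage-limit : ∀ x d → proj₁ (stage (suc x + d)) x ≡ limit x
    stage-limit x zero    = cong (λ j → proj₁ (stage (suc j)) x) (+-identityʳ x)
    stage-limit x (suc d) = trans (cong (λ j → proj₁ (stage (suc j)) x) (+-suc x d))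
      (trans (update-other _ (suc x + d) _ x (<⇒≢ (s≤s (m≤m+n x d)))) (stage-limit x d))

  compactness : Σ[ c ∈ (ℕ → Fin (suc ℓ)) ] (∀ N → G N c)
  compactness = limit , λ N → let (d , agree , Gd) = proj₂ (stage N) N in
    local N (λ x p → trans (agree x p)
      (subst (λ j → proj₁ (stage j) x ≡ limit x) (m+[n∸m]≡n p) (stage-limit x (N ∸ suc x)))) Gd

Idx : Maybe ℕ → Set
Idx (just b) = Fin b
Idx nothing  = ℕ

val : ∀ {u} → Idx u → ℕ
val {just b}  = toℕ
val {nothing} = id

val-inj : ∀ {u} {s t : Idx u} → val {u} s ≡ val {u} t → s ≡ t
val-inj {just b}  = FP.toℕ-injective
val-inj {nothing} = id

-- A sum of chains with order types given by the entries, nothing standing for ω.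
Carrier : ∀ {L} → Vec (Maybe ℕ) L → Set
Carrier []       = ⊥
Carrier (u ∷ us) = Idx u ⊎ Carrier us

infix 4 _≼_

_≼_ : ∀ {L} {us : Vec (Maybe ℕ) L} → Carrier us → Carrier us → Set
_≼_ {us = u ∷ us} (inj₁ s) (inj₁ t) = val {u} s ≤ val {u} t
_≼_ {us = u ∷ us} (inj₁ s) (inj₂ d) = ⊤
_≼_ {us = u ∷ us} (inj₂ c) (inj₁ t) = ⊥
_≼_ {us = u ∷ us} (inj₂ c) (inj₂ d) = c ≼ d

≼-refl : ∀ {L} {us : Vec (Maybe ℕ) L} {c : Carrier us} → c ≼ c
≼-refl {us = u ∷ us} {inj₁ s} = ≤-refl
≼-refl {us = u ∷ us} {inj₂ c} = ≼-refl {c = c}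

≼-trans : ∀ {L} {us : Vec (Maybe ℕ) L} {c d e : Carrier us} → c ≼ d → d ≼ e → c ≼ e
≼-trans {us = u ∷ us} {inj₁ _} {inj₁ _} {inj₁ _} p q = ≤-trans p q
≼-trans {us = u ∷ us} {inj₁ _} {_}      {inj₂ _} p q = tt
≼-trans {us = u ∷ us} {inj₂ c} {inj₂ d} {inj₂ e} p q = ≼-trans {c = c} {d} {e} p q

≼-antisym : ∀ {L} {us : Vec (Maybe ℕ) L} {c d : Carrier us} → c ≼ d → d ≼ c → c ≡ d
≼-antisym {us = u ∷ us} {inj₁ _} {inj₁ _} p q = cong inj₁ (val-inj {u} (≤-antisym p q))
≼-antisym {us = u ∷ us} {inj₂ _} {inj₂ _} p q = cong inj₂ (≼-antisym p q)

≼-total : ∀ {L} {us : Vec (Maybe ℕ) L} (c d : Carrier us) → c ≼ d ⊎ d ≼ c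
≼-total {us = u ∷ us} (inj₁ s) (inj₁ t) = ≤-total (val {u} s) (val {u} t)
≼-total {us = u ∷ us} (inj₁ s) (inj₂ d) = inj₁ tt
≼-total {us = u ∷ us} (inj₂ c) (inj₁ t) = inj₂ tt
≼-total {us = u ∷ us} (inj₂ c) (inj₂ d) = ≼-total c d

≼-isTotalOrder : ∀ {L} {us : Vec (Maybe ℕ) L} → IsTotalOrder _≡_ (_≼_ {us = us})
≼-isTotalOrder = record
  { isPartialOrder = record
    { isPreorder = record
      { isEquivalence = isEquivalence
      ; reflexive = λ { {c} refl → ≼-refl {c = c} }
      ; trans = λ {c} {d} {e} → ≼-trans {c = c} {d} {e} }
    ; antisym = ≼-antisym }
  ; total = ≼-total }

cmpᶜ : ∀ {L} {us : Vec (Maybe ℕ) L} → Carrier us → Carrier us → Fin 3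
cmpᶜ {us = u ∷ us} (inj₁ s) (inj₁ t) = cmp (val {u} s) (val {u} t)
cmpᶜ {us = u ∷ us} (inj₁ s) (inj₂ d) = F.zero
cmpᶜ {us = u ∷ us} (inj₂ c) (inj₁ t) = F.suc (F.suc F.zero)
cmpᶜ {us = u ∷ us} (inj₂ c) (inj₂ d) = cmpᶜ c d

≺⇒cmpᶜ : ∀ {L} {us : Vec (Maybe ℕ) L} {c d : Carrier us} → c ≼ d → c ≢ d → cmpᶜ c d ≡ F.zero
≺⇒cmpᶜ {us = u ∷ us} {inj₁ s} {inj₁ t} p ne = cmp-< (≤∧≢⇒< p (ne ∘ cong inj₁ ∘ val-inj {u}))
≺⇒cmpᶜ {us = u ∷ us} {inj₁ s} {inj₂ d} p ne = refl
≺⇒cmpᶜ {us = u ∷ us} {inj₂ c} {inj₂ d} p ne = ≺⇒cmpᶜ p (ne ∘ cong inj₂)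

cmpᶜ⇒≼ : ∀ {L} {us : Vec (Maybe ℕ) L} {c d : Carrier us} → cmpᶜ c d ≡ F.zero → c ≼ d
cmpᶜ⇒≼ {us = u ∷ us} {inj₁ s} {inj₁ t} e = <⇒≤ (cmp≡0⇒< (val {u} s) (val {u} t) e)
cmpᶜ⇒≼ {us = u ∷ us} {inj₁ s} {inj₂ d} e = tt
cmpᶜ⇒≼ {us = u ∷ us} {inj₂ c} {inj₂ d} e = cmpᶜ⇒≼ {c = c} {d} e

run : ∀ {L} {us : Vec (Maybe ℕ) L} → Carrier us → ℕ
run {us = u ∷ us} (inj₁ s) = 0
run {us = u ∷ us} (inj₂ c) = suc (run c)

pos : ∀ {L} {us : Vec (Maybe ℕ) L} → Vec ℕ L → Carrier us → ℕ
pos {us = u ∷ us} (a ∷ m) (inj₁ s) = val {u} s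
pos {us = u ∷ us} (a ∷ m) (inj₂ c) = a + pos m c

-- The element survives when the chains are truncated to the lengths `m`. Only then is `pos m` its
-- position in the inflated chain.
Below : ∀ {L} {us : Vec (Maybe ℕ) L} → Vec ℕ L → Carrier us → Set
Below {us = u ∷ us} (a ∷ m) (inj₁ s) = val {u} s ℕ.< a
Below {us = u ∷ us} (a ∷ m) (inj₂ c) = Below m c

pos< : ∀ {L} {us : Vec (Maybe ℕ) L} m (c : Carrier us) → Below m c → pos m c ℕ.< sum (toList m)
pos< {us = u ∷ us} (a ∷ m) (inj₁ s) p = ≤-trans p (m≤m+n a _)
pos< {us = u ∷ us} (a ∷ m) (inj₂ c) p = +-monoʳ-< a (pos< m c p)

loc-pos : ∀ {L} {us : Vec (Maybe ℕ) L} m (c : Carrier us) → Below m c → loc (toList m) (pos m c) ≡ run c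
loc-pos {us = u ∷ us} (a ∷ m) (inj₁ s) p = loc-head a (toList m) _ p
loc-pos {us = u ∷ us} (a ∷ m) (inj₂ c) p = trans (loc-shift a (toList m) _) (cong suc (loc-pos m c p))

cmp-+ : ∀ a x y → cmp (a + x) (a + y) ≡ cmp x y
cmp-+ zero    x y = refl
cmp-+ (suc a) x y = cmp-+ a x y

cmp-pos : ∀ {L} {us : Vec (Maybe ℕ) L} m (c d : Carrier us) → Below m c → Below m d →
  cmp (pos m c) (pos m d) ≡ cmpᶜ c d
cmp-pos {us = u ∷ us} (a ∷ m) (inj₁ s) (inj₁ t) p q = refl
cmp-pos {us = u ∷ us} (a ∷ m) (inj₁ s) (inj₂ d) p q = cmp-< (≤-trans p (m≤m+n a _))
cmp-pos {us = u ∷ us} (a ∷ m) (inj₂ c) (inj₁ t) p q = cmp-> (≤-trans q (m≤m+n a _))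
cmp-pos {us = u ∷ us} (a ∷ m) (inj₂ c) (inj₂ d) p q = trans (cmp-+ a _ _) (cmp-pos m c d p q)

val-onto : ∀ {a} u → Within a u → ∀ x → x ℕ.< a → Σ[ s ∈ Idx u ] val {u} s ≡ x
val-onto (just b) a≤b x p = fromℕ< (<-≤-trans p a≤b) , FP.toℕ-fromℕ< (<-≤-trans p a≤b)
val-onto nothing  _   x p = x , refl

pos-onto : ∀ {L} {us : Vec (Maybe ℕ) L} m → InBox m us → ∀ x → x ℕ.< sum (toList m) →
  Σ[ c ∈ Carrier us ] (Below m c × pos m c ≡ x)
pos-onto {us = u ∷ us} (a ∷ m) (w ∷ ws) x p with x <? a
... | yes q = let (s , e) = val-onto u w x q in inj₁ s , subst (ℕ._< a) (sym e) q , e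
... | no ¬q = let (c , b , e) = pos-onto m ws (x ∸ a) (+-cancelˡ-< a _ _ (subst (ℕ._< a + sum (toList m)) (sym eq) p)) in
      inj₂ c , b , trans (cong (a +_) e) eq
  where
  eq : a + (x ∸ a) ≡ x
  eq = m+[n∸m]≡n (≮⇒≥ ¬q)

-- Numbers the elements by naturals so that compactness over ℕ applies. Besides being injective, it
-- bounds the index inside each chain, so elements of bounded code lie in a finite `cutoff`.
code : ∀ {L} {us : Vec (Maybe ℕ) L} → Carrier us → ℕ
code {us = u ∷ us} (inj₁ s) = 2 * val {u} s
code {us = u ∷ us} (inj₂ c) = suc (2 * code c)

code-inj : ∀ {L} {us : Vec (Maybe ℕ) L} {c d : Carrier us} → code c ≡ code d → c ≡ d
code-inj {us = u ∷ us} {inj₁ s} {inj₁ t} e = cong inj₁ (val-inj {u} (*-cancelˡ-≡ _ _ 2 e))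
code-inj {us = u ∷ us} {inj₁ s} {inj₂ d} e = ⊥-elim (even≢odd (val {u} s) (code d) e)
code-inj {us = u ∷ us} {inj₂ c} {inj₁ t} e = ⊥-elim (even≢odd (val {u} t) (code c) (sym e))
code-inj {us = u ∷ us} {inj₂ c} {inj₂ d} e = cong inj₂ (code-inj (*-cancelˡ-≡ _ _ 2 (ℕP.suc-injective e)))

cutoff : ∀ {L} → ℕ → Vec (Maybe ℕ) L → Vec ℕ L
cutoff N []             = []
cutoff N (just b ∷ us)  = b ∷ cutoff N us
cutoff N (nothing ∷ us) = N ∷ cutoff N us

cutoff-inBox : ∀ {L} N (us : Vec (Maybe ℕ) L) → InBox (cutoff N us) us
cutoff-inBox N []             = []
cutoff-inBox N (just b ∷ us)  = ≤-refl ∷ cutoff-inBox N us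
cutoff-inBox N (nothing ∷ us) = tt ∷ cutoff-inBox N us

code<⇒below : ∀ {L} N {us : Vec (Maybe ℕ) L} (c : Carrier us) → code c ℕ.< N → Below (cutoff N us) c
code<⇒below N {just b ∷ us}  (inj₁ s) p = FP.toℕ<n s
code<⇒below N {nothing ∷ us} (inj₁ s) p = ≤-<-trans (m≤m+n s _) p
code<⇒below N {just b ∷ us}  (inj₂ c) p = code<⇒below N c (≤-<-trans (m≤n⇒m≤1+n (m≤m+n (code c) _)) p)
code<⇒below N {nothing ∷ us} (inj₂ c) p = code<⇒below N c (≤-<-trans (m≤n⇒m≤1+n (m≤m+n (code c) _)) p)

sumOfChains : ∀ {k K L} → Table k K → Vec (Maybe ℕ) L → Structure k
sumOfChains {K = K} Q us = record
  { Carrier = Carrier us ; _≤_ = _≼_ ; isTotalOrder = ≼-isTotalOrder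
  ; ρ = λ i c d → Q i (clamp K (run c)) (clamp K (run d)) (cmpᶜ c d) ≡ true }

module _ {k K L : ℕ} (Q : Table k K) (us : Vec (Maybe ℕ) L) where

  R : Structure k
  R = sumOfChains Q us

  induced : ∀ {n} → (Fin n → Carrier us) → FinStr k n
  induced f i x y = Q i (clamp K (run (f x))) (clamp K (run (f y))) (cmpᶜ (f x) (f y))

  module _ (m : Vec ℕ L) {n : ℕ} {f : Fin n → Carrier us} (below : ∀ x → Below m (f x)) where

    induced-inflate : induced f ≗ₛ (λ i x y → inflate Q (toList m) i (pos m (f x)) (pos m (f y)))
    induced-inflate i x y = sym (trans
      (cong₂ (λ a b → Q i (clamp K a) (clamp K b) (cmp (pos m (f x)) (pos m (f y)))) (loc-pos m (f x) (below x)) (loc-pos m (f y) (below y)))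
      (cong (Q i _ _) (cmp-pos m (f x) (f y) (below x) (below y))))

    pos-increasing : StrictlyIncreasing R f → Increasing (pos m ∘ f)
    pos-increasing inc x y p = cmp≡0⇒< _ _ (trans (cmp-pos m (f x) (f y) (below x) (below y))
      (≺⇒cmpᶜ (proj₁ (inc x y p)) (proj₂ (inc x y p))))

    increasing-pos : Increasing (pos m ∘ f) → StrictlyIncreasing R f
    increasing-pos inc x y p =
      cmpᶜ⇒≼ {c = f x} {f y} (trans (sym (cmp-pos m (f x) (f y) (below x) (below y))) (cmp-< (inc x y p)))
      , λ e → <⇒≢ (inc x y p) (cong (pos m) e)

  inAge : ∀ m → InBox m us → ∀ {n} (s : FinStr k n) → sum (toList m) ≡ n →
    s ≗ₛ fin n (inflate Q (toList m)) → InAge R s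
  inAge m inbox {n} s refl eq = f , increasing-pos m below inc , ≗⇒≅ λ i x y → trans (eq i x y)
      (trans (sym (cong₂ (inflate Q (toList m) i) (at x) (at y))) (sym (induced-inflate m below i x y)))
    where
    onto : ∀ x → _
    onto x = pos-onto m inbox (toℕ x) (FP.toℕ<n x)
    f : Fin n → Carrier us
    f x = proj₁ (onto x)
    below : ∀ x → Below m (f x)
    below x = proj₁ (proj₂ (onto x))
    at : ∀ x → pos m (f x) ≡ toℕ x
    at x = proj₂ (proj₂ (onto x))
    inc : Increasing (pos m ∘ f)
    inc x y p = subst₂ ℕ._<_ (sym (at x)) (sym (at y)) p

  module _ {C : Class k} (her : Hereditary C)
    (inC : ∀ m → InBox m us → C (sum (toList m)) (fin (sum (toList m)) (inflate Q (toList m)))) where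

    age⊆C : ∀ {n} (s : FinStr k n) → InAge R s → C n s
    age⊆C {n} s (f , inc , iso) =
      member-≗ her (λ i x y → trans (sym (induced-inflate m below i x y)) (sym (≅⇒≗ s (induced f) iso i x y)))
        (member-increasing her (inflate Q (toList m)) (pos m ∘ f) (λ x → pos< m (f x) (below x))
          (pos-increasing m below inc) (inC m (cutoff-inBox N us)))
      where
      N : ℕ
      N = proj₁ (finBound (code ∘ f))
      m : Vec ℕ L
      m = cutoff N us
      below : ∀ x → Below m (f x)
      below x = code<⇒below N (f x) (proj₂ (finBound (code ∘ f)) x)

    module _ (em : EM) {ℓ : ℕ} (decomps : ∀ n (s : FinStr k n) → C n s → MonoDecomp (toStructure s) (suc ℓ)) where

      private
        -- Limiting the codes by `N` makes the condition local and cumulative, as `compactness`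
        -- requires. Two finite subsets always lie below some common `N`, so goodness at every `N`
        -- gives back the full decomposition property.
        Good : ℕ → (ℕ → Fin (suc ℓ)) → Set
        Good N c = ∀ n (f f' : Fin n → Carrier us) → StrictlyIncreasing R f → StrictlyIncreasing R f' →
          (∀ x → code (f x) ℕ.< N) → (∀ x → code (f' x) ℕ.< N) →
          (∀ j → countIn R (c ∘ code) f j ≡ countIn R (c ∘ code) f' j) →
          IsoRels (restrictRels R f) (restrictRels R f')

        counts-cong : ∀ {n} (f : Fin n → Carrier us) {c c' : ℕ → Fin (suc ℓ)} →
          (∀ x → c (code (f x)) ≡ c' (code (f x))) → ∀ j →
          countIn R (c ∘ code) f j ≡ countIn R (c' ∘ code) f j
        counts-cong {n} f eq j = countFin-cong n λ x → cong (λ a → ⌊ a F.≟ j ⌋) (eq x)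

        local : ∀ N {c c'} → (∀ x → x ℕ.< N → c x ≡ c' x) → Good N c → Good N c'
        local N {c} {c'} eq G n f f' inc inc' p p' counts = G n f f' inc inc' p p' λ j →
          trans (counts-cong f {c} {c'} (λ x → eq _ (p x)) j)
            (trans (counts j) (sym (counts-cong f' {c} {c'} (λ x → eq _ (p' x)) j)))

        anti : ∀ {M N c} → M ≤ N → Good N c → Good M c
        anti M≤N G n f f' inc inc' p p' =
          G n f f' inc inc' (λ x → ≤-trans (p x) M≤N) (λ x → ≤-trans (p' x) M≤N)

        -- The elements with code below `N` lie in a truncation that belongs to `C`. Its
        -- decomposition, given by `decomps`, is pulled back along `code`.
        finitely : ∀ N → Σ[ c ∈ _ ] Good N c
        finitely N = c , good
          where
          m : Vec ℕ L
          m = cutoff N us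
          S : ℕ
          S = sum (toList m)
          s : FinStr k S
          s = fin S (inflate Q (toList m))
          decomp = decomps S s (inC m (cutoff-inBox N us))
          blk : Fin S → Fin (suc ℓ)
          blk = proj₁ decomp
          Coded-by : ℕ → Set
          Coded-by y = Σ[ d ∈ Carrier us ] (Below m d × code d ≡ y)
          colour : ∀ {y} → Dec (Coded-by y) → Fin (suc ℓ)
          colour (yes (d , b , _)) = blk (fromℕ< (pos< m d b))
          -- An arbitrary colour for numbers that code no element of the truncation; the elements
          -- under comparison all have codes of the other kind.
          colour (no _)            = F.zero
          c : ℕ → Fin (suc ℓ)
          c y = colour (em {Coded-by y})
          place : ∀ {n} (f : Fin n → Carrier us) → (∀ x → Below m (f x)) → Fin n → Fin S
          place f below x = fromℕ< (pos< m (f x) (below x))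
          toℕ-place : ∀ {n} (f : Fin n → Carrier us) below x → toℕ (place f below x) ≡ pos m (f x)
          toℕ-place f below x = FP.toℕ-fromℕ< (pos< m (f x) (below x))
          colour-code : ∀ d (b : Below m d) (dec : Dec (Coded-by (code d))) → colour dec ≡ blk (fromℕ< (pos< m d b))
          colour-code d b (no none) = ⊥-elim (none (d , b , refl))
          colour-code d b (yes (d' , b' , e)) with code-inj {c = d'} {d} e
          ... | refl = refl
          place-inc : ∀ {n} (f : Fin n → Carrier us) below → StrictlyIncreasing R f →
            StrictlyIncreasing (toStructure s) (place f below)
          place-inc f below inc = <⇒inc s λ x y p →
            subst₂ ℕ._<_ (sym (toℕ-place f below x)) (sym (toℕ-place f below y)) (pos-increasing m below inc x y p)
          place-induced : ∀ {n} (f : Fin n → Carrier us) below → restrictFin s (place f below) ≗ₛ induced f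
          place-induced f below i x y = trans
            (cong₂ (inflate Q (toList m) i) (toℕ-place f below x) (toℕ-place f below y))
            (sym (induced-inflate m below i x y))
          place-counts : ∀ {n} (f : Fin n → Carrier us) below j →
            countIn (toStructure s) blk (place f below) j ≡ countIn R (c ∘ code) f j
          place-counts {n} f below j = countFin-cong n λ x →
            cong (λ a → ⌊ a F.≟ j ⌋) (sym (colour-code (f x) (below x) em))
          good : Good N c
          good n f f' inc inc' p p' counts = ≗⇒≅ λ i x y →
            trans (sym (place-induced f below i x y)) (trans
              (≅⇒≗ (restrictFin s (place f below)) (restrictFin s (place f' below'))
                (proj₂ decomp n (place f below) (place f' below') (place-inc f below inc) (place-inc f' below' inc')
                  λ j → trans (place-counts f below j) (trans (counts j) (sym (place-counts f' below' j)))) i x y)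
              (place-induced f' below' i x y))
            where
            below : ∀ x → Below m (f x)
            below x = code<⇒below N (f x) (p x)
            below' : ∀ x → Below m (f' x)
            below' x = code<⇒below N (f' x) (p' x)

      sumOfChains-decomp : MonoDecomp R (suc ℓ)
      sumOfChains-decomp = proj₁ limit ∘ code , λ n f f' inc inc' counts →
        let (N , p) = finBound (code ∘ f) ; (N' , p') = finBound (code ∘ f') in
        proj₂ limit (N ⊔ N') n f f' inc inc' (λ x → ≤-trans (p x) (m≤m⊔n N N'))
          (λ x → ≤-trans (p' x) (m≤n⊔m N N')) counts
        where
        limit = Compactness.compactness em Good (λ N {c} {c'} → local N {c} {c'}) (λ {M} {N} {c} → anti {M} {N} {c}) finitely

-- Classes with boundedly many breaks

pointwise-toList : ∀ {L} {v w : Vec ℕ L} → VPw.Pointwise _≤_ v w → LPw.Pointwise _≤_ (toList v) (toList w)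
pointwise-toList []       = []
pointwise-toList (p ∷ ps) = p ∷ pointwise-toList ps

toList-inj : ∀ {L} (v w : Vec ℕ L) → toList v ≡ toList w → v ≡ w
toList-inj []      []       _ = refl
toList-inj (a ∷ v) (b ∷ w) e = cong₂ _∷_ (LP.∷-injectiveˡ e) (toList-inj v w (LP.∷-injectiveʳ e))

asVec : ∀ {N} m → length m ℕ.< N → Σ[ L ∈ Fin N ] Σ[ v ∈ Vec ℕ (toℕ L) ] toList v ≡ m
asVec m p = fromℕ< p , build _ (FP.toℕ-fromℕ< p)
  where
  build : ∀ l → l ≡ length m → Σ[ v ∈ Vec ℕ l ] toList v ≡ m
  build _ refl = fromList m , VecP.toList∘fromList m

gather : ∀ {A : Set} Y (f : Fin Y → List A) → Σ[ as ∈ List A ]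
  ((∀ y a → a ∈ f y → a ∈ as) × (∀ a → a ∈ as → Σ[ y ∈ Fin Y ] a ∈ f y))
gather zero    f = [] , (λ ()) , λ _ ()
gather (suc Y) f with gather Y (f ∘ F.suc)
... | as , into , from = f F.zero ++ as ,
  (λ { F.zero a m → ∈-++⁺ˡ m ; (F.suc y) a m → ∈-++⁺ʳ (f F.zero) (into y a m) }) ,
  λ a m → split a (∈-++⁻ (f F.zero) m)
  where
  split : ∀ a → a ∈ f F.zero ⊎ a ∈ as → Σ[ y ∈ Fin (suc Y) ] a ∈ f y
  split a (inj₁ m) = F.zero , m
  split a (inj₂ m) = let (y , m') = from a m in F.suc y , m'

inflate-≈ₜ : ∀ {k K n} {Q Q' : Table k K} m → Q ≈ₜ Q' → inflate Q m ≈[ n ] inflate Q' m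
inflate-≈ₜ m eq i x y _ _ = eq i _ _ _

canonical-≈ₜ : ∀ {k K} {Q Q' : Table k K} {m} → Q ≈ₜ Q' → Canonical Q m → Canonical Q' m
canonical-≈ₜ {Q = Q} {Q'} {m} eq can = record
  { positive = positive
  ; reduced = λ x p ne → Break-≈ (inflate-≈ₜ {Q = Q} {Q'} m eq) p (reduced x p ne)
  ; normalised = λ i a b o → normalised' i a b o (normalised i a b o) }
  where
  open Canonical can
  normalised' : ∀ i a b o → Realised (sum m) m a b o ⊎ Q i a b o ≡ _ → Realised (sum m) m a b o ⊎ Q' i a b o ≡ _
  normalised' i a b o (inj₁ r) = inj₁ r
  normalised' i a b o (inj₂ e) = inj₂ (trans (sym (eq i a b o)) e)

module BoundedBreaks (em : EM) {k : ℕ} {C : Class k} (her : Hereditary C) (K : ℕ)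
  (few : ∀ n (s : FinStr k n) → C n s → Runs.breaks em n (ext s) ≤ K)
  (tables : Coded (Table k K) _≈ₜ_) (B : ℕ) (K<B : suc K ℕ.< B) where

  open Runs em
  open Counting em

  private
    module T = Coded tables

  record Presentation {n} (s : FinStr k n) : Set where
    field
      len       : Fin B
      tab       : Fin T.size
      vec       : Vec ℕ (toℕ len)
      total     : sum (toList vec) ≡ n
      presents  : s ≗ₛ fin n (inflate (T.decode tab) (toList vec))
      canonical′ : Canonical (T.decode tab) (toList vec)

  presentation : ∀ {n} (s : FinStr k n) → C n s → Presentation s
  presentation {n} s Cs = record
    { len = proj₁ v ; tab = T.encode Q ; vec = proj₁ (proj₂ v)
    ; total = subst (λ m → sum m ≡ n) (sym toList≡) (sum≡ n g few')
    ; presents = subst (λ m → s ≗ₛ fin n (inflate (T.decode (T.encode Q)) m)) (sym toList≡)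
        λ i x y → trans (sym (fin-ext s i x y)) (trans
          (inflate-table n g few' i _ _ (FP.toℕ<n x) (FP.toℕ<n y)) (sym (T.decode-encode Q i _ _ _)))
    ; canonical′ = subst (Canonical (T.decode (T.encode Q))) (sym toList≡)
        (canonical-≈ₜ (λ i a b o → sym (T.decode-encode Q i a b o)) (canonical n g few')) }
    where
    g : NatStr k
    g = ext s
    few' = few n s Cs
    Q : Table k K
    Q = table n g few'
    v = asVec (runLengths n g few') (ℕP.≤-<-trans (length≤ n g few') K<B)
    toList≡ = proj₂ (proj₂ v)

  module _ {n : ℕ} {s : FinStr k n} (P : Presentation s) where
    open Presentation P
    presented : C n s → C (sum (toList vec)) (fin (sum (toList vec)) (inflate (T.decode tab) (toList vec)))
    presented Cs = subst (λ l → C l (fin l (inflate (T.decode tab) (toList vec)))) (sym total) (member-≗ her presents Cs)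

  decomposition : ∀ n (s : FinStr k n) → C n s → MonoDecomp (toStructure s) (suc K)
  decomposition n s Cs = mono-≗ (λ i x y → sym (presents i x y)) (mono-inflate (T.decode tab) (toList vec))
    where open Presentation (presentation s Cs)

  Inside : (L : ℕ) → Fin T.size → Vec ℕ L → Set
  Inside L c v = C (sum (toList v)) (fin (sum (toList v)) (inflate (T.decode c) (toList v)))

  inside-down : ∀ L c → Down (Inside L c)
  inside-down L c p = inflate-down her (T.decode c) (pointwise-toList p)

  ChainSum : Set
  ChainSum = Σ[ L ∈ ℕ ] (Fin T.size × Vec (Maybe ℕ) L)

  chainSums-of : (L : ℕ) → Fin T.size → List ChainSum
  chainSums-of L c = List.map (λ us → L , c , us) (proj₁ (boxes L (Inside L c) (inside-down L c)))

  structureOf : ChainSum → Structure k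
  structureOf (L , c , us) = sumOfChains (T.decode c) us

  AllInside : ChainSum → Set
  AllInside (L , c , us) = ∀ v → InBox v us → Inside L c v

  chainSums-of-inside : ∀ L c a → a ∈ chainSums-of L c → AllInside a
  chainSums-of-inside L c a mem with ∈-map⁻ (λ us → L , c , us) mem
  ... | us , mem' , refl = proj₂ (proj₂ (boxes L (Inside L c) (inside-down L c))) us mem'

  chainSums-of-covers : ∀ {n} (s : FinStr k n) (P : Presentation s) → C n s → let open Presentation P in
    Σ[ a ∈ ChainSum ] (a ∈ chainSums-of (toℕ len) tab × InAge (structureOf a) s)
  chainSums-of-covers s P Cs =
    (toℕ len , tab , us) , ∈-map⁺ (λ us → toℕ len , tab , us) mem ,
    inAge (T.decode tab) us vec inbox s total presents
    where
    open Presentation P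
    cover = proj₁ (proj₂ (boxes (toℕ len) (Inside (toℕ len) tab) (inside-down (toℕ len) tab))) vec (presented P Cs)
    us = proj₁ cover
    mem = proj₁ (proj₂ cover)
    inbox = proj₂ (proj₂ cover)

  Covering : List ChainSum → Set
  Covering as = (∀ a → a ∈ as → AllInside a)
    × (∀ {n} (s : FinStr k n) → C n s → Σ[ a ∈ ChainSum ] (a ∈ as × InAge (structureOf a) s))

  covering : Σ[ as ∈ List ChainSum ] Covering as
  covering with gather B (λ L → proj₁ (gather T.size (chainSums-of (toℕ L))))
  ... | as , into , from = as ,
    (λ a mem → let (L , mem') = from a mem
                   (c , mem'') = proj₂ (proj₂ (gather T.size (chainSums-of (toℕ L)))) a mem' in
      chainSums-of-inside (toℕ L) c a mem'') ,
    λ s Cs → let P = presentation s Cs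
                 open Presentation P
                 (a , mem , age) = chainSums-of-covers s P Cs in
      a , into len a (proj₁ (proj₂ (gather T.size (chainSums-of (toℕ len)))) tab a mem) , age

  Ages : ℕ → Set₁
  Ages ℓ = Σ[ r ∈ ℕ ] Σ[ R ∈ (Fin r → Structure k) ]
      ( (∀ j → MonoDecomp (R j) (suc ℓ))
      × (∀ n (s : FinStr k n) → C n s ⇔ (Σ[ j ∈ Fin r ] InAge (R j) s)))

  ages : ∀ ℓ → (∀ n (s : FinStr k n) → C n s → MonoDecomp (toStructure s) (suc ℓ)) → Ages ℓ
  ages ℓ decomps = from-covering (proj₁ covering) (proj₂ covering)
    where
    from-covering : ∀ as → Covering as → Ages ℓ
    from-covering as (inside , cover) = length as , (λ j → structureOf (List.lookup as j)) ,
      (λ j → decomp (List.lookup as j) (∈-lookup j)) ,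
      λ n s → mk⇔ (covers s) (λ (j , age) → within (List.lookup as j) (∈-lookup j) s age)
      where
      decomp : ∀ a → a ∈ as → MonoDecomp (structureOf a) (suc ℓ)
      -- The runs would give a decomposition whose size depends on `K`. The bound `suc ℓ` comes from
      -- `decomps` through compactness instead.
      decomp a@(L , c , us) mem = sumOfChains-decomp (T.decode c) us her (inside a mem) em decomps
      within : ∀ a → a ∈ as → ∀ {n} (s : FinStr k n) → InAge (structureOf a) s → C n s
      within a@(L , c , us) mem s = age⊆C (T.decode c) us her (inside a mem) s
      covers : ∀ {n} (s : FinStr k n) → C n s → Σ[ j ∈ _ ] InAge (structureOf (List.lookup as j)) s
      covers s Cs = let (a , mem , age) = cover s Cs in
        Any.index mem , subst (λ a → InAge (structureOf a) s) (lookup-index mem) age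

  Normal : (L : ℕ) → Fin T.size → Vec ℕ L → Set
  Normal L c v = Canonical (T.decode c) (toList v) × Inside L c v

  normal-count : ∀ L c → Σ[ f ∈ (ℕ → ℕ) ] (Poly f × CountedBy (Normal L c) f)
  normal-count L c = tame-count L (Normal L c)
    (tame-∩ L (tame-up L (λ p → canonical-up (T.decode c) (pointwise-toList p))) (tame-down L (inside-down L c)))

  profile : ℕ → ℕ
  profile n = sumFin B λ L → sumFin T.size λ c → proj₁ (normal-count (toℕ L) c) n

  profile-poly : Poly profile
  profile-poly = poly-sumFin B λ L → poly-sumFin T.size λ c → proj₁ (proj₂ (normal-count (toℕ L) c))

  -- Each member has a canonical presentation by `presentation` and only one by `canonical-unique`,
  -- so codes of size `n` enumerate the members with `n` elements up to isomorphism.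
  hasProfile : ∀ n → HasProfile C n (profile n)
  hasProfile n = from-codes (enum-Σ B λ L → enum-Σ T.size λ c → proj₂ (proj₂ (normal-count (toℕ L) c)) n)
    where
    Code : Set
    Code = Σ (Fin B) λ L → Σ (Fin T.size) λ _ → Vec ℕ (toℕ L)
    IsCode : Code → Set
    IsCode (L , c , v) = OfSize (Normal (toℕ L) c) n v
    realise : Code → FinStr k n
    realise (L , c , v) = fin n (inflate (T.decode c) (toList v))
    valid : ∀ a → IsCode a → C n (realise a)
    valid (L , c , v) ((_ , inside) , refl) = inside
    same-code : ∀ a a' → toList (proj₂ (proj₂ a)) ≡ toList (proj₂ (proj₂ a')) → proj₁ (proj₂ a) ≡ proj₁ (proj₂ a') → a ≡ a'
    same-code (L , c , v) (L' , .c , v') e refl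
      with FP.toℕ-injective {i = L} {L'} (trans (sym (VecP.length-toList v)) (trans (cong length e) (VecP.length-toList v')))
    ... | refl = cong (λ v → L , c , v) (toList-inj v v' e)
    realise-inj : ∀ a a' → IsCode a → IsCode a' → realise a ≅ realise a' → a ≡ a'
    realise-inj a@(L , c , v) a'@(L' , c' , v') ((can , _) , e) ((can' , _) , e') iso =
      let (same-runs , same-table) = canonical-unique can can' e e' (≗⇒≈ (≅⇒≗ (realise a) (realise a') iso)) in
      same-code a a' same-runs (T.decode-inj c c' same-table)
    from-codes : Enum _≡_ IsCode (profile n) → HasProfile C n (profile n)
    from-codes (reps , isCode , inj , cover) =
      realise ∘ reps , (λ j → valid (reps j) (isCode j)) ,
      (λ j j' iso → inj j j' (realise-inj (reps j) (reps j') (isCode j) (isCode j') iso)) ,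
      λ s Cs → covered s Cs
      where
      covered : ∀ s → C n s → Σ[ j ∈ _ ] (s ≅ realise (reps j))
      covered s Cs = j , subst (λ a → s ≅ realise a) e (≗⇒≅ presents)
        where
        P = presentation s Cs
        open Presentation P
        found = cover (len , tab , vec) ((canonical′ , presented P Cs) , total)
        j = proj₁ found
        e = proj₂ found

  eventually-polynomial : Σ[ p ∈ List ℚ ] Σ[ n₀ ∈ ℕ ] ∀ n → n₀ ≤ n →
    Σ[ N ∈ ℕ ] (HasProfile C n N × ℕtoℚ N ≡ evalPoly p (ℕtoℚ n))
  eventually-polynomial = let (p , n₀ , eval) = poly⇒eval profile-poly in
    p , n₀ , λ n q → profile n , hasProfile n , eval n q

theorem8p30 : ({ℓ : Level} → ExcludedMiddle ℓ) →
    (k : ℕ) (C : Class k) → Hereditary C →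
    ( (ℓ : ℕ) → (∀ n (s : FinStr k n) → C n s → MonoDecomp (toStructure s) (suc ℓ)) →
    ( (Σ[ r ∈ ℕ ] Σ[ R ∈ (Fin r → Structure k) ]
    ( (∀ j → MonoDecomp (R j) (suc ℓ))
    × (∀ n (s : FinStr k n) → C n s ⇔ (Σ[ j ∈ Fin r ] InAge (R j) s))))
    × (Σ[ p ∈ List ℚ ] Σ[ n₀ ∈ ℕ ] ∀ n → n₀ ≤ n →
    Σ[ N ∈ ℕ ] (HasProfile C n N × ℕtoℚ N ≡ evalPoly p (ℕtoℚ n)))))
    × ( (Σ[ ℓ ∈ ℕ ] ∀ n (s : FinStr k n) → C n s → MonoDecomp (toStructure s) (suc ℓ))
    ⊎ (Σ[ a ∈ ℚ ] Σ[ c ∈ ℚ ] (0ℚ < a × 1ℚ < c ×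
    (Σ[ n₀ ∈ ℕ ] ∀ n → n₀ ≤ n →
    Σ[ N ∈ ℕ ] (HasProfile C n N × (a *ℚ (c ^ℚ n)) ≤ℚ ℕtoℚ N)))))
theorem8p30 em′ k C her = bounded , dichotomy em
  where
  em : EM
  em = em′
  open Runs em using (breaks)

  bounded : (ℓ : ℕ) → (∀ n (s : FinStr k n) → C n s → MonoDecomp (toStructure s) (suc ℓ)) → _
  bounded ℓ decomps = ages ℓ decomps , eventually-polynomial
    where
    -- The bound of `few-breaks` for `suc ℓ` blocks.
    K : ℕ
    K = suc ℓ * suc ℓ * 2
    few : ∀ n (s : FinStr k n) → C n s → breaks n (ext s) ≤ K
    few n s Cs = FewBreaks.few-breaks em (ext s) (mono-≗ (λ i x y → sym (fin-ext s i x y)) (decomps n s Cs))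
    open BoundedBreaks em her K few (tableCoded k K) (suc (suc K)) ℕP.≤-refl

  BreaksBounded : Set
  BreaksBounded = Σ[ K ∈ ℕ ] ∀ n (s : FinStr k n) → C n s → breaks n (ext s) ≤ K

  dichotomy : Dec BreaksBounded → _
  -- At most `K` breaks leave at most `K + 1` runs, and these serve as blocks, so `ℓ` is taken to be
  -- `K`.
  dichotomy (yes (K , few)) = inj₁ (K , BoundedBreaks.decomposition em her K few (tableCoded k K) (suc (suc K)) ℕP.≤-refl)
  dichotomy (no unbounded) = inj₂ (½ , 5/4 , toWitness {a? = 0ℚ ℚP.<? ½} _ , toWitness {a? = 1ℚ ℚP.<? 5/4} _ ,
    0 , λ n _ → let (N , prof) = profile-exists em C her n in
      N , prof , ℚP.≤-trans (exponential-bound n) (ℕtoℚ-mono (ManyBreaks.profile-exponential em her many n N prof)))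
    where
    many : ∀ K → Σ[ n ∈ ℕ ] Σ[ s ∈ FinStr k n ] (C n s × K ℕ.< breaks n (ext s))
    many K = Counting.stable em λ none → unbounded (K , λ n s Cs →
      ℕP.≮⇒≥ λ more → none (n , s , Cs , more))
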